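{- Let $X\subset\mathbb{P}^4_{\mathbb{Q}}$ be the projective closure of the affine surface in $(x,y,u,v)$-space over $\mathbb{Q}$ given by $$x^2+y=u^2,\qquad x+y^2=v^2.$$ Then $X$ is a smooth intersection of two quadrics in $\mathbb{P}^4$, hence a del Pezzo surface of degree $4$ over $\mathbb{Q}$, and the rational map $\phi\colon\mathbb{P}^2\dashrightarrow X$ over $\mathbb{Q}$ given in affine coordinates $(\lambda,\mu)$ on $\mathbb{P}^2$ by $$x=\frac{\mu^2-\lambda^4}{4\lambda^3-4\lambda\mu+1},\quad y=2\lambda x+\lambda^2,\quad u=x+\lambda,\quad v=2\lambda x+\mu$$ is birational, with inverse given by $\lambda=u-x$, $\mu=v-2\lambda x$.
   Context: In homogeneous coordinates $(x:y:u:v:z)$ on $\mathbb{P}^4$, the surface $X$ is given by $x^2+yz=u^2$, $xz+y^2=v^2$. A rational map is birational if it has a rational inverse defined over the same ground field. -}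

module Defs where

open import Algebra.Bundles using (CommutativeRing; RawRing; Semiring)
open import Algebra.Morphism.Structures using (IsRingHomomorphism)
import Algebra.Morphism.Construct.Composition as Composition
import Algebra.Definitions.RawSemiring as RawSemiringDefs
open import Data.Bool.Base using (if_then_else_)
open import Data.Fin.Base using (Fin; zero; suc; fromℕ)
import Data.Fin.Properties as Fin
open import Data.Fin.Patterns using (0F; 1F; 2F; 3F; 4F)
open import Data.Integer.Base using (+_)
open import Data.Nat.Base as ℕ using (ℕ; suc)
open import Data.Product.Base using (Σ; ∃; Σ-syntax; ∃-syntax; _×_; _,_)
open import Data.Rational.Base as ℚ using (ℚ; 0ℚ; 1ℚ; 1/_; _/_)
import Data.Rational.Properties as ℚ
open import Data.Sum.Base using (_⊎_; [_,_])
open import Data.Vec.Functional using (Vector; insertAt; _∷_; [])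
open import Function.Base using (_∘_; id)
open import Level using (0ℓ)
open import Relation.Binary.Definitions using (Decidable)
open import Relation.Binary.PropositionalEquality.Core using (_≡_; _≢_; refl)
open import Relation.Nullary.Decidable.Core using (does)
open import Relation.Nullary.Negation.Core using (¬_)
open import Relation.Unary using (Pred; _∈_; _∉_; _∪_; ｛_｝; ∅)

-- Decidability of equality holds for every field classically.
record Field : Set₁ where
  field
    commutativeRing : CommutativeRing 0ℓ 0ℓ
  open CommutativeRing commutativeRing public
  field
    _≟_     : Decidable _≈_
    1≉0     : ¬ (1# ≈ 0#)
    inverse : ∀ x → ¬ (x ≈ 0#) → ∃[ y ] x * y ≈ 1#

  open RawSemiringDefs (Semiring.rawSemiring semiring) public using (sum)

record Extension (k : Field) : Set₁ where
  field
    top                : Field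
    ι                  : Field.Carrier k → Field.Carrier top
    isRingHomomorphism : IsRingHomomorphism (Field.rawRing k) (Field.rawRing top) ι

  open Field top public

_⟫_ : {k : Field} (E : Extension k) → Extension (Extension.top E) → Extension k
E ⟫ L = record
  { top                = L.top
  ; ι                  = L.ι ∘ E.ι
  ; isRingHomomorphism = Composition.isRingHomomorphism L.trans
                           E.isRingHomomorphism L.isRingHomomorphism
  }
  where
  module E = Extension E
  module L = Extension L

ℚ-field : Field
ℚ-field = record
  { commutativeRing = ℚ.+-*-commutativeRing
  ; _≟_     = ℚ._≟_
  ; 1≉0     = λ ()
  ; inverse = λ x x≢0 → (1/ x) {{ℚ.≢-nonZero x≢0}} , ℚ.*-inverseʳ x {{ℚ.≢-nonZero x≢0}}
  }

-- The polynomial ring k[x₀,…,xₙ₋₁], as the free commutative k-algebra on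
-- n generators: terms modulo the congruence generated by the axioms of
-- commutative rings and the operations of k.

infix  8 :-_
infixl 7 _:*_
infixl 6 _:+_

data Poly (k : Field) (n : ℕ) : Set where
  con       : Field.Carrier k → Poly k n
  var       : Fin n → Poly k n
  _:+_ _:*_ : (p q : Poly k n) → Poly k n
  :-_       : Poly k n → Poly k n

module _ {k : Field} {n : ℕ} where
  private module k = Field k

  infixl 6 _:-_
  infix  4 _≋_

  𝟘 𝟙 : Poly k n
  𝟘 = con k.0#
  𝟙 = con k.1#

  _:-_ : (p q : Poly k n) → Poly k n
  p :- q = p :+ (:- q)

  data _≋_ : Poly k n → Poly k n → Set where
    ≋-refl  : ∀ {p} → p ≋ p
    ≋-sym   : ∀ {p q} → p ≋ q → q ≋ p
    ≋-trans : ∀ {p q r} → p ≋ q → q ≋ r → p ≋ r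

    con-cong : ∀ {a b} → a k.≈ b → con a ≋ con b
    +-cong   : ∀ {p p′ q q′} → p ≋ p′ → q ≋ q′ → p :+ q ≋ p′ :+ q′
    *-cong   : ∀ {p p′ q q′} → p ≋ p′ → q ≋ q′ → p :* q ≋ p′ :* q′
    neg-cong : ∀ {p p′} → p ≋ p′ → :- p ≋ :- p′

    con-+ : ∀ a b → con (a k.+ b) ≋ con a :+ con b
    con-* : ∀ a b → con (a k.* b) ≋ con a :* con b

    +-assoc     : ∀ p q r → (p :+ q) :+ r ≋ p :+ (q :+ r)
    +-comm      : ∀ p q → p :+ q ≋ q :+ p
    +-identityˡ : ∀ p → 𝟘 :+ p ≋ p
    +-inverseˡ  : ∀ p → (:- p) :+ p ≋ 𝟘
    *-assoc     : ∀ p q r → (p :* q) :* r ≋ p :* (q :* r)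
    *-comm      : ∀ p q → p :* q ≋ q :* p
    *-identityˡ : ∀ p → 𝟙 :* p ≋ p
    distribˡ    : ∀ p q r → p :* (q :+ r) ≋ p :* q :+ p :* r

polyRing : Field → ℕ → CommutativeRing 0ℓ 0ℓ
polyRing k n = record
  { Carrier = Poly k n
  ; _≈_ = _≋_ ; _+_ = _:+_ ; _*_ = _:*_ ; -_ = :-_ ; 0# = 𝟘 ; 1# = 𝟙
  ; isCommutativeRing = record
    { isRing = record
      { +-isAbelianGroup = record
        { isGroup = record
          { isMonoid = record
            { isSemigroup = record
              { isMagma = record
                { isEquivalence = record
                  { refl = ≋-refl ; sym = ≋-sym ; trans = ≋-trans }
                ; ∙-cong = +-cong
                }
              ; assoc = +-assoc
              }
            ; identity = +-identityˡ , λ p → ≋-trans (+-comm p 𝟘) (+-identityˡ p)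
            }
          ; inverse = +-inverseˡ , λ p → ≋-trans (+-comm p (:- p)) (+-inverseˡ p)
          ; ⁻¹-cong = neg-cong
          }
        ; comm = +-comm
        }
      ; *-cong = *-cong
      ; *-assoc = *-assoc
      ; *-identity = *-identityˡ , λ p → ≋-trans (*-comm p 𝟙) (*-identityˡ p)
      ; distrib = distribˡ , λ p q r →
          ≋-trans (*-comm (q :+ r) p)
            (≋-trans (distribˡ p q r) (+-cong (*-comm p q) (*-comm p r)))
      }
    ; *-comm = *-comm
    }
  }

module _ {k : Field} {n : ℕ} where
  open RawSemiringDefs (Semiring.rawSemiring (CommutativeRing.semiring (polyRing k n))) public
    using () renaming (_^_ to _:^_; sum to Σₚ)

  fold : (S : RawRing 0ℓ 0ℓ) (ι : Field.Carrier k → RawRing.Carrier S) →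
         Vector (RawRing.Carrier S) n → Poly k n → RawRing.Carrier S
  fold S ι ρ (con a)  = ι a
  fold S ι ρ (var i)  = ρ i
  fold S ι ρ (p :+ q) = RawRing._+_ S (fold S ι ρ p) (fold S ι ρ q)
  fold S ι ρ (p :* q) = RawRing._*_ S (fold S ι ρ p) (fold S ι ρ q)
  fold S ι ρ (:- p)   = RawRing.-_ S (fold S ι ρ p)

  subst : ∀ {m} → Vector (Poly k m) n → Poly k n → Poly k m
  subst {m} = fold (CommutativeRing.rawRing (polyRing k m)) con

  module _ (E : Extension k) where
    private module E = Extension E

    eval : Vector E.Carrier n → Poly k n → E.Carrier
    eval = fold E.rawRing E.ι

    extendScalars : Poly k n → Poly E.top n
    extendScalars =
      fold (CommutativeRing.rawRing (polyRing E.top n)) (con ∘ E.ι) var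

  ∂ : Fin n → Poly k n → Poly k n
  ∂ i (con a)  = 𝟘
  ∂ i (var j)  = if does (i Fin.≟ j) then 𝟙 else 𝟘
  ∂ i (p :+ q) = ∂ i p :+ ∂ i q
  ∂ i (p :* q) = ∂ i p :* q :+ p :* ∂ i q
  ∂ i (:- p)   = :- ∂ i p

  -- In particular 𝟘 is homogeneous of every degree.
  data Homogeneous : ℕ → Poly k n → Set where
    con  : ∀ a → Homogeneous 0 (con a)
    var  : ∀ i → Homogeneous 1 (var i)
    zero : ∀ {d} → Homogeneous d 𝟘
    add  : ∀ {d p q} → Homogeneous d p → Homogeneous d q → Homogeneous d (p :+ q)
    mul  : ∀ {d e p q} → Homogeneous d p → Homogeneous e q → Homogeneous (d ℕ.+ e) (p :* q)
    neg  : ∀ {d p} → Homogeneous d p → Homogeneous d (:- p)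
    resp : ∀ {d p q} → p ≋ q → Homogeneous d p → Homogeneous d q

  -- The ideal generated by G.
  data ⟨_⟩ (G : Pred (Poly k n) 0ℓ) : Pred (Poly k n) 0ℓ where
    gen  : ∀ {p} → p ∈ G → p ∈ ⟨ G ⟩
    zero : 𝟘 ∈ ⟨ G ⟩
    add  : ∀ {p q} → p ∈ ⟨ G ⟩ → q ∈ ⟨ G ⟩ → (p :+ q) ∈ ⟨ G ⟩
    mul  : ∀ p {q} → q ∈ ⟨ G ⟩ → (p :* q) ∈ ⟨ G ⟩
    resp : ∀ {p q} → p ≋ q → p ∈ ⟨ G ⟩ → q ∈ ⟨ G ⟩

  infix 4 _≡_[mod_]
  _≡_[mod_] : Poly k n → Poly k n → Pred (Poly k n) 0ℓ → Set
  p ≡ q [mod I ] = (p :- q) ∈ I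

-- Dehomogenisation with respect to the last variable.
dehom : ∀ {k n} → Poly k (suc n) → Poly k n
dehom {n = n} = subst (insertAt var (fromℕ n) 𝟙)

record ClosedSubscheme (k : Field) (n : ℕ) : Set₁ where
  field
    Gen         : Pred (Poly k (suc n)) 0ℓ
    homogeneous : ∀ {p} → p ∈ Gen → ∃[ d ] Homogeneous d p

  ideal : Pred (Poly k (suc n)) 0ℓ
  ideal = ⟨ Gen ⟩

open ClosedSubscheme using (Gen; ideal)

ℙ : (k : Field) (n : ℕ) → ClosedSubscheme k n
ℙ k n = record { Gen = ∅ ; homogeneous = λ () }

-- The closure in ℙⁿ of the closed subscheme of 𝔸ⁿ = {xₙ ≠ 0} cut out by G.
projectiveClosure : ∀ {k n} → Pred (Poly k n) 0ℓ → ClosedSubscheme k n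
projectiveClosure G = record
  { Gen         = λ p → (∃[ d ] Homogeneous d p) × dehom p ∈ ⟨ G ⟩
  ; homogeneous = λ (h , _) → h
  }

-- The scheme-theoretic intersection of two hypersurfaces.
intersection : ∀ {k n d e} {p q : Poly k (suc n)} →
               Homogeneous d p → Homogeneous e q → ClosedSubscheme k n
intersection {p = p} {q} hp hq = record
  { Gen         = ｛ p ｝ ∪ ｛ q ｝
  ; homogeneous = [ (λ { refl → _ , hp }) , (λ { refl → _ , hq }) ]
  }

-- The homogeneous ideal of X generates a prime ideal, not containing the
-- irrelevant ideal, over every field extension; so this presupposes that X is
-- given by a saturated ideal.
IsGeometricallyIntegral : ∀ {k n} → ClosedSubscheme k n → Set₁
IsGeometricallyIntegral {k} {n} X =
  (E : Extension k) →
  let I : Pred (Poly (Extension.top E) (suc n)) 0ℓ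
      I = ⟨ (λ q → ∃[ p ] p ∈ Gen X × q ≡ extendScalars E p) ⟩
  in (∀ p q → (p :* q) ∈ I → p ∈ I ⊎ q ∈ I) × (∃[ i ] var i ∉ I)

-- Proportionality of vectors, tested on 2 × 2 minors: for nonzero v and w
-- this is equality in projective space, and for v nonzero it says that w
-- lies on the line spanned by v.
Proportional : (K : Field) → ∀ {n} → (v w : Vector (Field.Carrier K) n) → Set
Proportional K v w = ∀ i j → v i * w j ≈ v j * w i
  where open Field K

module _ {k : Field} {n : ℕ} (X : ClosedSubscheme k n) (E : Extension k) where
  open Extension E

  record Point : Set where
    field
      coords  : Vector Carrier (suc n)
      nonzero : ∃[ i ] ¬ (coords i ≈ 0#)
      onX     : ∀ {p} → p ∈ Gen X → eval E coords p ≈ 0#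

module _ {k : Field} {n : ℕ} {X : ClosedSubscheme k n} {E : Extension k} (P : Point X E) where
  open Extension E
  open Point P

  at : Poly k (suc n) → Carrier
  at = eval E coords

  differential : Poly k (suc n) → Vector Carrier (suc n) → Carrier
  differential p w = sum λ i → at (∂ i p) * w i

  -- Tangent vectors to the affine cone over X at (a representative of) P;
  -- the tangent space of X at P is their space modulo the line spanned by P.
  IsTangent : Pred (Vector Carrier (suc n)) 0ℓ
  IsTangent w = ∀ {p} → p ∈ Gen X → differential p w ≈ 0#

-- The Jacobian criterion, at all geometric points: near P, X is cut out by
-- n ∸ r equations whose Jacobian matrix has independent rows at P.
IsSmoothOfDimension : ∀ {k n} → ℕ → ClosedSubscheme k n → Set₁
IsSmoothOfDimension {k} {n} r X =
  (E : Extension k) (P : Point X E) →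
  let open Extension E in
  ∃[ c ] r ℕ.+ c ≡ n × Σ[ f ∈ Vector (Poly k (suc n)) c ]
    (∀ i → f i ∈ ideal X × ∃[ d ] Homogeneous d (f i)) ×
    (∀ (a : Vector Carrier c) →
       (∀ j → sum (λ i → a i * at P (∂ j (f i))) ≈ 0#) → ∀ i → a i ≈ 0#) ×
    (∀ {g} → g ∈ Gen X →
       ∃[ h ] ¬ (at P h ≈ 0#) × (h :* g) ∈ ⟨ (λ p → ∃[ i ] p ≡ f i) ⟩)

record RationalMap {k n m} (X : ClosedSubscheme k n) (Y : ClosedSubscheme k m) : Set where
  field
    coords      : Vector (Poly k (suc n)) (suc m)
    degree      : ℕ
    homogeneous : ∀ i → Homogeneous degree (coords i)
    nonzero     : ∃[ i ] coords i ∉ ideal X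
    lands       : ∀ {p} → p ∈ Gen Y → subst coords p ∈ ideal X

-- The tuples v and w, not all of whose entries vanish on X, represent the
-- same rational map.
SameOn : ∀ {k n m} → ClosedSubscheme k n → (v w : Vector (Poly k (suc n)) m) → Set
SameOn X v w = ∀ i j → v i :* w j ≡ v j :* w i [mod ideal X ]

module _ {k : Field} {n m : ℕ} {X : ClosedSubscheme k n} {Y : ClosedSubscheme k m} where

  -- ψ ∘ φ is defined, and equal to the identity of X.
  IsLeftInverse : RationalMap Y X → RationalMap X Y → Set
  IsLeftInverse ψ φ = (∃[ i ] composite i ∉ ideal X) × SameOn X composite var
    where
    composite : Vector (Poly k (suc n)) (suc n)
    composite i = subst (RationalMap.coords φ) (RationalMap.coords ψ i)

  IsRegular : RationalMap X Y → Set₁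
  IsRegular φ = (E : Extension k) (P : Point X E) → let open Extension E in
    Σ[ φ′ ∈ RationalMap X Y ]
      SameOn X (RationalMap.coords φ) (RationalMap.coords φ′) ×
      (∃[ i ] ¬ (at P (RationalMap.coords φ′ i) ≈ 0#))

AreInverse : ∀ {k n m} {X : ClosedSubscheme k n} {Y : ClosedSubscheme k m} →
             RationalMap X Y → RationalMap Y X → Set
AreInverse φ ψ = IsLeftInverse ψ φ × IsLeftInverse φ ψ

IsBirational : ∀ {k n m} {X : ClosedSubscheme k n} {Y : ClosedSubscheme k m} →
               RationalMap X Y → Set
IsBirational {X = X} {Y} φ = Σ[ ψ ∈ RationalMap Y X ] AreInverse φ ψ

IsIsomorphic : ∀ {k n m} → ClosedSubscheme k n → ClosedSubscheme k m → Set₁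
IsIsomorphic X Y =
  Σ[ φ ∈ RationalMap X Y ] Σ[ ψ ∈ RationalMap Y X ]
    IsRegular φ × IsRegular ψ × AreInverse φ ψ

module _ {k : Field} {n : ℕ} (X : ClosedSubscheme k n) where

  -- Rational sections of 𝒪(d - e).
  record Fraction (d e : ℕ) : Set where
    field
      num     : Poly k (suc n)
      den     : Poly k (suc n)
      num-hom : Homogeneous d num
      den-hom : Homogeneous e den
      den≢0   : den ∉ ideal X

  record RationalFunction : Set where
    field
      degree   : ℕ
      fraction : Fraction degree degree
    open Fraction fraction public

  -- The 2-form c da ∧ db.
  record RationalTwoForm : Set where
    constructor _·d_∧d_
    field
      c a b : RationalFunction

  -- Derivations of the homogeneous coordinate ring R of X, given by the
  -- images of the variables.  They span the derivations of Frac R.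
  VectorField : Pred (Vector (Poly k (suc n)) (suc n)) 0ℓ
  VectorField w = ∀ {p} → p ∈ Gen X → Σₚ (λ i → w i :* ∂ i p) ∈ ideal X

module _ {k : Field} {n : ℕ} {X : ClosedSubscheme k n} where

  -- (den a)² da(w)
  d[_] : RationalFunction X → Vector (Poly k (suc n)) (suc n) → Poly k (suc n)
  d[ a ] w = den :* Σₚ (λ i → w i :* ∂ i num) :- num :* Σₚ (λ i → w i :* ∂ i den)
    where open RationalFunction a

  private module RF = RationalFunction

  -- The value on (w , w′) of c da ∧ db is numerator / denominator.
  numerator : RationalTwoForm X → (w w′ : Vector (Poly k (suc n)) (suc n)) → Poly k (suc n)
  numerator (c ·d a ∧d b) w w′ =
    RF.num c :* (d[ a ] w :* d[ b ] w′ :- d[ a ] w′ :* d[ b ] w)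

  denominator : RationalTwoForm X → Poly k (suc n)
  denominator (c ·d a ∧d b) = RF.den c :* (RF.den a :^ 2 :* RF.den b :^ 2)

  -- A 2-form on X is determined by its pullback to the affine cone, and
  -- that by its values on derivations.
  _≈Ω_ : RationalTwoForm X → RationalTwoForm X → Set
  ω ≈Ω η = ∀ {w w′} → VectorField X w → VectorField X w′ →
    numerator ω w w′ :* denominator η ≡ numerator η w w′ :* denominator ω [mod ideal X ]

  -- (den a)(P)² da(w) for a tangent vector w at P
  d[_]at : {E : Extension k} → RationalFunction X → (P : Point X E) →
           let open Extension E in Vector Carrier (suc n) → Carrier
  d[_]at {E} a P w =
    at P den * differential P num w - at P num * differential P den w
    where
    open Extension E
    open RationalFunction a

  -- a and b are regular at P and da, db form a basis of the cotangent space
  -- at P (X being a surface which is smooth at P).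
  record AreLocalCoordinates {E : Extension k} (P : Point X E) (a b : RationalFunction X) : Set where
    open Extension E
    field
      a-regular   : ¬ (at P (RF.den a) ≈ 0#)
      b-regular   : ¬ (at P (RF.den b) ≈ 0#)
      independent : ∀ w → IsTangent P w → d[ a ]at P w ≈ 0# → d[ b ]at P w ≈ 0# →
                    Proportional top (Point.coords P) w

record IsSmoothProjectiveSurface {k n} (X : ClosedSubscheme k n) : Set₁ where
  field
    geometricallyIntegral : IsGeometricallyIntegral X
    smooth                : IsSmoothOfDimension 2 X

-- m div ω = div s near P, for a rational 2-form ω and a rational section s of
-- 𝒪(-1): ω = h da ∧ db with local coordinates a, b at P, and hᵐ = s t with a
-- local generator t of 𝒪(1).
record DivisorsAgreeAt {k n} {X : ClosedSubscheme k n} {E : Extension k} {e : ℕ}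
                       (m : ℕ) (ω : RationalTwoForm X) (s : Fraction X e (suc e))
                       (P : Point X E) : Set where
  open Extension E
  field
    a b h       : RationalFunction X
    coordinates : AreLocalCoordinates P a b
    ω≈          : ω ≈Ω (h ·d a ∧d b)
    {d}         : ℕ
    t           : Fraction X (suc d) d

  private
    module h = RationalFunction h
    module s = Fraction s
    module t = Fraction t

  field
    t-num≢0 : ¬ (at P t.num ≈ 0#)
    t-den≢0 : ¬ (at P t.den ≈ 0#)
    hᵐ≈st   : h.num :^ m :* (s.den :* t.den) ≡ s.num :* t.num :* h.den :^ m [mod ideal X ]

-- m K ~ - H on the surface X ⊂ ℙⁿ, where K = div ω and H is the hyperplane
-- class.
record IsPluricanonicallyMinusHyperplane {k n} (m : ℕ) (X : ClosedSubscheme k n) : Set₁ where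
  field
    ω     : RationalTwoForm X
    e     : ℕ
    s     : Fraction X e (suc e)
    s≢0   : Fraction.num s ∉ ideal X
    local : (E : Extension k) (P : Point X E) → DivisorsAgreeAt m ω s P

-- H · H = d on the smooth surface X ⊂ ℙⁿ: over some extension of k there are
-- two hyperplanes ℓ = ℓ′ = 0 meeting X transversally in d points, and in no
-- further points over any larger field.
record HasDegree {k n} (d : ℕ) (X : ClosedSubscheme k n) : Set₁ where
  field
    E : Extension k
  open Extension E
  field
    ℓ ℓ′   : Vector Carrier (suc n)
    points : Fin d → Point X E

  coords : Fin d → Vector Carrier (suc n)
  coords i = Point.coords (points i)

  _·_ : (v w : Vector Carrier (suc n)) → Carrier
  v · w = sum λ i → v i * w i

  field
    on-ℓ        : ∀ i → ℓ · coords i ≈ 0#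
    on-ℓ′       : ∀ i → ℓ′ · coords i ≈ 0#
    distinct    : ∀ i j → i ≢ j → ¬ Proportional top (coords i) (coords j)
    transversal : ∀ i w → IsTangent (points i) w → ℓ · w ≈ 0# → ℓ′ · w ≈ 0# →
                  Proportional top (coords i) w
    complete    : (L : Extension top) (P : Point X (E ⟫ L)) →
      let module L = Extension L
          Q = Point.coords P
      in L.sum (λ i → L.ι (ℓ i) L.* Q i) L.≈ L.0# →
         L.sum (λ i → L.ι (ℓ′ i) L.* Q i) L.≈ L.0# →
         ∃[ i ] Proportional L.top (L.ι ∘ coords i) Q

-- X is a smooth, projective, geometrically integral surface, - K is ample and
-- K² = d.  Ampleness: some multiple - m K with m ≥ 1 is very ample, i.e. X is
-- isomorphic to a surface Y ⊂ ℙᴺ on which - m K is the hyperplane class; then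
-- m² K² is the degree of Y.
record IsDelPezzo {k n} (d : ℕ) (X : ClosedSubscheme k n) : Set₁ where
  field
    isSurface   : IsSmoothProjectiveSurface X
    {N}         : ℕ
    Y           : ClosedSubscheme k N
    Y-isSurface : IsSmoothProjectiveSurface Y
    X≅Y         : IsIsomorphic X Y
    m           : ℕ
    m≥1         : m ℕ.≥ 1
    -mK∼H       : IsPluricanonicallyMinusHyperplane m Y
    m²K²        : HasDegree (m ℕ.* m ℕ.* d) Y

module Affine where
  x y u v : Poly ℚ-field 4
  x = var 0F
  y = var 1F
  u = var 2F
  v = var 3F

  equations : Pred (Poly ℚ-field 4) 0ℓ
  equations = ｛ x :* x :+ y :- u :* u ｝ ∪ ｛ x :+ y :* y :- v :* v ｝

X : ClosedSubscheme ℚ-field 4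
X = projectiveClosure Affine.equations

module Projective where
  x y u v z : Poly ℚ-field 5
  x = var 0F
  y = var 1F
  u = var 2F
  v = var 3F
  z = var 4F

  Q₁ Q₂ : Poly ℚ-field 5
  Q₁ = x :* x :+ y :* z :- u :* u
  Q₂ = x :* z :+ y :* y :- v :* v

  Q₁-quadratic : Homogeneous 2 Q₁
  Q₁-quadratic = add (add (mul (var _) (var _)) (mul (var _) (var _))) (neg (mul (var _) (var _)))

  Q₂-quadratic : Homogeneous 2 Q₂
  Q₂-quadratic = add (add (mul (var _) (var _)) (mul (var _) (var _))) (neg (mul (var _) (var _)))

open Projective public using (Q₁; Q₂; Q₁-quadratic; Q₂-quadratic)

ℙ² : ClosedSubscheme ℚ-field 2
ℙ² = ℙ ℚ-field 2

module AffinePlane where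
  ƛ μ 𝟚 𝟜 : Poly ℚ-field 2
  ƛ = var 0F
  μ = var 1F
  𝟚 = con (+ 2 / 1)
  𝟜 = con (+ 4 / 1)

  -- The formulas for x = X′/Z′, y = Y′/Z′, u = U′/Z′, v = V′/Z′ in ℚ(λ, μ),
  -- multiplied through by the denominators.
  record φ-Formulas (X′ Y′ U′ V′ Z′ : Poly ℚ-field 2) : Set where
    field
      defined   : ¬ (Z′ ≋ 𝟘)
      x-formula : X′ :* (𝟜 :* ƛ :^ 3 :- 𝟜 :* ƛ :* μ :+ 𝟙) ≋ (μ :^ 2 :- ƛ :^ 4) :* Z′
      y-formula : Y′ ≋ 𝟚 :* ƛ :* X′ :+ ƛ :^ 2 :* Z′
      u-formula : U′ ≋ X′ :+ ƛ :* Z′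
      v-formula : V′ ≋ 𝟚 :* ƛ :* X′ :+ μ :* Z′

IsGivenByφ : RationalMap ℙ² X → Set
IsGivenByφ φ = AffinePlane.φ-Formulas (p 0F) (p 1F) (p 2F) (p 3F) (p 4F)
  where
  p : Vector (Poly ℚ-field 2) 5
  p i = dehom (RationalMap.coords φ i)

module AffineSurface where
  open Affine

  𝟚 : Poly ℚ-field 4
  𝟚 = con (+ 2 / 1)

  -- The formulas for λ = Λ/N, μ = M/N in the function field of X, multiplied
  -- through by the denominators.
  record ψ-Formulas (Λ M N : Poly ℚ-field 4) : Set where
    field
      defined   : N ∉ ⟨ equations ⟩
      ƛ-formula : Λ ≡ (u :- x) :* N [mod ⟨ equations ⟩ ]
      μ-formula : M ≡ v :* N :- 𝟚 :* Λ :* x [mod ⟨ equations ⟩ ]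

IsGivenByψ : RationalMap X ℙ² → Set
IsGivenByψ ψ = AffineSurface.ψ-Formulas (p 0F) (p 1F) (p 2F)
  where
  p : Vector (Poly ℚ-field 4) 3
  p i = dehom (RationalMap.coords ψ i)

{-# OPTIONS --safe #-}
module Submission where

-- The theorem rests on an explicit description of the homogeneous coordinate ring
-- of X.  Modulo the quadrics Q₁ and Q₂ every polynomial has a unique normal form
-- a + b u + c v + d u v with a, b, c, d in k[x,y,z], so that the residue class ring
-- is k[x,y,z][√A][√B] for A = x² + y z and B = x z + y².  Over a field k in which 2
-- is invertible, none of A, B, A B is a square in k(x,y,z) (poly-domain and the
-- NonSquare lemmas, by expansion in powers of one variable), and therefore this
-- ring is a domain (√-domain, √-nonSquare).  So Q₁ and Q₂ generate a prime ideal
-- over every extension of ℚ, which is geometric integrality.  It also follows that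
-- z is a non-zero-divisor, and that the quadrics generate the ideal of the
-- projective closure: a homogeneous polynomial is a power of z times its
-- dehomogenisation at x/z, y/z, u/z, v/z in the total ring of fractions
-- (homogeneous∈quadrics).
--
-- At every geometric point P some 2 × 2 minor of the Jacobian matrix of Q₁ and Q₂
-- and some coordinate whose column is not in this minor are nonzero.  Seven charts,
-- consisting of such a minor and coordinate l, cover X (AtPoint.chart).  A nonzero
-- minor gives smoothness.  If i and j are the remaining columns, then x_i / x_l and
-- x_j / x_l are local coordinates (tangent-proportional).  By duality of Plücker
-- coordinates (chartDet-minor), the 2-form dx ∧ dy / (u v) is
-- 4 x_l³ / (z M) d(x_i / x_l) ∧ d(x_j / x_l), where M is the minor, and so its divisor
-- is minus the hyperplane section z = 0.  Thus - K is the hyperplane class, which is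
-- very ample.  Its self-intersection is 4 because the hyperplanes z = 0 and x = y
-- meet X transversally in the four points (1 : 1 : ± 1 : ± 1 : 0).
--
-- The parametrisation lies on X, and the two composites are multiples of the
-- identity, by polynomial identities; on X they use y z = (u - x)² + 2 (u - x) x.

open import Defs
open import Data.Product.Base using (Σ-syntax; _×_)
open import Relation.Unary using (_≐_)

open import Algebra.Bundles using (CommutativeRing; CommutativeSemiring; RawRing)
import Algebra.Definitions.RawSemiring as RawSemiringDefs
import Algebra.Morphism.Construct.Composition as Composition
import Algebra.Morphism.Construct.Identity as Identity
open import Algebra.Morphism.Structures using (IsRingHomomorphism)
import Algebra.Properties.AbelianGroup as AbelianGroupProperties
import Algebra.Properties.Ring as RingProperties
import Algebra.Properties.Semiring.Exp as Exp
import Algebra.Properties.Semiring.Mult.TCOptimised as Multiples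
import Algebra.Solver.Ring
open import Algebra.Solver.Ring.AlmostCommutativeRing
  using (fromCommutativeRing; _-Raw-AlmostCommutative⟶_)
open import Data.Bool.Base using (T; true; false; if_then_else_)
open import Data.Fin.Base using (Fin; zero; suc; inject₁; fromℕ)
open import Data.Fin.Patterns using (0F; 1F; 2F; 3F; 4F)
import Data.Fin.Properties as Fin
open import Data.Integer.Base as ℤ using (0ℤ; 1ℤ; +_)
import Data.Integer.Properties as ℤ
open import Data.Maybe.Base as Maybe using (just; is-just)
open import Data.Nat.Base as ℕ using (ℕ; suc; z≤n; s≤s)
open import Data.Product.Base using (_,_; ∃-syntax; proj₁; proj₂)
open import Data.Rational.Base as ℚ using (ℚ; _/_)
import Data.Rational.Properties as ℚ
open import Data.Sum.Base as Sum using (_⊎_; inj₁; inj₂; [_,_]′)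
import Data.Vec.Base as Vec
open import Data.Vec.Functional using (Vector; _∷_; []; insertAt)
import Data.Vec.Properties as Vec
open import Function.Base using (_∘_)
open import Level using (0ℓ)
import Relation.Binary.Reasoning.Setoid as SetoidReasoning
open import Relation.Binary.PropositionalEquality.Core as ≡ using (_≡_; _≢_; refl)
open import Relation.Binary.Structures using (IsEquivalence)
open import Relation.Nullary.Decidable.Core using (Dec; yes; no; does; dec⇒maybe; map′)
open import Relation.Nullary.Negation.Core using (¬_; contradiction)
open import Relation.Unary using (Pred; _∈_; _∉_; _∪_; ｛_｝)

-- Commutative rings

-- The ring solver for R with integer coefficients.  In its syntax ⊕, ⊗, ⊝, ⊖
-- are the operations, κ the constants and ⊜ the equality.
module IntegerCoefficients (R : CommutativeRing 0ℓ 0ℓ) where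
  private
    module R where
      open CommutativeRing R public
      open RingProperties ring public
      open AbelianGroupProperties +-abelianGroup public
        using (⁻¹-∙-comm) renaming (ε⁻¹≈ε to -0≈0)
      open Multiples semiring public
  open R using (_≈_)
  open SetoidReasoning R.setoid

  -- The unique ring homomorphism from ℤ; fromℤ 1 is 1# by definition.
  fromℤ : ℤ.ℤ → R.Carrier
  fromℤ (ℤ.+ n)      = n R.× R.1#
  fromℤ (ℤ.-[1+ n ]) = R.- (suc n R.× R.1#)

  private
    castℕ : ℕ → R.Carrier
    castℕ n = n R.× R.1#

    castℕ-suc : ∀ n → castℕ (suc n) ≈ R.1# R.+ castℕ n
    castℕ-suc n = R.×-homo-+ R.1# 1 n

    cancel : ∀ a b c → (c R.+ a) R.+ R.- (c R.+ b) ≈ a R.+ R.- b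
    cancel a b c = begin
      (c R.+ a) R.+ R.- (c R.+ b)         ≈⟨ R.+-cong (R.+-comm c a) (R.-‿cong (R.+-comm c b)) ⟩
      (a R.+ c) R.+ R.- (b R.+ c)         ≈⟨ R.+-congˡ (R.⁻¹-∙-comm b c) ⟨
      (a R.+ c) R.+ (R.- b R.+ R.- c)     ≈⟨ R.+-congˡ (R.+-comm _ _) ⟩
      (a R.+ c) R.+ (R.- c R.+ R.- b)     ≈⟨ R.+-assoc a c _ ⟩
      a R.+ (c R.+ (R.- c R.+ R.- b))     ≈⟨ R.+-congˡ (R.+-assoc c _ _) ⟨
      a R.+ ((c R.+ R.- c) R.+ R.- b)     ≈⟨ R.+-congˡ (R.+-congʳ (R.-‿inverseʳ c)) ⟩
      a R.+ (R.0# R.+ R.- b)              ≈⟨ R.+-congˡ (R.+-identityˡ _) ⟩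
      a R.+ R.- b                         ∎

    fromℤ-⊖ : ∀ m n → fromℤ (m ℤ.⊖ n) ≈ castℕ m R.+ R.- castℕ n
    fromℤ-⊖ ℕ.zero    ℕ.zero    = R.sym (R.-‿inverseʳ _)
    fromℤ-⊖ ℕ.zero    (suc n) = R.sym (R.+-identityˡ _)
    fromℤ-⊖ (suc m) ℕ.zero    = R.sym (R.trans (R.+-congˡ R.-0≈0) (R.+-identityʳ _))
    fromℤ-⊖ (suc m) (suc n) = begin
      fromℤ (suc m ℤ.⊖ suc n)                            ≡⟨ ≡.cong fromℤ (ℤ.[1+m]⊖[1+n]≡m⊖n m n) ⟩
      fromℤ (m ℤ.⊖ n)                                    ≈⟨ fromℤ-⊖ m n ⟩
      castℕ m R.+ R.- castℕ n                            ≈⟨ cancel _ _ R.1# ⟨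
      (R.1# R.+ castℕ m) R.+ R.- (R.1# R.+ castℕ n)      ≈⟨ R.+-cong (castℕ-suc m) (R.-‿cong (castℕ-suc n)) ⟨
      castℕ (suc m) R.+ R.- castℕ (suc n)                ∎

    fromℤ-+ : ∀ i j → fromℤ (i ℤ.+ j) ≈ fromℤ i R.+ fromℤ j
    fromℤ-+ (ℤ.+ m)      (ℤ.+ n)      = R.×-homo-+ R.1# m n
    fromℤ-+ (ℤ.+ m)      (ℤ.-[1+ n ]) = fromℤ-⊖ m (suc n)
    fromℤ-+ (ℤ.-[1+ m ]) (ℤ.+ n)      = R.trans (fromℤ-⊖ n (suc m)) (R.+-comm _ _)
    fromℤ-+ (ℤ.-[1+ m ]) (ℤ.-[1+ n ]) = begin
      R.- castℕ (suc (suc (m ℕ.+ n)))             ≈⟨ R.-‿cong (castℕ-suc (suc (m ℕ.+ n))) ⟩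
      R.- (R.1# R.+ castℕ (suc m ℕ.+ n))          ≈⟨ R.-‿cong (R.+-congˡ (R.×-homo-+ R.1# (suc m) n)) ⟩
      R.- (R.1# R.+ (castℕ (suc m) R.+ castℕ n))  ≈⟨ R.-‿cong (R.+-assoc _ _ _) ⟨
      R.- ((R.1# R.+ castℕ (suc m)) R.+ castℕ n)  ≈⟨ R.-‿cong (R.+-congʳ (R.+-comm _ _)) ⟩
      R.- ((castℕ (suc m) R.+ R.1#) R.+ castℕ n)  ≈⟨ R.-‿cong (R.+-assoc _ _ _) ⟩
      R.- (castℕ (suc m) R.+ (R.1# R.+ castℕ n))  ≈⟨ R.-‿cong (R.+-congˡ (castℕ-suc n)) ⟨
      R.- (castℕ (suc m) R.+ castℕ (suc n))       ≈⟨ R.⁻¹-∙-comm _ _ ⟨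
      R.- castℕ (suc m) R.+ R.- castℕ (suc n)     ∎

    fromℤ-neg : ∀ i → fromℤ (ℤ.- i) ≈ R.- fromℤ i
    fromℤ-neg (ℤ.+ ℕ.zero)   = R.sym R.-0≈0
    fromℤ-neg (ℤ.+ suc n)    = R.refl
    fromℤ-neg (ℤ.-[1+ n ])   = R.sym (R.-‿involutive _)

    fromℤ-+* : ∀ m j → fromℤ (ℤ.+ m ℤ.* j) ≈ castℕ m R.* fromℤ j
    fromℤ-+* m (ℤ.+ n)      = R.trans
      (R.reflexive (≡.cong fromℤ (≡.sym (ℤ.pos-* m n)))) (R.×1-homo-* m n)
    fromℤ-+* m (ℤ.-[1+ n ]) = begin
      fromℤ (ℤ.+ m ℤ.* ℤ.- ℤ.+ suc n)    ≡⟨ ≡.cong fromℤ (ℤ.neg-distribʳ-* (ℤ.+ m) (ℤ.+ suc n)) ⟨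
      fromℤ (ℤ.- (ℤ.+ m ℤ.* ℤ.+ suc n))  ≈⟨ fromℤ-neg (ℤ.+ m ℤ.* ℤ.+ suc n) ⟩
      R.- fromℤ (ℤ.+ m ℤ.* ℤ.+ suc n)    ≈⟨ R.-‿cong (fromℤ-+* m (ℤ.+ suc n)) ⟩
      R.- (castℕ m R.* castℕ (suc n))    ≈⟨ R.-‿distribʳ-* _ _ ⟩
      castℕ m R.* R.- castℕ (suc n)      ∎

    fromℤ-* : ∀ i j → fromℤ (i ℤ.* j) ≈ fromℤ i R.* fromℤ j
    fromℤ-* (ℤ.+ m)      j = fromℤ-+* m j
    fromℤ-* (ℤ.-[1+ m ]) j = begin
      fromℤ (ℤ.- ℤ.+ suc m ℤ.* j)    ≡⟨ ≡.cong fromℤ (ℤ.neg-distribˡ-* (ℤ.+ suc m) j) ⟨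
      fromℤ (ℤ.- (ℤ.+ suc m ℤ.* j))  ≈⟨ fromℤ-neg (ℤ.+ suc m ℤ.* j) ⟩
      R.- fromℤ (ℤ.+ suc m ℤ.* j)    ≈⟨ R.-‿cong (fromℤ-+* (suc m) j) ⟩
      R.- (castℕ (suc m) R.* fromℤ j) ≈⟨ R.-‿distribˡ-* _ _ ⟩
      R.- castℕ (suc m) R.* fromℤ j  ∎

    morphism : ℤ.+-*-rawRing -Raw-AlmostCommutative⟶ fromCommutativeRing R
    morphism = record
      { ⟦_⟧ = fromℤ ; +-homo = fromℤ-+ ; *-homo = fromℤ-* ; -‿homo = fromℤ-neg
      ; 0-homo = R.refl ; 1-homo = R.refl }

  open Algebra.Solver.Ring ℤ.+-*-rawRing (fromCommutativeRing R) morphism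
    (λ i j → Maybe.map (λ i≡j → R.reflexive (≡.cong fromℤ i≡j)) (dec⇒maybe (i ℤ.≟ j)))
    public using (solve)
    renaming (_:+_ to _⊕_; _:*_ to _⊗_; :-_ to ⊝_; _:-_ to _⊖_; con to κ; _:=_ to _⊜_)

-- The axioms of a commutative ring without the redundant ones.
record RingAxioms {A : Set} (_≈_ : A → A → Set) (_+_ _*_ : A → A → A) (-_ : A → A)
                  (0# 1# : A) : Set where
  field
    isEquivalence : IsEquivalence _≈_
    add-cong      : ∀ {a a′ b b′} → a ≈ a′ → b ≈ b′ → (a + b) ≈ (a′ + b′)
    mul-cong      : ∀ {a a′ b b′} → a ≈ a′ → b ≈ b′ → (a * b) ≈ (a′ * b′)
    opp-cong      : ∀ {a a′} → a ≈ a′ → (- a) ≈ (- a′)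
    add-assoc     : ∀ a b c → ((a + b) + c) ≈ (a + (b + c))
    add-comm      : ∀ a b → (a + b) ≈ (b + a)
    add-identity  : ∀ a → (0# + a) ≈ a
    add-inverse   : ∀ a → ((- a) + a) ≈ 0#
    mul-assoc     : ∀ a b c → ((a * b) * c) ≈ (a * (b * c))
    mul-comm      : ∀ a b → (a * b) ≈ (b * a)
    mul-identity  : ∀ a → (1# * a) ≈ a
    distrib       : ∀ a b c → (a * (b + c)) ≈ ((a * b) + (a * c))

  open IsEquivalence isEquivalence using (trans)

  commutativeRing : CommutativeRing 0ℓ 0ℓ
  commutativeRing = record
    { isCommutativeRing = record
      { isRing = record
        { +-isAbelianGroup = record
          { isGroup = record
            { isMonoid = record
              { isSemigroup = record
                { isMagma = record { isEquivalence = isEquivalence ; ∙-cong = add-cong }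
                ; assoc   = add-assoc
                }
              ; identity = add-identity , λ a → trans (add-comm a 0#) (add-identity a)
              }
            ; inverse = add-inverse , λ a → trans (add-comm a (- a)) (add-inverse a)
            ; ⁻¹-cong = opp-cong
            }
          ; comm = add-comm
          }
        ; *-cong     = mul-cong
        ; *-assoc    = mul-assoc
        ; *-identity = mul-identity , λ a → trans (mul-comm a 1#) (mul-identity a)
        ; distrib    = distrib , λ a b c →
            trans (mul-comm (b + c) a)
              (trans (distrib a b c) (add-cong (mul-comm a b) (mul-comm a c)))
        }
      ; *-comm = mul-comm
      }
    }

module _ {R : RawRing 0ℓ 0ℓ} {S : CommutativeRing 0ℓ 0ℓ} where
  private
    module R = RawRing R
    module S = CommutativeRing S

  ringHomomorphism : {f : R.Carrier → S.Carrier} →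
    (∀ {a b} → a R.≈ b → f a S.≈ f b) →
    (∀ a b → f (a R.+ b) S.≈ f a S.+ f b) → (∀ a b → f (a R.* b) S.≈ f a S.* f b) →
    (∀ a → f (R.- a) S.≈ S.- f a) → f R.0# S.≈ S.0# → f R.1# S.≈ S.1# →
    IsRingHomomorphism R S.rawRing f
  ringHomomorphism cong +-homo *-homo neg-homo 0-homo 1-homo = record
    { isSemiringHomomorphism = record
      { isNearSemiringHomomorphism = record
        { +-isMonoidHomomorphism = record
          { isMagmaHomomorphism = record
            { isRelHomomorphism = record { cong = cong } ; homo = +-homo }
          ; ε-homo = 0-homo
          }
        ; *-homo = *-homo
        }
      ; 1#-homo = 1-homo
      }
    ; -‿homo = neg-homo
    }

-- Nonzero products, with the decision which factor of a zero product is zero;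
-- the zero ring is not excluded.
IsDomain : CommutativeRing 0ℓ 0ℓ → Set
IsDomain R = ∀ a b → a * b ≈ 0# → a ≈ 0# ⊎ b ≈ 0#
  where open CommutativeRing R

-- For a domain R: f is not a square in the field of fractions.
NonSquare : (R : CommutativeRing 0ℓ 0ℓ) → CommutativeRing.Carrier R → Set
NonSquare R f = ∀ a b → a * a ≈ f * (b * b) → b ≈ 0#
  where open CommutativeRing R

-- Finite sums

module FiniteSum (S : CommutativeRing 0ℓ 0ℓ) where
  private module S = CommutativeRing S
  open IntegerCoefficients S
  open RawSemiringDefs (CommutativeSemiring.rawSemiring S.commutativeSemiring) public using (sum)

  sum-cong : ∀ {n} {f g : Vector S.Carrier n} → (∀ i → f i S.≈ g i) → sum f S.≈ sum g
  sum-cong {ℕ.zero} e = S.refl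
  sum-cong {suc n}  e = S.+-cong (e zero) (sum-cong (λ i → e (suc i)))

  sum-zero : ∀ {n} {f : Vector S.Carrier n} → (∀ i → f i S.≈ S.0#) → sum f S.≈ S.0#
  sum-zero {ℕ.zero} e = S.refl
  sum-zero {suc n}  e = S.trans (S.+-cong (e zero) (sum-zero (λ i → e (suc i)))) (S.+-identityˡ _)

  sum-linear : ∀ {n} c d (g f f′ : Vector S.Carrier n) →
    sum (λ i → g i S.* (c S.* f i S.+ d S.* f′ i)) S.≈
    c S.* sum (λ i → g i S.* f i) S.+ d S.* sum (λ i → g i S.* f′ i)
  sum-linear {ℕ.zero} c d g f f′ = solve 2 (λ c d → κ 0ℤ ⊜ c ⊗ κ 0ℤ ⊕ d ⊗ κ 0ℤ) S.refl c d
  sum-linear {suc n}  c d g f f′ = S.trans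
    (S.+-congˡ (sum-linear c d (λ i → g (suc i)) (λ i → f (suc i)) (λ i → f′ (suc i))))
    (solve 7 (λ c d g f f′ s s′ →
        g ⊗ (c ⊗ f ⊕ d ⊗ f′) ⊕ (c ⊗ s ⊕ d ⊗ s′) ⊜ c ⊗ (g ⊗ f ⊕ s) ⊕ d ⊗ (g ⊗ f′ ⊕ s′))
      S.refl c d (g zero) (f zero) (f′ zero)
      (sum (λ i → g (suc i) S.* f (suc i))) (sum (λ i → g (suc i) S.* f′ (suc i))))

  sum-δ : ∀ {n} (i : Fin n) (f : Vector S.Carrier n) →
    sum (λ q → (if does (q Fin.≟ i) then S.1# else S.0#) S.* f q) S.≈ f i
  sum-δ zero    f = S.trans (S.+-cong (S.*-identityˡ (f zero)) (sum-zero (λ q → S.zeroˡ (f (suc q)))))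
    (S.+-identityʳ (f zero))
  sum-δ (suc i) f = S.trans (S.+-cong (S.zeroˡ (f zero)) (sum-δ i (λ q → f (suc q)))) (S.+-identityˡ _)

-- Cramer's rule

module _ {R : CommutativeRing 0ℓ 0ℓ} (domain : IsDomain R) where
  private module R = CommutativeRing R
  open R using (_≈_; _+_; _*_; -_; 0#)
  open IntegerCoefficients R

  cramer : ∀ {p q r s a b} → ¬ (p * s + - (q * r) ≈ 0#) →
    a * p + b * q ≈ 0# → a * r + b * s ≈ 0# → a ≈ 0# × b ≈ 0#
  cramer {p} {q} {r} {s} {a} {b} det≉0 e f =
    solution (solve 6 (λ p q r s a b → (p ⊗ s ⊖ q ⊗ r) ⊗ a ⊜ s ⊗ (a ⊗ p ⊕ b ⊗ q) ⊖ q ⊗ (a ⊗ r ⊕ b ⊗ s))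
      R.refl p q r s a b) e f ,
    solution (solve 6 (λ p q r s a b → (p ⊗ s ⊖ q ⊗ r) ⊗ b ⊜ p ⊗ (a ⊗ r ⊕ b ⊗ s) ⊖ r ⊗ (a ⊗ p ⊕ b ⊗ q))
      R.refl p q r s a b) f e
    where
    solution : ∀ {c d g h X} → (p * s + - (q * r)) * X ≈ c * g + - (d * h) → g ≈ 0# → h ≈ 0# → X ≈ 0#
    solution eq g≈0 h≈0 = [ (λ z → contradiction z det≉0) , (λ z → z) ]′ (domain _ _ (R.trans eq
      (R.trans (R.+-cong (R.*-congˡ g≈0) (R.-‿cong (R.*-congˡ h≈0)))
        (solve 2 (λ c d → c ⊗ κ 0ℤ ⊖ d ⊗ κ 0ℤ ⊜ κ 0ℤ) R.refl _ _))))

module _ {R : CommutativeRing 0ℓ 0ℓ} where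
  private module R = CommutativeRing R
  open R using (_≈_; _*_)
  open IntegerCoefficients R

  proportional : ∀ {n} {c} {v w : Vector R.Carrier n} → (∀ q → w q ≈ c * v q) →
    ∀ i j → v i * w j ≈ v j * w i
  proportional {c = c} {v} e i j = R.trans (R.*-congˡ (e j)) (R.trans
    (solve 3 (λ a b c → a ⊗ (c ⊗ b) ⊜ b ⊗ (c ⊗ a)) R.refl (v i) (v j) c) (R.*-congˡ (R.sym (e i))))

-- Determinants

module Determinant (R : CommutativeRing 0ℓ 0ℓ) where
  private module R = CommutativeRing R
  open R using (Carrier; _≈_; _+_; _*_; -_)
  open IntegerCoefficients R
  open SetoidReasoning R.setoid

  -- The determinant with rows a, b, c.
  det : (a b c : Vector Carrier 3) → Carrier
  det a b c = (a 0F * (b 1F * c 2F + - (b 2F * c 1F)) + - (b 0F * (a 1F * c 2F + - (a 2F * c 1F))))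
              + c 0F * (a 1F * b 2F + - (a 2F * b 1F))

  det-cong : ∀ {a a′ b b′ c c′} → (∀ i → a i ≈ a′ i) → (∀ i → b i ≈ b′ i) → (∀ i → c i ≈ c′ i) →
             det a b c ≈ det a′ b′ c′
  det-cong e f g = R.+-cong (R.+-cong
      (R.*-cong (e 0F) (minor-cong f g)) (R.-‿cong (R.*-cong (f 0F) (minor-cong e g))))
    (R.*-cong (g 0F) (minor-cong e f))
    where
    minor-cong : ∀ {a a′ b b′ : Vector Carrier 3} → (∀ i → a i ≈ a′ i) → (∀ i → b i ≈ b′ i) →
      a 1F * b 2F + - (a 2F * b 1F) ≈ a′ 1F * b′ 2F + - (a′ 2F * b′ 1F)
    minor-cong e f = R.+-cong (R.*-cong (e 1F) (f 2F)) (R.-‿cong (R.*-cong (e 2F) (f 1F)))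

  det-cyclic : ∀ a b c → det a b c ≈ det c a b
  det-cyclic a b c = solve 9 (λ a b c a′ b′ c′ a″ b″ c″ →
      (a ⊗ (b′ ⊗ c″ ⊖ b″ ⊗ c′) ⊖ b ⊗ (a′ ⊗ c″ ⊖ a″ ⊗ c′)) ⊕ c ⊗ (a′ ⊗ b″ ⊖ a″ ⊗ b′)
    ⊜ (c ⊗ (a′ ⊗ b″ ⊖ a″ ⊗ b′) ⊖ a ⊗ (c′ ⊗ b″ ⊖ c″ ⊗ b′)) ⊕ b ⊗ (c′ ⊗ a″ ⊖ c″ ⊗ a′)) R.refl
    (a 0F) (b 0F) (c 0F) (a 1F) (b 1F) (c 1F) (a 2F) (b 2F) (c 2F)

  det-scale : ∀ t a b c → det (λ i → t * a i) b c ≈ t * det a b c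
  det-scale t a b c = solve 10 (λ t a b c a′ b′ c′ a″ b″ c″ →
      (t ⊗ a ⊗ (b′ ⊗ c″ ⊖ b″ ⊗ c′) ⊖ b ⊗ (t ⊗ a′ ⊗ c″ ⊖ t ⊗ a″ ⊗ c′)) ⊕ c ⊗ (t ⊗ a′ ⊗ b″ ⊖ t ⊗ a″ ⊗ b′)
    ⊜ t ⊗ ((a ⊗ (b′ ⊗ c″ ⊖ b″ ⊗ c′) ⊖ b ⊗ (a′ ⊗ c″ ⊖ a″ ⊗ c′)) ⊕ c ⊗ (a′ ⊗ b″ ⊖ a″ ⊗ b′))) R.refl
    t (a 0F) (b 0F) (c 0F) (a 1F) (b 1F) (c 1F) (a 2F) (b 2F) (c 2F)

  det-add : ∀ a a₁ b c → det (λ i → a i + a₁ i) b c ≈ det a b c + det a₁ b c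
  det-add a a₁ b c = solve 12 (λ a b c a′ b′ c′ a″ b″ c″ d d′ d″ →
      ((a ⊕ d) ⊗ (b′ ⊗ c″ ⊖ b″ ⊗ c′) ⊖ b ⊗ ((a′ ⊕ d′) ⊗ c″ ⊖ (a″ ⊕ d″) ⊗ c′)) ⊕ c ⊗ ((a′ ⊕ d′) ⊗ b″ ⊖ (a″ ⊕ d″) ⊗ b′)
    ⊜ ((a ⊗ (b′ ⊗ c″ ⊖ b″ ⊗ c′) ⊖ b ⊗ (a′ ⊗ c″ ⊖ a″ ⊗ c′)) ⊕ c ⊗ (a′ ⊗ b″ ⊖ a″ ⊗ b′)) ⊕
      ((d ⊗ (b′ ⊗ c″ ⊖ b″ ⊗ c′) ⊖ b ⊗ (d′ ⊗ c″ ⊖ d″ ⊗ c′)) ⊕ c ⊗ (d′ ⊗ b″ ⊖ d″ ⊗ b′))) R.refl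
    (a 0F) (b 0F) (c 0F) (a 1F) (b 1F) (c 1F) (a 2F) (b 2F) (c 2F) (a₁ 0F) (a₁ 1F) (a₁ 2F)

  det-swap : ∀ a b c → det a c b ≈ - det a b c
  det-swap a b c = solve 9 (λ a b c a′ b′ c′ a″ b″ c″ →
      (a ⊗ (c′ ⊗ b″ ⊖ c″ ⊗ b′) ⊖ c ⊗ (a′ ⊗ b″ ⊖ a″ ⊗ b′)) ⊕ b ⊗ (a′ ⊗ c″ ⊖ a″ ⊗ c′)
    ⊜ ⊝ ((a ⊗ (b′ ⊗ c″ ⊖ b″ ⊗ c′) ⊖ b ⊗ (a′ ⊗ c″ ⊖ a″ ⊗ c′)) ⊕ c ⊗ (a′ ⊗ b″ ⊖ a″ ⊗ b′))) R.refl
    (a 0F) (b 0F) (c 0F) (a 1F) (b 1F) (c 1F) (a 2F) (b 2F) (c 2F)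

  det-equal : ∀ a b → det a b b ≈ R.0#
  det-equal a b = solve 6 (λ a b a′ b′ a″ b″ →
      (a ⊗ (b′ ⊗ b″ ⊖ b″ ⊗ b′) ⊖ b ⊗ (a′ ⊗ b″ ⊖ a″ ⊗ b′)) ⊕ b ⊗ (a′ ⊗ b″ ⊖ a″ ⊗ b′) ⊜ κ 0ℤ) R.refl
    (a 0F) (b 0F) (a 1F) (b 1F) (a 2F) (b 2F)

  -- Replacing a multiple t a of the first row by a combination of three rows.
  det-relation : ∀ {t p q r} {a b c d : Vector Carrier 3} →
    (∀ i → t * a i ≈ (p * b i + q * c i) + r * d i) → ∀ e f →
    t * det a e f ≈ (p * det b e f + q * det c e f) + r * det d e f
  det-relation {t} {p} {q} {r} {a} {b} {c} {d} rel e f = begin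
    t * det a e f
      ≈⟨ det-scale t a e f ⟨
    det (λ i → t * a i) e f
      ≈⟨ det-cong {b = e} {b′ = e} {c = f} {c′ = f} rel (λ _ → R.refl) (λ _ → R.refl) ⟩
    det (λ i → (p * b i + q * c i) + r * d i) e f
      ≈⟨ det-add (λ i → p * b i + q * c i) (λ i → r * d i) e f ⟩
    det (λ i → p * b i + q * c i) e f + det (λ i → r * d i) e f
      ≈⟨ R.+-cong (det-add (λ i → p * b i) (λ i → q * c i) e f) (det-scale r d e f) ⟩
    (det (λ i → p * b i) e f + det (λ i → q * c i) e f) + r * det d e f
      ≈⟨ R.+-congʳ (R.+-cong (det-scale p b e f) (det-scale q c e f)) ⟩
    (p * det b e f + q * det c e f) + r * det d e f ∎

  det-equal₁₂ : ∀ a b → det a a b ≈ R.0#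
  det-equal₁₂ a b = R.trans (det-cyclic a a b) (det-equal b a)

  det-equal₁₃ : ∀ a b → det a b a ≈ R.0#
  det-equal₁₃ a b = R.trans (det-cyclic a b a) (det-equal₁₂ a b)

  -- The hypotheses say that the gradients of the two quadrics kill the columns of
  -- the 5 × 3 matrix with rows rx, ry, ru, rv, rz.  Its maximal minors are then
  -- proportional to the complementary minors of the Jacobian matrix; the lemmas
  -- compare them with the minor D.
  module Complementary {x y u v z : Carrier} {rx ry ru rv rz : Vector Carrier 3}
    (ru-relation : ∀ i → (u + u) * ru i ≈ ((x + x) * rx i + z * ry i) + y * rz i)
    (rv-relation : ∀ i → (v + v) * rv i ≈ (z * rx i + (y + y) * ry i) + x * rz i) where

    private
      D : Carrier
      D = det rz rx ry

    ru-det : ∀ e f → (u + u) * det ru e f ≈ ((x + x) * det rx e f + z * det ry e f) + y * det rz e f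
    ru-det = det-relation ru-relation

    rv-det : ∀ e f → (v + v) * det rv e f ≈ (z * det rx e f + (y + y) * det ry e f) + x * det rz e f
    rv-det = det-relation rv-relation

    -- One of three terms is left when two determinants have equal rows.
    keep₁ : ∀ {p q r a b c} → b ≈ R.0# → c ≈ R.0# → (p * a + q * b) + r * c ≈ p * a
    keep₁ {p} {q} {r} {a} b≈0 c≈0 = R.trans (R.+-cong (R.+-congˡ (R.*-congˡ b≈0)) (R.*-congˡ c≈0))
      (solve 4 (λ p q r a → (p ⊗ a ⊕ q ⊗ κ 0ℤ) ⊕ r ⊗ κ 0ℤ ⊜ p ⊗ a) R.refl p q r a)

    keep₂ : ∀ {p q r a b c} → a ≈ R.0# → c ≈ R.0# → (p * a + q * b) + r * c ≈ q * b
    keep₂ {p} {q} {r} {b = b} a≈0 c≈0 = R.trans (R.+-cong (R.+-congʳ (R.*-congˡ a≈0)) (R.*-congˡ c≈0))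
      (solve 4 (λ p q r b → (p ⊗ κ 0ℤ ⊕ q ⊗ b) ⊕ r ⊗ κ 0ℤ ⊜ q ⊗ b) R.refl p q r b)

    keep₃ : ∀ {p q r a b c} → a ≈ R.0# → b ≈ R.0# → (p * a + q * b) + r * c ≈ r * c
    keep₃ {p} {q} {r} {c = c} a≈0 b≈0 = R.trans (R.+-congʳ (R.+-cong (R.*-congˡ a≈0) (R.*-congˡ b≈0)))
      (solve 4 (λ p q r c → (p ⊗ κ 0ℤ ⊕ q ⊗ κ 0ℤ) ⊕ r ⊗ c ⊜ r ⊗ c) R.refl p q r c)

    det-zvy : (v + v) * det rz rv ry ≈ z * D
    det-zvy = R.trans (R.*-congˡ (R.trans (det-cyclic rz rv ry) (det-cyclic ry rz rv)))
      (R.trans (rv-det ry rz) (R.trans (keep₁ (det-equal₁₂ ry rz) (det-equal₁₃ rz ry))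
        (R.*-congˡ (det-cyclic rx ry rz))))

    det-zxu : (u + u) * det rz rx ru ≈ z * D
    det-zxu = R.trans (R.*-congˡ (det-cyclic rz rx ru))
      (R.trans (ru-det rz rx) (R.trans (keep₂ (det-equal₁₃ rx rz) (det-equal₁₂ rz rx))
        (R.*-congˡ (R.trans (det-cyclic ry rz rx) (det-cyclic rx ry rz)))))

    det-zuy : (u + u) * det rz ru ry ≈ (x + x) * D
    det-zuy = R.trans (R.*-congˡ (R.trans (det-cyclic rz ru ry) (det-cyclic ry rz ru)))
      (R.trans (ru-det ry rz) (R.trans (keep₁ (det-equal₁₂ ry rz) (det-equal₁₃ rz ry))
        (R.*-congˡ (det-cyclic rx ry rz))))

    det-zux : (u + u) * det rz ru rx ≈ - (z * D)
    det-zux = begin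
      (u + u) * det rz ru rx       ≈⟨ R.*-congˡ (det-swap rz rx ru) ⟩
      (u + u) * - det rz rx ru     ≈⟨ solve 2 (λ u d → u ⊗ ⊝ d ⊜ ⊝ (u ⊗ d)) R.refl (u + u) (det rz rx ru) ⟩
      - ((u + u) * det rz rx ru)   ≈⟨ R.-‿cong det-zxu ⟩
      - (z * D)                    ∎

    det-zuv : (u + u) * ((v + v) * det rz ru rv) ≈ ((x + x) * (y + y) + - (z * z)) * D
    det-zuv = begin
      (u + u) * ((v + v) * det rz ru rv)
        ≈⟨ R.*-congˡ (R.trans (R.*-congˡ (det-cyclic rz ru rv)) (R.trans (rv-det rz ru)
             (R.+-cong (R.+-cong (R.*-congˡ (R.trans (det-cyclic rx rz ru) (det-cyclic ru rx rz)))
               (R.*-congˡ (R.trans (det-cyclic ry rz ru) (det-cyclic ru ry rz))))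
               (R.trans (R.*-congˡ (det-equal₁₂ rz ru)) (R.zeroʳ x))))) ⟩
      (u + u) * ((z * det rz ru rx + (y + y) * det rz ru ry) + R.0#)
        ≈⟨ solve 5 (λ u z y d e → u ⊗ ((z ⊗ d ⊕ y ⊗ e) ⊕ κ 0ℤ) ⊜ z ⊗ (u ⊗ d) ⊕ y ⊗ (u ⊗ e)) R.refl
             (u + u) z (y + y) (det rz ru rx) (det rz ru ry) ⟩
      z * ((u + u) * det rz ru rx) + (y + y) * ((u + u) * det rz ru ry)
        ≈⟨ R.+-cong (R.*-congˡ det-zux) (R.*-congˡ det-zuy) ⟩
      z * - (z * D) + (y + y) * ((x + x) * D)
        ≈⟨ solve 4 (λ x y z d → z ⊗ ⊝ (z ⊗ d) ⊕ y ⊗ (x ⊗ d) ⊜ (x ⊗ y ⊖ z ⊗ z) ⊗ d) R.refl (x + x) (y + y) z D ⟩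
      ((x + x) * (y + y) + - (z * z)) * D ∎

    det-xyz : det rx ry rz ≈ D
    det-xyz = det-cyclic rx ry rz

    det-xyv : (v + v) * det rx ry rv ≈ x * D
    det-xyv = R.trans (R.*-congˡ (det-cyclic rx ry rv))
      (R.trans (rv-det rx ry) (keep₃ (det-equal₁₂ rx ry) (det-equal₁₃ ry rx)))

    det-yux : (u + u) * det ry ru rx ≈ y * D
    det-yux = R.trans (R.*-congˡ (R.trans (det-cyclic ry ru rx) (det-cyclic rx ry ru)))
      (R.trans (ru-det rx ry) (keep₃ (det-equal₁₂ rx ry) (det-equal₁₃ ry rx)))

-- Quadratic extensions

-- R[s]/(s² - A), with (a , b) standing for a + b s.
module _ (R : CommutativeRing 0ℓ 0ℓ) (A : CommutativeRing.Carrier R) where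
  private module R = CommutativeRing R
  open R using (_+_; _*_; -_; 0#; 1#; _≈_)
  open IntegerCoefficients R

  _[√_] : CommutativeRing 0ℓ 0ℓ
  _[√_] = RingAxioms.commutativeRing {A = R.Carrier × R.Carrier}
    {_≈_ = λ (a , b) (c , d) → a ≈ c × b ≈ d}
    {_+_ = λ (a , b) (c , d) → a + c , b + d}
    {_*_ = λ (a , b) (c , d) → a * c + A * (b * d) , a * d + b * c}
    { -_ = λ (a , b) → - a , - b } {0# = 0# , 0#} {1# = 1# , 0#} record
    { isEquivalence = record
      { refl  = R.refl , R.refl
      ; sym   = λ (e , f) → R.sym e , R.sym f
      ; trans = λ (e , f) (g , h) → R.trans e g , R.trans f h
      }
    ; add-cong  = λ (e , f) (g , h) → R.+-cong e g , R.+-cong f h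
    ; mul-cong  = λ (e , f) (g , h) → R.+-cong (R.*-cong e g) (R.*-congˡ (R.*-cong f h)) ,
                                      R.+-cong (R.*-cong e h) (R.*-cong f g)
    ; opp-cong  = λ (e , f) → R.-‿cong e , R.-‿cong f
    ; add-assoc    = λ _ _ _ → R.+-assoc _ _ _ , R.+-assoc _ _ _
    ; add-comm     = λ _ _ → R.+-comm _ _ , R.+-comm _ _
    ; add-identity = λ _ → R.+-identityˡ _ , R.+-identityˡ _
    ; add-inverse  = λ _ → R.-‿inverseˡ _ , R.-‿inverseˡ _
    ; mul-assoc    = λ (a , b) (c , d) (e , f) →
        solve 7 (λ A a b c d e f →
            (a ⊗ c ⊕ A ⊗ (b ⊗ d)) ⊗ e ⊕ A ⊗ ((a ⊗ d ⊕ b ⊗ c) ⊗ f)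
          ⊜ a ⊗ (c ⊗ e ⊕ A ⊗ (d ⊗ f)) ⊕ A ⊗ (b ⊗ (c ⊗ f ⊕ d ⊗ e))) R.refl A a b c d e f ,
        solve 7 (λ A a b c d e f →
            (a ⊗ c ⊕ A ⊗ (b ⊗ d)) ⊗ f ⊕ (a ⊗ d ⊕ b ⊗ c) ⊗ e
          ⊜ a ⊗ (c ⊗ f ⊕ d ⊗ e) ⊕ b ⊗ (c ⊗ e ⊕ A ⊗ (d ⊗ f))) R.refl A a b c d e f
    ; mul-comm     = λ (a , b) (c , d) →
        solve 5 (λ A a b c d → a ⊗ c ⊕ A ⊗ (b ⊗ d) ⊜ c ⊗ a ⊕ A ⊗ (d ⊗ b)) R.refl A a b c d ,
        solve 4 (λ a b c d → a ⊗ d ⊕ b ⊗ c ⊜ c ⊗ b ⊕ d ⊗ a) R.refl a b c d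
    ; mul-identity = λ (a , b) →
        solve 3 (λ A a b → κ 1ℤ ⊗ a ⊕ A ⊗ (κ 0ℤ ⊗ b) ⊜ a) R.refl A a b ,
        solve 2 (λ a b → κ 1ℤ ⊗ b ⊕ κ 0ℤ ⊗ a ⊜ b) R.refl a b
    ; distrib      = λ (a , b) (c , d) (e , f) →
        solve 7 (λ A a b c d e f → a ⊗ (c ⊕ e) ⊕ A ⊗ (b ⊗ (d ⊕ f))
          ⊜ (a ⊗ c ⊕ A ⊗ (b ⊗ d)) ⊕ (a ⊗ e ⊕ A ⊗ (b ⊗ f))) R.refl A a b c d e f ,
        solve 6 (λ a b c d e f → a ⊗ (d ⊕ f) ⊕ b ⊗ (c ⊕ e)
          ⊜ (a ⊗ d ⊕ b ⊗ c) ⊕ (a ⊗ f ⊕ b ⊗ e)) R.refl a b c d e f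
    }

module _ {R : CommutativeRing 0ℓ 0ℓ} (domain : IsDomain R) where
  private module R = CommutativeRing R
  open R using (Carrier; _+_; _*_; -_; 0#; 1#; _≈_)
  open IntegerCoefficients R
  open SetoidReasoning R.setoid

  private
    square≈0 : ∀ a → a * a ≈ 0# → a ≈ 0#
    square≈0 a e = [ (λ z → z) , (λ z → z) ]′ (domain a a e)

    cancel : ∀ {a} → ¬ (a ≈ 0#) → ∀ b → a * b ≈ 0# → b ≈ 0#
    cancel a≉0 b e = [ (λ a≈0 → contradiction a≈0 a≉0) , (λ z → z) ]′ (domain _ b e)

    difference≈0 : ∀ {a b} → a + - b ≈ 0# → a ≈ b
    difference≈0 {a} {b} e = begin
      a              ≈⟨ solve 2 (λ a b → a ⊜ (a ⊖ b) ⊕ b) R.refl a b ⟩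
      (a + - b) + b  ≈⟨ R.+-congʳ e ⟩
      0# + b         ≈⟨ R.+-identityˡ b ⟩
      b              ∎

    ≈⇒difference : ∀ {a b} → a ≈ b → a + - b ≈ 0#
    ≈⇒difference e = R.trans (R.+-congʳ e) (R.-‿inverseʳ _)

    times-0 : ∀ {a b} → a ≈ 0# → b * a ≈ 0#
    times-0 e = R.trans (R.*-congˡ e) (R.zeroʳ _)

  nonSquare-root : ∀ {f} → NonSquare R f → ∀ a b → a * a ≈ f * (b * b) → a ≈ 0#
  nonSquare-root nonSquare a b e = square≈0 a (R.trans e (times-0 (times-0 (nonSquare a b e))))

  module _ {A : Carrier} (A-nonSquare : NonSquare R A) where

    -- Multiplication by the conjugate turns a + b √A into its norm a² - A b².
    √-domain : IsDomain (R [√ A ])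
    √-domain (a , b) (c , d) (e , f) = from
      (domain (a * a + - (A * (b * b))) c (begin
        (a * a + - (A * (b * b))) * c
          ≈⟨ solve 5 (λ A a b c d → (a ⊗ a ⊖ A ⊗ (b ⊗ b)) ⊗ c
               ⊜ a ⊗ (a ⊗ c ⊕ A ⊗ (b ⊗ d)) ⊖ A ⊗ b ⊗ (a ⊗ d ⊕ b ⊗ c)) R.refl A a b c d ⟩
        a * (a * c + A * (b * d)) + - (A * b * (a * d + b * c))
          ≈⟨ ≈⇒difference (R.trans (times-0 e) (R.sym (times-0 f))) ⟩
        0# ∎))
      (domain (a * a + - (A * (b * b))) d (begin
        (a * a + - (A * (b * b))) * d
          ≈⟨ solve 5 (λ A a b c d → (a ⊗ a ⊖ A ⊗ (b ⊗ b)) ⊗ d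
               ⊜ a ⊗ (a ⊗ d ⊕ b ⊗ c) ⊖ b ⊗ (a ⊗ c ⊕ A ⊗ (b ⊗ d))) R.refl A a b c d ⟩
        a * (a * d + b * c) + - (b * (a * c + A * (b * d)))
          ≈⟨ ≈⇒difference (R.trans (times-0 f) (R.sym (times-0 e))) ⟩
        0# ∎))
      where
      norm≈0 : a * a + - (A * (b * b)) ≈ 0# → a ≈ 0# × b ≈ 0#
      norm≈0 e = nonSquare-root A-nonSquare a b (difference≈0 e) , A-nonSquare a b (difference≈0 e)

      from : a * a + - (A * (b * b)) ≈ 0# ⊎ c ≈ 0# → a * a + - (A * (b * b)) ≈ 0# ⊎ d ≈ 0# →
             (a ≈ 0# × b ≈ 0#) ⊎ (c ≈ 0# × d ≈ 0#)
      from (inj₁ e) _        = inj₁ (norm≈0 e)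
      from (inj₂ _) (inj₁ e) = inj₁ (norm≈0 e)
      from (inj₂ e) (inj₂ f) = inj₂ (e , f)

    -- If (a + b √A)² = B (c + e √A)², then comparing coefficients and norms
    -- gives a² + A b² = B (c² + A e²) and a² - A b² = ± B (c² - A e²).
    √-nonSquare : ∀ {B} → (∀ a → (1# + 1#) * a ≈ 0# → a ≈ 0#) → ¬ (A ≈ 0#) →
      NonSquare R B → NonSquare R (A * B) → NonSquare (R [√ A ]) (B , 0#)
    √-nonSquare {B} half A≉0 B-nonSquare AB-nonSquare (a , b) (c , e) (eq₁ , eq₂) =
      [ plus , minus ]′ (domain _ _ norms)
      where
      X₀ Y₀ U₀ V₀ : Carrier
      X₀ = a * a
      Y₀ = A * (b * b)
      U₀ = B * (c * c)
      V₀ = B * (A * (e * e))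

      sums : X₀ + Y₀ ≈ U₀ + V₀
      sums = R.trans eq₁ (solve 4 (λ A B c e →
        B ⊗ (c ⊗ c ⊕ A ⊗ (e ⊗ e)) ⊕ A ⊗ (κ 0ℤ ⊗ (c ⊗ e ⊕ e ⊗ c)) ⊜ B ⊗ (c ⊗ c) ⊕ B ⊗ (A ⊗ (e ⊗ e))) R.refl A B c e)

      cross : a * b + b * a ≈ B * (c * e + e * c)
      cross = R.trans eq₂ (solve 4 (λ A B c e →
        B ⊗ (c ⊗ e ⊕ e ⊗ c) ⊕ κ 0ℤ ⊗ (c ⊗ c ⊕ A ⊗ (e ⊗ e)) ⊜ B ⊗ (c ⊗ e ⊕ e ⊗ c)) R.refl A B c e)

      norms : ((X₀ + - Y₀) + - (U₀ + - V₀)) * ((X₀ + - Y₀) + (U₀ + - V₀)) ≈ 0#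
      norms = begin
        ((X₀ + - Y₀) + - (U₀ + - V₀)) * ((X₀ + - Y₀) + (U₀ + - V₀))
          ≈⟨ solve 6 (λ A B a b c e →
               ((a ⊗ a ⊖ A ⊗ (b ⊗ b)) ⊖ (B ⊗ (c ⊗ c) ⊖ B ⊗ (A ⊗ (e ⊗ e)))) ⊗
               ((a ⊗ a ⊖ A ⊗ (b ⊗ b)) ⊕ (B ⊗ (c ⊗ c) ⊖ B ⊗ (A ⊗ (e ⊗ e)))) ⊜
               ((a ⊗ a ⊕ A ⊗ (b ⊗ b)) ⊗ (a ⊗ a ⊕ A ⊗ (b ⊗ b))
                 ⊕ A ⊗ ((B ⊗ (c ⊗ e ⊕ e ⊗ c)) ⊗ (B ⊗ (c ⊗ e ⊕ e ⊗ c)))) ⊖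
               ((B ⊗ (c ⊗ c) ⊕ B ⊗ (A ⊗ (e ⊗ e))) ⊗ (B ⊗ (c ⊗ c) ⊕ B ⊗ (A ⊗ (e ⊗ e)))
                 ⊕ A ⊗ ((a ⊗ b ⊕ b ⊗ a) ⊗ (a ⊗ b ⊕ b ⊗ a)))) R.refl A B a b c e ⟩
        ((X₀ + Y₀) * (X₀ + Y₀) + A * (B * (c * e + e * c) * (B * (c * e + e * c)))) +
        - ((U₀ + V₀) * (U₀ + V₀) + A * ((a * b + b * a) * (a * b + b * a)))
          ≈⟨ ≈⇒difference (R.+-cong (R.*-cong sums sums) (R.*-congˡ (R.sym (R.*-cong cross cross)))) ⟩
        0# ∎

      twice : ∀ {p q} → (1# + 1#) * p ≈ (1# + 1#) * q → p ≈ q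
      twice {p} {q} h = difference≈0 (half (p + - q) (begin
        (1# + 1#) * (p + - q)
          ≈⟨ solve 2 (λ p q → (κ 1ℤ ⊕ κ 1ℤ) ⊗ (p ⊖ q) ⊜ (κ 1ℤ ⊕ κ 1ℤ) ⊗ p ⊖ (κ 1ℤ ⊕ κ 1ℤ) ⊗ q) R.refl p q ⟩
        (1# + 1#) * p + - ((1# + 1#) * q)
          ≈⟨ ≈⇒difference h ⟩
        0# ∎))

      half-sum : ∀ {p q r s} → p + q ≈ r + s → p + - q ≈ r + - s → p ≈ r × q ≈ s
      half-sum {p} {q} {r} {s} h h′ = twice (begin
        (1# + 1#) * p           ≈⟨ solve 2 (λ p q → (κ 1ℤ ⊕ κ 1ℤ) ⊗ p ⊜ (p ⊕ q) ⊕ (p ⊖ q)) R.refl p q ⟩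
        (p + q) + (p + - q)     ≈⟨ R.+-cong h h′ ⟩
        (r + s) + (r + - s)     ≈⟨ solve 2 (λ p q → (κ 1ℤ ⊕ κ 1ℤ) ⊗ p ⊜ (p ⊕ q) ⊕ (p ⊖ q)) R.refl r s ⟨
        (1# + 1#) * r           ∎) , twice (begin
        (1# + 1#) * q           ≈⟨ solve 2 (λ p q → (κ 1ℤ ⊕ κ 1ℤ) ⊗ q ⊜ (p ⊕ q) ⊖ (p ⊖ q)) R.refl p q ⟩
        (p + q) + - (p + - q)   ≈⟨ R.+-cong h (R.-‿cong h′) ⟩
        (r + s) + - (r + - s)   ≈⟨ solve 2 (λ p q → (κ 1ℤ ⊕ κ 1ℤ) ⊗ q ⊜ (p ⊕ q) ⊖ (p ⊖ q)) R.refl r s ⟨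
        (1# + 1#) * s           ∎)

      plus : (X₀ + - Y₀) + - (U₀ + - V₀) ≈ 0# → c ≈ 0# × e ≈ 0#
      plus h = B-nonSquare a c (proj₁ XU,YV) , B-nonSquare b e
        (difference≈0 (cancel A≉0 _ (begin
          A * (b * b + - (B * (e * e)))
            ≈⟨ solve 4 (λ A B b e → A ⊗ (b ⊗ b ⊖ B ⊗ (e ⊗ e)) ⊜ A ⊗ (b ⊗ b) ⊖ B ⊗ (A ⊗ (e ⊗ e))) R.refl A B b e ⟩
          Y₀ + - V₀ ≈⟨ ≈⇒difference (proj₂ XU,YV) ⟩
          0# ∎)))
        where XU,YV = half-sum sums (difference≈0 h)

      minus : (X₀ + - Y₀) + (U₀ + - V₀) ≈ 0# → c ≈ 0# × e ≈ 0#
      minus h = AB-nonSquare (A * b) c (begin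
          A * b * (A * b) ≈⟨ solve 2 (λ A b → A ⊗ b ⊗ (A ⊗ b) ⊜ A ⊗ (A ⊗ (b ⊗ b))) R.refl A b ⟩
          A * Y₀           ≈⟨ R.*-congˡ (proj₂ XV,YU) ⟩
          A * U₀           ≈⟨ R.*-assoc _ _ _ ⟨
          A * B * (c * c) ∎) ,
        AB-nonSquare a e (begin
          X₀               ≈⟨ proj₁ XV,YU ⟩
          V₀               ≈⟨ solve 3 (λ A B e → B ⊗ (A ⊗ (e ⊗ e)) ⊜ A ⊗ B ⊗ (e ⊗ e)) R.refl A B e ⟩
          A * B * (e * e) ∎)
        where
        XV,YU = half-sum (R.trans sums (R.+-comm _ _)) (difference≈0 (R.trans
          (solve 4 (λ x y u v → (x ⊖ y) ⊖ (v ⊖ u) ⊜ (x ⊖ y) ⊕ (u ⊖ v)) R.refl X₀ Y₀ U₀ V₀) h))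

module _ (R : CommutativeRing 0ℓ 0ℓ) (A : CommutativeRing.Carrier R) where
  private
    module R = CommutativeRing R
    module R√ = CommutativeRing (R [√ A ])

  √-embed : R.Carrier → R√.Carrier
  √-embed a = a , R.0#

  √-embed-hom : IsRingHomomorphism R.rawRing R√.rawRing √-embed
  √-embed-hom = ringHomomorphism {S = R [√ A ]}
    (λ e → e , R.refl)
    (λ _ _ → R.refl , R.sym (R.+-identityˡ _))
    (λ a b → solve 3 (λ A a b → a ⊗ b ⊜ a ⊗ b ⊕ A ⊗ (κ 0ℤ ⊗ κ 0ℤ)) R.refl A a b ,
             solve 2 (λ a b → κ 0ℤ ⊜ a ⊗ κ 0ℤ ⊕ κ 0ℤ ⊗ b) R.refl a b)
    (λ _ → R.refl , solve 0 (κ 0ℤ ⊜ ⊝ κ 0ℤ) R.refl)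
    (R.refl , R.refl) (R.refl , R.refl)
    where open IntegerCoefficients R

  -- √A
  root : R√.Carrier
  root = R.0# , R.1#

  root² : root R√.* root R√.≈ √-embed A
  root² = solve 1 (λ A → κ 0ℤ ⊗ κ 0ℤ ⊕ A ⊗ (κ 1ℤ ⊗ κ 1ℤ) ⊜ A) R.refl A ,
          solve 0 (κ 0ℤ ⊗ κ 1ℤ ⊕ κ 1ℤ ⊗ κ 0ℤ ⊜ κ 0ℤ) R.refl
    where open IntegerCoefficients R

  -- The universal property of R[√A].
  module √-Lift (S : CommutativeRing 0ℓ 0ℓ) {h : R.Carrier → CommutativeRing.Carrier S}
                (h-hom : IsRingHomomorphism R.rawRing (CommutativeRing.rawRing S) h)
                {r : CommutativeRing.Carrier S}
                (r² : CommutativeRing._≈_ S (CommutativeRing._*_ S r r) (h A)) where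
    private
      open IntegerCoefficients S
      module S = CommutativeRing S
      module h = IsRingHomomorphism h-hom
      open SetoidReasoning S.setoid

    √-lift : R√.Carrier → S.Carrier
    √-lift (a , b) = h a S.+ r S.* h b

    √-lift-hom : IsRingHomomorphism R√.rawRing S.rawRing √-lift
    √-lift-hom = ringHomomorphism {S = S}
      (λ (e , f) → S.+-cong (h.⟦⟧-cong e) (S.*-congˡ (h.⟦⟧-cong f)))
      (λ (a , b) (c , d) → begin
        h (a R.+ c) S.+ r S.* h (b R.+ d)
          ≈⟨ S.+-cong (h.+-homo a c) (S.*-congˡ (h.+-homo b d)) ⟩
        (h a S.+ h c) S.+ r S.* (h b S.+ h d)
          ≈⟨ solve 5 (λ a b c d r → (a ⊕ c) ⊕ r ⊗ (b ⊕ d) ⊜ (a ⊕ r ⊗ b) ⊕ (c ⊕ r ⊗ d))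
               S.refl (h a) (h b) (h c) (h d) r ⟩
        (h a S.+ r S.* h b) S.+ (h c S.+ r S.* h d) ∎)
      (λ (a , b) (c , d) → begin
        h (a R.* c R.+ A R.* (b R.* d)) S.+ r S.* h (a R.* d R.+ b R.* c)
          ≈⟨ S.+-cong
               (S.trans (h.+-homo _ _) (S.+-cong (h.*-homo a c)
                 (S.trans (h.*-homo A _) (S.*-cong (S.sym r²) (h.*-homo b d)))))
               (S.*-congˡ (S.trans (h.+-homo _ _) (S.+-cong (h.*-homo a d) (h.*-homo b c)))) ⟩
        (h a S.* h c S.+ r S.* r S.* (h b S.* h d)) S.+ r S.* (h a S.* h d S.+ h b S.* h c)
          ≈⟨ solve 5 (λ a b c d r →
               (a ⊗ c ⊕ r ⊗ r ⊗ (b ⊗ d)) ⊕ r ⊗ (a ⊗ d ⊕ b ⊗ c) ⊜ (a ⊕ r ⊗ b) ⊗ (c ⊕ r ⊗ d))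
               S.refl (h a) (h b) (h c) (h d) r ⟩
        (h a S.+ r S.* h b) S.* (h c S.+ r S.* h d) ∎)
      (λ (a , b) → begin
        h (R.- a) S.+ r S.* h (R.- b)   ≈⟨ S.+-cong (h.-‿homo a) (S.*-congˡ (h.-‿homo b)) ⟩
        (S.- h a) S.+ r S.* (S.- h b)
          ≈⟨ solve 3 (λ a b r → ⊝ a ⊕ r ⊗ ⊝ b ⊜ ⊝ (a ⊕ r ⊗ b)) S.refl (h a) (h b) r ⟩
        S.- (h a S.+ r S.* h b)         ∎)
      (S.trans (S.+-cong h.0#-homo (S.trans (S.*-congˡ h.0#-homo) (S.zeroʳ r))) (S.+-identityˡ _))
      (S.trans (S.+-cong h.1#-homo (S.trans (S.*-congˡ h.0#-homo) (S.zeroʳ r))) (S.+-identityʳ _))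

-- Fractions

module TotalFractions (R : CommutativeRing 0ℓ 0ℓ) where
  private module R = CommutativeRing R
  open R using (Carrier; _+_; _*_; -_; 0#; 1#; _≈_)
  open IntegerCoefficients R
  open SetoidReasoning R.setoid

  -- Non-zero-divisors
  Regular : Carrier → Set
  Regular s = ∀ a → s * a ≈ 0# → a ≈ 0#

  record Frac : Set where
    constructor _/_[_]
    field
      num     : Carrier
      den     : Carrier
      regular : Regular den

  regular-1 : Regular 1#
  regular-1 a e = R.trans (R.sym (R.*-identityˡ a)) e

  private
    regular-* : ∀ {s t} → Regular s → Regular t → Regular (s * t)
    regular-* {s} {t} r r′ a e = r′ a (r (t * a) (R.trans (R.sym (R.*-assoc s t a)) e))

    regular-cancel : ∀ {s} → Regular s → ∀ {a b} → s * a ≈ s * b → a ≈ b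
    regular-cancel {s} r {a} {b} e = begin
      a              ≈⟨ solve 2 (λ a b → a ⊜ (a ⊖ b) ⊕ b) R.refl a b ⟩
      (a + - b) + b  ≈⟨ R.+-congʳ (r _ (begin
        s * (a + - b)      ≈⟨ solve 3 (λ s a b → s ⊗ (a ⊖ b) ⊜ s ⊗ a ⊖ s ⊗ b) R.refl s a b ⟩
        s * a + - (s * b)  ≈⟨ R.+-congʳ e ⟩
        s * b + - (s * b)  ≈⟨ R.-‿inverseʳ _ ⟩
        0#                 ∎)) ⟩
      0# + b         ≈⟨ R.+-identityˡ b ⟩
      b              ∎

  -- The total ring of fractions: every non-zero-divisor is inverted.
  fractions : CommutativeRing 0ℓ 0ℓ
  fractions = RingAxioms.commutativeRing {A = Frac}
    {_≈_ = λ (a / s [ _ ]) (b / t [ _ ]) → a * t ≈ b * s}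
    {_+_ = λ (a / s [ r ]) (b / t [ r′ ]) → (a * t + b * s) / s * t [ regular-* r r′ ]}
    {_*_ = λ (a / s [ r ]) (b / t [ r′ ]) → (a * b) / s * t [ regular-* r r′ ]}
    { -_ = λ (a / s [ r ]) → (- a) / s [ r ]}
    {0# = 0# / 1# [ regular-1 ]} {1# = 1# / 1# [ regular-1 ]} record
    { isEquivalence = record
      { refl  = R.refl
      ; sym   = R.sym
      ; trans = λ { {a / s [ _ ]} {b / t [ r ]} {c / u [ _ ]} e f → regular-cancel r (begin
          t * (a * u)    ≈⟨ solve 3 (λ a t u → t ⊗ (a ⊗ u) ⊜ a ⊗ t ⊗ u) R.refl a t u ⟩
          a * t * u      ≈⟨ R.*-congʳ e ⟩
          b * s * u      ≈⟨ solve 3 (λ b s u → b ⊗ s ⊗ u ⊜ b ⊗ u ⊗ s) R.refl b s u ⟩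
          b * u * s      ≈⟨ R.*-congʳ f ⟩
          c * t * s      ≈⟨ solve 3 (λ c t s → c ⊗ t ⊗ s ⊜ t ⊗ (c ⊗ s)) R.refl c t s ⟩
          t * (c * s)    ∎) }
      }
    ; add-cong = λ { {a / s [ _ ]} {a′ / s′ [ _ ]} {b / t [ _ ]} {b′ / t′ [ _ ]} e f → begin
        (a * t + b * s) * (s′ * t′)
          ≈⟨ solve 6 (λ a s s′ b t t′ → (a ⊗ t ⊕ b ⊗ s) ⊗ (s′ ⊗ t′)
               ⊜ a ⊗ s′ ⊗ (t ⊗ t′) ⊕ b ⊗ t′ ⊗ (s ⊗ s′)) R.refl a s s′ b t t′ ⟩
        a * s′ * (t * t′) + b * t′ * (s * s′)
          ≈⟨ R.+-cong (R.*-congʳ e) (R.*-congʳ f) ⟩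
        a′ * s * (t * t′) + b′ * t * (s * s′)
          ≈⟨ solve 6 (λ a′ s s′ b′ t t′ → a′ ⊗ s ⊗ (t ⊗ t′) ⊕ b′ ⊗ t ⊗ (s ⊗ s′)
               ⊜ (a′ ⊗ t′ ⊕ b′ ⊗ s′) ⊗ (s ⊗ t)) R.refl a′ s s′ b′ t t′ ⟩
        (a′ * t′ + b′ * s′) * (s * t) ∎ }
    ; mul-cong = λ { {a / s [ _ ]} {a′ / s′ [ _ ]} {b / t [ _ ]} {b′ / t′ [ _ ]} e f → begin
        a * b * (s′ * t′)
          ≈⟨ solve 4 (λ a s′ b t′ → a ⊗ b ⊗ (s′ ⊗ t′) ⊜ a ⊗ s′ ⊗ (b ⊗ t′)) R.refl a s′ b t′ ⟩
        a * s′ * (b * t′)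
          ≈⟨ R.*-cong e f ⟩
        a′ * s * (b′ * t)
          ≈⟨ solve 4 (λ a s′ b t′ → a ⊗ b ⊗ (s′ ⊗ t′) ⊜ a ⊗ s′ ⊗ (b ⊗ t′)) R.refl a′ s b′ t ⟨
        a′ * b′ * (s * t) ∎ }
    ; opp-cong = λ { {a / s [ _ ]} {b / t [ _ ]} e → begin
        - a * t    ≈⟨ solve 2 (λ a t → ⊝ a ⊗ t ⊜ ⊝ (a ⊗ t)) R.refl a t ⟩
        - (a * t)  ≈⟨ R.-‿cong e ⟩
        - (b * s)  ≈⟨ solve 2 (λ a t → ⊝ a ⊗ t ⊜ ⊝ (a ⊗ t)) R.refl b s ⟨
        - b * s    ∎ }
    ; add-assoc = λ (a / s [ _ ]) (b / t [ _ ]) (c / u [ _ ]) →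
        solve 6 (λ a s b t c u →
            ((a ⊗ t ⊕ b ⊗ s) ⊗ u ⊕ c ⊗ (s ⊗ t)) ⊗ (s ⊗ (t ⊗ u))
          ⊜ (a ⊗ (t ⊗ u) ⊕ (b ⊗ u ⊕ c ⊗ t) ⊗ s) ⊗ (s ⊗ t ⊗ u)) R.refl a s b t c u
    ; add-comm = λ (a / s [ _ ]) (b / t [ _ ]) →
        solve 4 (λ a s b t → (a ⊗ t ⊕ b ⊗ s) ⊗ (t ⊗ s) ⊜ (b ⊗ s ⊕ a ⊗ t) ⊗ (s ⊗ t)) R.refl a s b t
    ; add-identity = λ (a / s [ _ ]) →
        solve 2 (λ a s → (κ 0ℤ ⊗ s ⊕ a ⊗ κ 1ℤ) ⊗ s ⊜ a ⊗ (κ 1ℤ ⊗ s)) R.refl a s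
    ; add-inverse = λ (a / s [ _ ]) →
        solve 2 (λ a s → (⊝ a ⊗ s ⊕ a ⊗ s) ⊗ κ 1ℤ ⊜ κ 0ℤ ⊗ (s ⊗ s)) R.refl a s
    ; mul-assoc = λ (a / s [ _ ]) (b / t [ _ ]) (c / u [ _ ]) →
        solve 6 (λ a s b t c u → (a ⊗ b ⊗ c) ⊗ (s ⊗ (t ⊗ u)) ⊜ (a ⊗ (b ⊗ c)) ⊗ (s ⊗ t ⊗ u))
          R.refl a s b t c u
    ; mul-comm = λ (a / s [ _ ]) (b / t [ _ ]) →
        solve 4 (λ a s b t → (a ⊗ b) ⊗ (t ⊗ s) ⊜ (b ⊗ a) ⊗ (s ⊗ t)) R.refl a s b t
    ; mul-identity = λ (a / s [ _ ]) →
        solve 2 (λ a s → (κ 1ℤ ⊗ a) ⊗ s ⊜ a ⊗ (κ 1ℤ ⊗ s)) R.refl a s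
    ; distrib = λ (a / s [ _ ]) (b / t [ _ ]) (c / u [ _ ]) →
        solve 6 (λ a s b t c u →
            (a ⊗ (b ⊗ u ⊕ c ⊗ t)) ⊗ ((s ⊗ t) ⊗ (s ⊗ u))
          ⊜ ((a ⊗ b) ⊗ (s ⊗ u) ⊕ (a ⊗ c) ⊗ (s ⊗ t)) ⊗ (s ⊗ (t ⊗ u))) R.refl a s b t c u
    }

  fraction : Carrier → Frac
  fraction a = a / 1# [ regular-1 ]

  fraction-hom : IsRingHomomorphism R.rawRing (CommutativeRing.rawRing fractions) fraction
  fraction-hom = ringHomomorphism {S = fractions} (λ e → R.*-congʳ e)
    (λ a b → solve 2 (λ a b → (a ⊕ b) ⊗ (κ 1ℤ ⊗ κ 1ℤ) ⊜ (a ⊗ κ 1ℤ ⊕ b ⊗ κ 1ℤ) ⊗ κ 1ℤ) R.refl a b)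
    (λ a b → solve 2 (λ a b → (a ⊗ b) ⊗ (κ 1ℤ ⊗ κ 1ℤ) ⊜ (a ⊗ b) ⊗ κ 1ℤ) R.refl a b)
    (λ _ → R.refl) R.refl R.refl

-- Homomorphisms out of polynomial rings

-- A ring S with a homomorphism ι from k is a k-algebra, and evaluation at
-- elements of S is the homomorphism of k-algebras given by the universal
-- property of the polynomial ring.
module Evaluation {k : Field} (S : CommutativeRing 0ℓ 0ℓ)
                  {ι : Field.Carrier k → CommutativeRing.Carrier S}
                  (ι-hom : IsRingHomomorphism (Field.rawRing k) (CommutativeRing.rawRing S) ι)
                  where
  private
    module k = Field k
    module S = CommutativeRing S
    module ι = IsRingHomomorphism ι-hom

  module _ {n : ℕ} where

    ev : Vector S.Carrier n → Poly k n → S.Carrier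
    ev = fold S.rawRing ι

    ev-cong : ∀ {ρ p q} → p ≋ q → ev ρ p S.≈ ev ρ q
    ev-cong ≋-refl = S.refl
    ev-cong (≋-sym e) = S.sym (ev-cong e)
    ev-cong (≋-trans e f) = S.trans (ev-cong e) (ev-cong f)
    ev-cong (con-cong e) = ι.⟦⟧-cong e
    ev-cong (+-cong e f) = S.+-cong (ev-cong e) (ev-cong f)
    ev-cong (*-cong e f) = S.*-cong (ev-cong e) (ev-cong f)
    ev-cong (neg-cong e) = S.-‿cong (ev-cong e)
    ev-cong (con-+ a b) = ι.+-homo a b
    ev-cong (con-* a b) = ι.*-homo a b
    ev-cong (+-assoc p q r) = S.+-assoc _ _ _
    ev-cong (+-comm p q) = S.+-comm _ _
    ev-cong (+-identityˡ p) = S.trans (S.+-congʳ ι.0#-homo) (S.+-identityˡ _)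
    ev-cong (+-inverseˡ p) = S.trans (S.-‿inverseˡ _) (S.sym ι.0#-homo)
    ev-cong (*-assoc p q r) = S.*-assoc _ _ _
    ev-cong (*-comm p q) = S.*-comm _ _
    ev-cong (*-identityˡ p) = S.trans (S.*-congʳ ι.1#-homo) (S.*-identityˡ _)
    ev-cong (distribˡ p q r) = S.distribˡ _ _ _

    -- A map that commutes with the operations is an evaluation.
    ev-unique : ∀ {ρ} {f : Poly k n → S.Carrier} →
      (∀ a → f (con a) S.≈ ι a) → (∀ i → f (var i) S.≈ ρ i) →
      (∀ p q → f (p :+ q) S.≈ f p S.+ f q) → (∀ p q → f (p :* q) S.≈ f p S.* f q) →
      (∀ p → f (:- p) S.≈ S.- f p) → ∀ p → f p S.≈ ev ρ p
    ev-unique {ρ} {f} f-con f-var f-+ f-* f-neg = go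
      where
      go : ∀ p → f p S.≈ ev ρ p
      go (con a)  = f-con a
      go (var i)  = f-var i
      go (p :+ q) = S.trans (f-+ p q) (S.+-cong (go p) (go q))
      go (p :* q) = S.trans (f-* p q) (S.*-cong (go p) (go q))
      go (:- p)   = S.trans (f-neg p) (S.-‿cong (go p))

    ev-≗ : ∀ {ρ ρ′} → (∀ i → ρ i S.≈ ρ′ i) → ∀ p → ev ρ p S.≈ ev ρ′ p
    ev-≗ e = ev-unique (λ _ → S.refl) e (λ _ _ → S.refl) (λ _ _ → S.refl) (λ _ → S.refl)

    ev-ideal : ∀ {G ρ} → (∀ {p} → p ∈ G → ev ρ p S.≈ S.0#) → ∀ {p} → p ∈ ⟨ G ⟩ → ev ρ p S.≈ S.0#
    ev-ideal G≈0 (gen g)    = G≈0 g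
    ev-ideal G≈0 zero       = ι.0#-homo
    ev-ideal G≈0 (add g h)  = S.trans (S.+-cong (ev-ideal G≈0 g) (ev-ideal G≈0 h)) (S.+-identityˡ _)
    ev-ideal G≈0 (mul p g)  = S.trans (S.*-congˡ (ev-ideal G≈0 g)) (S.zeroʳ _)
    ev-ideal G≈0 (resp e g) = S.trans (S.sym (ev-cong e)) (ev-ideal G≈0 g)

  ev-subst : ∀ {m n} {ρ : Vector S.Carrier n} (σ : Vector (Poly k n) m) →
             ∀ p → ev ρ (subst σ p) S.≈ ev (ev ρ ∘ σ) p
  ev-subst σ = ev-unique (λ _ → S.refl) (λ _ → S.refl)
    (λ _ _ → S.refl) (λ _ _ → S.refl) (λ _ → S.refl)

module _ {k : Field} {n : ℕ} where
  private module k = Field k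

  con-neg : ∀ a → con {k} {n} (k.- a) ≋ :- con a
  con-neg a = begin
    con (k.- a)                        ≈⟨ ≋-sym (P.+-identityʳ _) ⟩
    con (k.- a) :+ 𝟘                   ≈⟨ +-cong ≋-refl (≋-sym (P.-‿inverseʳ (con a))) ⟩
    con (k.- a) :+ (con a :+ :- con a) ≈⟨ ≋-sym (+-assoc _ _ _) ⟩
    (con (k.- a) :+ con a) :+ :- con a ≈⟨ +-cong (≋-trans (≋-sym (con-+ _ _)) (con-cong (k.-‿inverseˡ a))) ≋-refl ⟩
    𝟘 :+ :- con a                      ≈⟨ +-identityˡ _ ⟩
    :- con a                           ∎
    where
    module P = CommutativeRing (polyRing k n)
    open SetoidReasoning P.setoid

  con-hom : IsRingHomomorphism (Field.rawRing k) (CommutativeRing.rawRing (polyRing k n)) con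
  con-hom = ringHomomorphism {S = polyRing k n} con-cong con-+ con-* con-neg ≋-refl ≋-refl

module Subst {k : Field} {n : ℕ} = Evaluation {k} (polyRing k n) con-hom

module _ {k : Field} (E : Extension k) where
  private module E = Extension E

  module Eval = Evaluation {k} E.commutativeRing E.isRingHomomorphism

  con∘ι-hom : ∀ {n} → IsRingHomomorphism (Field.rawRing k)
                (CommutativeRing.rawRing (polyRing E.top n)) (con ∘ E.ι)
  con∘ι-hom {n} = ringHomomorphism {S = polyRing E.top n}
    (λ e → con-cong (ι.⟦⟧-cong e))
    (λ a b → ≋-trans (con-cong (ι.+-homo a b)) (con-+ _ _))
    (λ a b → ≋-trans (con-cong (ι.*-homo a b)) (con-* _ _))
    (λ a → ≋-trans (con-cong (ι.-‿homo a)) (con-neg _))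
    (con-cong ι.0#-homo) (con-cong ι.1#-homo)
    where module ι = IsRingHomomorphism E.isRingHomomorphism

subst-var : ∀ {k n} (p : Poly k n) → subst var p ≋ p
subst-var p = ≋-sym (Subst.ev-unique {f = λ p → p} (λ _ → ≋-refl) (λ _ → ≋-refl)
  (λ _ _ → ≋-refl) (λ _ _ → ≋-refl) (λ _ → ≋-refl) p)

-- Residue class rings

module _ {k : Field} {n : ℕ} {G : Pred (Poly k n) 0ℓ} where
  private module P = CommutativeRing (polyRing k n)

  ≋⇒mod : ∀ {p q} → p ≋ q → p ≡ q [mod ⟨ G ⟩ ]
  ≋⇒mod {q = q} e = resp (≋-sym (≋-trans (+-cong e ≋-refl) (P.-‿inverseʳ q))) zero

-- The residue class ring of the ideal generated by G.
module _ {k : Field} {n : ℕ} (G : Pred (Poly k n) 0ℓ) where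
  open IntegerCoefficients (polyRing k n)

  Quotient : CommutativeRing 0ℓ 0ℓ
  Quotient = RingAxioms.commutativeRing {A = Poly k n} {_≈_ = λ p q → p ≡ q [mod ⟨ G ⟩ ]}
    {_+_ = _:+_} {_*_ = _:*_} { -_ = :-_ } {0# = 𝟘} {1# = 𝟙} record
    { isEquivalence = record
      { refl  = ≋⇒mod ≋-refl
      ; sym   = λ {p} {q} e →
          resp (solve 2 (λ p q → ⊝ (κ 1ℤ) ⊗ (p ⊖ q) ⊜ q ⊖ p) ≋-refl p q)
            (mul (:- 𝟙) e)
      ; trans = λ {p} {q} {r} e f →
          resp (solve 3 (λ p q r → (p ⊖ q) ⊕ (q ⊖ r) ⊜ p ⊖ r) ≋-refl p q r) (add e f)
      }
    ; add-cong = λ {p} {p′} {q} {q′} e f →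
        resp (solve 4 (λ p p′ q q′ → (p ⊖ p′) ⊕ (q ⊖ q′) ⊜ (p ⊕ q) ⊖ (p′ ⊕ q′)) ≋-refl p p′ q q′)
          (add e f)
    ; mul-cong = λ {p} {p′} {q} {q′} e f →
        resp (solve 4 (λ p p′ q q′ → q ⊗ (p ⊖ p′) ⊕ p′ ⊗ (q ⊖ q′) ⊜ p ⊗ q ⊖ p′ ⊗ q′) ≋-refl p p′ q q′)
          (add (mul q e) (mul p′ f))
    ; opp-cong = λ {p} {p′} e →
        resp (solve 2 (λ p p′ → ⊝ (κ 1ℤ) ⊗ (p ⊖ p′) ⊜ ⊝ p ⊖ ⊝ p′) ≋-refl p p′) (mul (:- 𝟙) e)
    ; add-assoc    = λ p q r → ≋⇒mod (+-assoc p q r)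
    ; add-comm     = λ p q → ≋⇒mod (+-comm p q)
    ; add-identity = λ p → ≋⇒mod (+-identityˡ p)
    ; add-inverse  = λ p → ≋⇒mod (+-inverseˡ p)
    ; mul-assoc    = λ p q r → ≋⇒mod (*-assoc p q r)
    ; mul-comm     = λ p q → ≋⇒mod (*-comm p q)
    ; mul-identity = λ p → ≋⇒mod (*-identityˡ p)
    ; distrib      = λ p q r → ≋⇒mod (distribˡ p q r)
    }

module _ {k : Field} {n : ℕ} {G : Pred (Poly k n) 0ℓ} where
  private
    minus-0 : ∀ p → p :- 𝟘 ≋ p
    minus-0 p = solve 1 (λ p → p ⊖ κ 0ℤ ⊜ p) ≋-refl p
      where open IntegerCoefficients (polyRing k n)

  ∈⇒mod : ∀ {p} → p ∈ ⟨ G ⟩ → p ≡ 𝟘 [mod ⟨ G ⟩ ]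
  ∈⇒mod = resp (≋-sym (minus-0 _))

  mod⇒∈ : ∀ {p} → p ≡ 𝟘 [mod ⟨ G ⟩ ] → p ∈ ⟨ G ⟩
  mod⇒∈ = resp (minus-0 _)

  con-hom-mod : IsRingHomomorphism (Field.rawRing k) (CommutativeRing.rawRing (Quotient G)) con
  con-hom-mod = ringHomomorphism {S = Quotient G} (λ e → ≋⇒mod (con-cong e))
    (λ a b → ≋⇒mod (con-+ a b)) (λ a b → ≋⇒mod (con-* a b)) (λ a → ≋⇒mod (con-neg a))
    (≋⇒mod ≋-refl) (≋⇒mod ≋-refl)

⟨⟩-mono : ∀ {k n} {G H : Pred (Poly k n) 0ℓ} → (∀ {p} → p ∈ G → p ∈ ⟨ H ⟩) →
          ∀ {p} → p ∈ ⟨ G ⟩ → p ∈ ⟨ H ⟩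
⟨⟩-mono G⊆H (gen g)    = G⊆H g
⟨⟩-mono G⊆H zero       = zero
⟨⟩-mono G⊆H (add g h)  = add (⟨⟩-mono G⊆H g) (⟨⟩-mono G⊆H h)
⟨⟩-mono G⊆H (mul p g)  = mul p (⟨⟩-mono G⊆H g)
⟨⟩-mono G⊆H (resp e g) = resp e (⟨⟩-mono G⊆H g)

module _ {k K : Field} {m : ℕ} {ι : Field.Carrier k → Poly K m}
         (ι-hom : IsRingHomomorphism (Field.rawRing k) (CommutativeRing.rawRing (polyRing K m)) ι)
         where
  open Evaluation {k} (polyRing K m) ι-hom

  ev-⟨⟩ : ∀ {n} {G : Pred (Poly k n) 0ℓ} {H : Pred (Poly K m) 0ℓ} {ρ} →
    (∀ {p} → p ∈ G → ev ρ p ∈ ⟨ H ⟩) → ∀ {p} → p ∈ ⟨ G ⟩ → ev ρ p ∈ ⟨ H ⟩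
  ev-⟨⟩ G→H (gen g)            = G→H g
  ev-⟨⟩ G→H zero               = resp (≋-sym (IsRingHomomorphism.0#-homo ι-hom)) zero
  ev-⟨⟩ G→H (add g h)          = add (ev-⟨⟩ G→H g) (ev-⟨⟩ G→H h)
  ev-⟨⟩ {ρ = ρ} G→H (mul p g)  = mul (ev ρ p) (ev-⟨⟩ G→H g)
  ev-⟨⟩ G→H (resp e g)         = resp (ev-cong e) (ev-⟨⟩ G→H g)

-- Identities between rational polynomials

module _ {n : ℕ} where
  private
    module P = CommutativeRing (polyRing ℚ-field n)

    morphism : Field.rawRing ℚ-field -Raw-AlmostCommutative⟶ fromCommutativeRing (polyRing ℚ-field n)
    morphism = record
      { ⟦_⟧ = con ; +-homo = con-+ ; *-homo = con-* ; -‿homo = con-neg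
      ; 0-homo = ≋-refl ; 1-homo = ≋-refl }

    module Solver = Algebra.Solver.Ring (Field.rawRing ℚ-field)
      (fromCommutativeRing (polyRing ℚ-field n)) morphism
      (λ a b → Maybe.map con-cong (dec⇒maybe (a ℚ.≟ b)))
    open Solver using (normalise; _≟N_; ⟦_⟧N-cong)

    quote′ : Poly ℚ-field n → Solver.Polynomial n
    quote′ (con a)  = Solver.con a
    quote′ (var i)  = Solver.var i
    quote′ (p :+ q) = quote′ p Solver.:+ quote′ q
    quote′ (p :* q) = quote′ p Solver.:* quote′ q
    quote′ (:- p)   = Solver.:- quote′ p

    ρ : Vec.Vec (Poly ℚ-field n) n
    ρ = Vec.tabulate var

    quote-correct : ∀ p → Solver.⟦ quote′ p ⟧ ρ ≡ p
    quote-correct (con a)  = refl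
    quote-correct (var i)  = Vec.lookup∘tabulate var i
    quote-correct (p :+ q) = ≡.cong₂ _:+_ (quote-correct p) (quote-correct q)
    quote-correct (p :* q) = ≡.cong₂ _:*_ (quote-correct p) (quote-correct q)
    quote-correct (:- p)   = ≡.cong :-_ (quote-correct p)

  -- Polynomials with the same normal form are equal; for closed p and q the
  -- implicit argument is found by computation.
  identity : ∀ {p q : Poly ℚ-field n} →
    {T (is-just (normalise (quote′ p) ≟N normalise (quote′ q)))} → p ≋ q
  identity {p} {q} {ok} with normalise (quote′ p) ≟N normalise (quote′ q)
  ... | just e = ≡.subst₂ _≋_ (quote-correct p) (quote-correct q)
    (≋-trans (≋-sym (Solver.correct (quote′ p) ρ)) (≋-trans (⟦ e ⟧N-cong ρ) (Solver.correct (quote′ q) ρ)))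

-- Expansion in powers of the first variable

module _ {k : Field} {n : ℕ} where
  private
    module P = CommutativeRing (polyRing k (suc n))
    open IntegerCoefficients (polyRing k (suc n))

    t : Poly k (suc n)
    t = var zero

  -- p(0, x₁, …, xₙ), where t = x₀ is the first variable.
  constantPart : Poly k (suc n) → Poly k n
  constantPart = subst (𝟘 ∷ var)

  weaken : Poly k n → Poly k (suc n)
  weaken = subst (λ i → var (suc i))

  -- The difference quotient (p(t) - p(0)) / t, computed by a twisted Leibniz rule.
  δ : Poly k (suc n) → Poly k (suc n)
  δ (con a)       = 𝟘
  δ (var zero)    = 𝟙
  δ (var (suc i)) = 𝟘
  δ (p :+ q)      = δ p :+ δ q
  δ (p :* q)      = δ p :* q :+ weaken (constantPart p) :* δ q
  δ (:- p)        = :- δ p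

  constantPart-cong : ∀ {p q} → p ≋ q → constantPart p ≋ constantPart q
  constantPart-cong = Subst.ev-cong

  constantPart-weaken : ∀ p → constantPart (weaken p) ≋ p
  constantPart-weaken p = ≋-trans (Subst.ev-subst _ p) (subst-var p)

  private
    weaken-cong : ∀ {p q} → p ≋ q → weaken p ≋ weaken q
    weaken-cong = Subst.ev-cong

  expand : ∀ p → p ≋ weaken (constantPart p) :+ t :* δ p
  expand (con a)       = solve 2 (λ a t → a ⊜ a ⊕ t ⊗ κ 0ℤ) ≋-refl (con a) t
  expand (var zero)    = solve 1 (λ t → t ⊜ κ 0ℤ ⊕ t ⊗ κ 1ℤ) ≋-refl t
  expand (var (suc i)) = solve 2 (λ a t → a ⊜ a ⊕ t ⊗ κ 0ℤ) ≋-refl (var (suc i)) t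
  expand (p :+ q)      = ≋-trans (+-cong (expand p) (expand q))
    (solve 5 (λ a b c d t → (a ⊕ t ⊗ b) ⊕ (c ⊕ t ⊗ d) ⊜ (a ⊕ c) ⊕ t ⊗ (b ⊕ d)) ≋-refl
       (weaken (constantPart p)) (δ p) (weaken (constantPart q)) (δ q) t)
  expand (p :* q)      = begin
    p :* q
      ≈⟨ *-cong (expand p) ≋-refl ⟩
    (p₀ :+ t :* δ p) :* q
      ≈⟨ distribʳ q p₀ (t :* δ p) ⟩
    p₀ :* q :+ t :* δ p :* q
      ≈⟨ +-cong (*-cong ≋-refl (expand q)) ≋-refl ⟩
    p₀ :* (q₀ :+ t :* δ q) :+ t :* δ p :* q
      ≈⟨ solve 6 (λ a b c d q t → a ⊗ (c ⊕ t ⊗ d) ⊕ t ⊗ b ⊗ q ⊜ a ⊗ c ⊕ t ⊗ (b ⊗ q ⊕ a ⊗ d)) ≋-refl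
           p₀ (δ p) q₀ (δ q) q t ⟩
    p₀ :* q₀ :+ t :* (δ p :* q :+ p₀ :* δ q) ∎
    where
    open SetoidReasoning P.setoid
    open P using (distribʳ)
    p₀ = weaken (constantPart p)
    q₀ = weaken (constantPart q)
  expand (:- p)        = ≋-trans (neg-cong (expand p))
    (solve 3 (λ a b t → ⊝ (a ⊕ t ⊗ b) ⊜ ⊝ a ⊕ t ⊗ ⊝ b) ≋-refl (weaken (constantPart p)) (δ p) t)

  -- Only commutativity of the product needs an argument: the Leibniz rule is not
  -- symmetric, and the defect vanishes by expand.
  δ-cong : ∀ {p q} → p ≋ q → δ p ≋ δ q
  δ-cong ≋-refl = ≋-refl
  δ-cong (≋-sym e) = ≋-sym (δ-cong e)
  δ-cong (≋-trans e f) = ≋-trans (δ-cong e) (δ-cong f)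
  δ-cong (con-cong e) = ≋-refl
  δ-cong (+-cong e f) = +-cong (δ-cong e) (δ-cong f)
  δ-cong (*-cong e f) = +-cong (*-cong (δ-cong e) f)
    (*-cong (weaken-cong (constantPart-cong e)) (δ-cong f))
  δ-cong (neg-cong e) = neg-cong (δ-cong e)
  δ-cong (con-+ a b) = ≋-sym (+-identityˡ 𝟘)
  δ-cong (con-* a b) = solve 2 (λ a b → κ 0ℤ ⊜ κ 0ℤ ⊗ b ⊕ a ⊗ κ 0ℤ) ≋-refl (con a) (con b)
  δ-cong (+-assoc p q r) = +-assoc _ _ _
  δ-cong (+-comm p q) = +-comm _ _
  δ-cong (+-identityˡ p) = +-identityˡ _
  δ-cong (+-inverseˡ p) = +-inverseˡ _
  δ-cong (*-assoc p q r) =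
    solve 7 (λ p₀ q₀ p′ q q′ r r′ →
        (p′ ⊗ q ⊕ p₀ ⊗ q′) ⊗ r ⊕ (p₀ ⊗ q₀) ⊗ r′ ⊜ p′ ⊗ (q ⊗ r) ⊕ p₀ ⊗ (q′ ⊗ r ⊕ q₀ ⊗ r′)) ≋-refl
      (weaken (constantPart p)) (weaken (constantPart q)) (δ p) q (δ q) r (δ r)
  δ-cong (*-comm p q) = begin
    δ p :* q :+ p₀ :* δ q                ≈⟨ +-cong (*-cong ≋-refl (expand q)) ≋-refl ⟩
    δ p :* (q₀ :+ t :* δ q) :+ p₀ :* δ q
      ≈⟨ solve 5 (λ p₀ p′ q₀ q′ t → p′ ⊗ (q₀ ⊕ t ⊗ q′) ⊕ p₀ ⊗ q′ ⊜ q′ ⊗ (p₀ ⊕ t ⊗ p′) ⊕ q₀ ⊗ p′) ≋-refl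
           p₀ (δ p) q₀ (δ q) t ⟩
    δ q :* (p₀ :+ t :* δ p) :+ q₀ :* δ p ≈⟨ +-cong (*-cong ≋-refl (expand p)) ≋-refl ⟨
    δ q :* p :+ q₀ :* δ p                ∎
    where
    open SetoidReasoning P.setoid
    p₀ = weaken (constantPart p)
    q₀ = weaken (constantPart q)
  δ-cong (*-identityˡ p) = solve 2 (λ p p′ → κ 0ℤ ⊗ p ⊕ κ 1ℤ ⊗ p′ ⊜ p′) ≋-refl p (δ p)
  δ-cong (distribˡ p q r) =
    solve 6 (λ p₀ p′ q q′ r r′ →
        p′ ⊗ (q ⊕ r) ⊕ p₀ ⊗ (q′ ⊕ r′) ⊜ (p′ ⊗ q ⊕ p₀ ⊗ q′) ⊕ (p′ ⊗ r ⊕ p₀ ⊗ r′)) ≋-refl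
      (weaken (constantPart p)) (δ p) q (δ q) r (δ r)

  δ-weaken : ∀ p → δ (weaken p) ≋ 𝟘
  δ-weaken (con a)  = ≋-refl
  δ-weaken (var i)  = ≋-refl
  δ-weaken (p :+ q) = ≋-trans (+-cong (δ-weaken p) (δ-weaken q)) (+-identityˡ _)
  δ-weaken (p :* q) = ≋-trans (+-cong (*-cong (δ-weaken p) ≋-refl) (*-cong ≋-refl (δ-weaken q)))
    (solve 2 (λ a b → κ 0ℤ ⊗ a ⊕ b ⊗ κ 0ℤ ⊜ κ 0ℤ) ≋-refl (weaken q) _)
  δ-weaken (:- p)   = ≋-trans (neg-cong (δ-weaken p)) (solve 0 (⊝ κ 0ℤ ⊜ κ 0ℤ) ≋-refl)

  constantPart-t* : ∀ p → constantPart (t :* p) ≋ 𝟘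
  constantPart-t* p = CommutativeRing.zeroˡ (polyRing k n) _

  δ-t* : ∀ p → δ (t :* p) ≋ p
  δ-t* p = solve 2 (λ p q → κ 1ℤ ⊗ p ⊕ κ 0ℤ ⊗ q ⊜ p) ≋-refl p (δ p)

  ≋t*δ : ∀ {p} → constantPart p ≋ 𝟘 → p ≋ t :* δ p
  ≋t*δ {p} p₀≋0 = ≋-trans (expand p) (≋-trans (+-cong (weaken-cong p₀≋0) ≋-refl) (+-identityˡ _))

  t-cancel : ∀ {p q} → t :* p ≋ t :* q → p ≋ q
  t-cancel {p} {q} e = ≋-trans (≋-sym (δ-t* p)) (≋-trans (δ-cong e) (δ-t* q))

  t*≋0 : ∀ {p} → p ≋ 𝟘 → t :* p ≋ 𝟘
  t*≋0 e = ≋-trans (*-cong ≋-refl e) (P.zeroʳ t)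

  ≋0-from-parts : ∀ {p} → constantPart p ≋ 𝟘 → δ p ≋ 𝟘 → p ≋ 𝟘
  ≋0-from-parts e f = ≋-trans (≋t*δ e) (t*≋0 f)

  -- Some iterate of δ kills p, i.e. p has bounded degree in t.  Inductions on the
  -- degree are inductions on this predicate.
  data Bounded (p : Poly k (suc n)) : Set where
    stop : p ≋ 𝟘 → Bounded p
    step : Bounded (δ p) → Bounded p

  private
    bounded-resp : ∀ {p q} → p ≋ q → Bounded p → Bounded q
    bounded-resp e (stop f) = stop (≋-trans (≋-sym e) f)
    bounded-resp e (step b) = step (bounded-resp (δ-cong e) b)

    bounded-δ : ∀ {p} → Bounded p → Bounded (δ p)
    bounded-δ (stop e) = stop (δ-cong e)
    bounded-δ (step b) = b

    bounded-+ : ∀ {p q} → Bounded p → Bounded q → Bounded (p :+ q)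
    bounded-+ (stop e) b = bounded-resp (≋-sym (≋-trans (+-cong e ≋-refl) (+-identityˡ _))) b
    bounded-+ (step a) b = step (bounded-+ a (bounded-δ b))

    bounded-weaken* : ∀ a {p} → Bounded p → Bounded (weaken a :* p)
    bounded-weaken* a (stop e) = stop (≋-trans (*-cong ≋-refl e) (P.zeroʳ _))
    bounded-weaken* a {p} (step b) = step (bounded-resp
      (≋-sym (≋-trans
        (+-cong (*-cong (δ-weaken a) ≋-refl) (*-cong (weaken-cong (constantPart-weaken a)) ≋-refl))
        (solve 2 (λ p q → κ 0ℤ ⊗ p ⊕ q ⊜ q) ≋-refl p (weaken a :* δ p))))
      (bounded-weaken* a b))

    bounded-* : ∀ {p q} → Bounded p → Bounded q → Bounded (p :* q)
    bounded-* (stop e) b = stop (≋-trans (*-cong e ≋-refl) (P.zeroˡ _))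
    bounded-* {p} (step a) b =
      step (bounded-+ (bounded-* a b) (bounded-weaken* (constantPart p) (bounded-δ b)))

    bounded-neg : ∀ {p} → Bounded p → Bounded (:- p)
    bounded-neg (stop e) = stop (≋-trans (neg-cong e) (solve 0 (⊝ κ 0ℤ ⊜ κ 0ℤ) ≋-refl))
    bounded-neg (step a) = step (bounded-neg a)

  bounded : ∀ p → Bounded p
  bounded (con a)       = step (stop ≋-refl)
  bounded (var zero)    = step (step (stop ≋-refl))
  bounded (var (suc i)) = step (stop ≋-refl)
  bounded (p :+ q)      = bounded-+ (bounded p) (bounded q)
  bounded (p :* q)      = bounded-* (bounded p) (bounded q)
  bounded (:- p)        = bounded-neg (bounded p)

-- Polynomial rings over fields are domains

module _ {k : Field} where
  private module k = Field k

  field-domain : IsDomain k.commutativeRing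
  field-domain a b ab≈0 with a k.≟ k.0#
  ... | yes a≈0 = inj₁ a≈0
  ... | no a≉0  = inj₂ (begin
    b                 ≈⟨ k.*-identityˡ b ⟨
    k.1# k.* b        ≈⟨ k.*-congʳ aa⁻¹≈1 ⟨
    a k.* a⁻¹ k.* b   ≈⟨ solve 3 (λ a c b → a ⊗ c ⊗ b ⊜ c ⊗ (a ⊗ b)) k.refl a a⁻¹ b ⟩
    a⁻¹ k.* (a k.* b) ≈⟨ k.*-congˡ ab≈0 ⟩
    a⁻¹ k.* k.0#      ≈⟨ k.zeroʳ a⁻¹ ⟩
    k.0#              ∎)
    where
    open SetoidReasoning k.setoid
    open IntegerCoefficients k.commutativeRing
    a⁻¹ = proj₁ (k.inverse a a≉0)
    aa⁻¹≈1 = proj₂ (k.inverse a a≉0)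

  private
    module Constant = Evaluation {k} k.commutativeRing (Identity.isRingHomomorphism k.rawRing k.refl)

    toConstant : Poly k 0 → k.Carrier
    toConstant = Constant.ev (λ ())

    toConstant-correct : ∀ p → p ≋ con (toConstant p)
    toConstant-correct (con a)  = ≋-refl
    toConstant-correct (p :+ q) =
      ≋-trans (+-cong (toConstant-correct p) (toConstant-correct q)) (≋-sym (con-+ _ _))
    toConstant-correct (p :* q) =
      ≋-trans (*-cong (toConstant-correct p) (toConstant-correct q)) (≋-sym (con-* _ _))
    toConstant-correct (:- p)   =
      ≋-trans (neg-cong (toConstant-correct p)) (≋-sym (con-neg _))

    toConstant≈0 : ∀ p → toConstant p k.≈ k.0# → p ≋ 𝟘
    toConstant≈0 p e = ≋-trans (toConstant-correct p) (con-cong e)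

  poly-≟0 : ∀ {n} (p : Poly k n) → Dec (p ≋ 𝟘)
  poly-≟0 {ℕ.zero} p with toConstant p k.≟ k.0#
  ... | yes e = yes (toConstant≈0 p e)
  ... | no ne = no (λ e → ne (Constant.ev-cong e))
  poly-≟0 {suc n} p = go p (bounded p)
    where
    go : ∀ q → Bounded q → Dec (q ≋ 𝟘)
    go q (stop e) = yes e
    go q (step b) with poly-≟0 (constantPart q) | go (δ q) b
    ... | yes e | yes f = yes (≋0-from-parts e f)
    ... | no ne | _     = no (λ e → ne (constantPart-cong e))
    ... | _     | no nf = no (λ e → nf (δ-cong e))

  poly-domain : ∀ {n} → IsDomain (polyRing k n)
  poly-domain {ℕ.zero} p q pq≋0 =
    [ (λ e → inj₁ (toConstant≈0 p e)) , (λ e → inj₂ (toConstant≈0 q e)) ]′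
    (field-domain (toConstant p) (toConstant q) (Constant.ev-cong pq≋0))
  poly-domain {suc n} p q = go p (bounded p)
    where
    module P = CommutativeRing (polyRing k (suc n))

    -- Induction on the degree of q, dividing by t.
    cancel : ∀ p q → ¬ (constantPart p ≋ 𝟘) → Bounded q → p :* q ≋ 𝟘 → q ≋ 𝟘
    cancel p q p₀≉0 (stop e) _ = e
    cancel p q p₀≉0 (step b) pq≋0
      with poly-domain (constantPart p) (constantPart q) (constantPart-cong pq≋0)
    ... | inj₁ p₀≋0 = contradiction p₀≋0 p₀≉0
    ... | inj₂ q₀≋0 = ≋0-from-parts q₀≋0 (cancel p (δ q) p₀≉0 b (t-cancel (begin
      var zero :* (p :* δ q) ≈⟨ solve 3 (λ t p q → t ⊗ (p ⊗ q) ⊜ p ⊗ (t ⊗ q)) ≋-refl (var zero) p (δ q) ⟩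
      p :* (var zero :* δ q) ≈⟨ *-cong ≋-refl (≋t*δ q₀≋0) ⟨
      p :* q                 ≈⟨ pq≋0 ⟩
      𝟘                      ≈⟨ P.zeroʳ _ ⟨
      var zero :* 𝟘          ∎)))
      where
      open SetoidReasoning P.setoid
      open IntegerCoefficients (polyRing k (suc n))

    go : ∀ p → Bounded p → p :* q ≋ 𝟘 → p ≋ 𝟘 ⊎ q ≋ 𝟘
    go p (stop e) _ = inj₁ e
    go p (step b) pq≋0 with poly-≟0 (constantPart p)
    ... | no p₀≉0  = inj₂ (cancel p q p₀≉0 (bounded q) pq≋0)
    ... | yes p₀≋0 = [ (λ e → inj₁ (≋0-from-parts p₀≋0 e)) , inj₂ ]′ (go (δ p) b (t-cancel (begin
      var zero :* (δ p :* q) ≈⟨ *-assoc _ _ _ ⟨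
      var zero :* δ p :* q   ≈⟨ *-cong (≋t*δ p₀≋0) ≋-refl ⟨
      p :* q                 ≈⟨ pq≋0 ⟩
      𝟘                      ≈⟨ P.zeroʳ _ ⟨
      var zero :* 𝟘          ∎)))
      where
      open SetoidReasoning P.setoid

  𝟙≉𝟘 : ∀ {n} → ¬ (𝟙 {k} {n} ≋ 𝟘)
  𝟙≉𝟘 {ℕ.zero} e = k.1≉0 (Constant.ev-cong {ρ = λ ()} e)
  𝟙≉𝟘 {suc n}  e = 𝟙≉𝟘 (constantPart-cong e)

  var0≉𝟘 : ∀ {n} → ¬ (var {k} {suc n} zero ≋ 𝟘)
  var0≉𝟘 e = 𝟙≉𝟘 (δ-cong e)

  var-suc≉𝟘 : ∀ {n i} → ¬ (var {k} {n} i ≋ 𝟘) → ¬ (var {k} {suc n} (suc i) ≋ 𝟘)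
  var-suc≉𝟘 ne e = ne (constantPart-cong e)

  poly-square≋0 : ∀ {n} (p : Poly k n) → p :* p ≋ 𝟘 → p ≋ 𝟘
  poly-square≋0 p e = [ (λ z → z) , (λ z → z) ]′ (poly-domain p p e)

-- Squares in polynomial rings

module _ {k : Field} {n : ℕ} where
  private
    module P = CommutativeRing (polyRing k (suc n))
    module P₀ = CommutativeRing (polyRing k n)
    open IntegerCoefficients (polyRing k (suc n))
    open SetoidReasoning P.setoid

    t : Poly k (suc n)
    t = var zero

  -- If a² = f b², then a(0)² = f(0) b(0)², so that t divides b and a, and the
  -- quotients satisfy the same equation.
  nonSquare-constantPart : (f : Poly k (suc n)) →
    NonSquare (polyRing k n) (constantPart f) → NonSquare (polyRing k (suc n)) f
  nonSquare-constantPart f f₀-nonSquare a b = go a b (bounded b)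
    where
    go : ∀ a b → Bounded b → a :* a ≋ f :* (b :* b) → b ≋ 𝟘
    go a b (stop e) _ = e
    go a b (step bd) a²≋fb² = ≋0-from-parts b₀≋0 (go (δ a) (δ b) bd (t-cancel (t-cancel (begin
      t :* (t :* (δ a :* δ a))          ≈⟨ solve 2 (λ t a → t ⊗ (t ⊗ (a ⊗ a)) ⊜ (t ⊗ a) ⊗ (t ⊗ a)) ≋-refl t (δ a) ⟩
      (t :* δ a) :* (t :* δ a)          ≈⟨ *-cong (≋t*δ a₀≋0) (≋t*δ a₀≋0) ⟨
      a :* a                            ≈⟨ a²≋fb² ⟩
      f :* (b :* b)                     ≈⟨ *-cong ≋-refl (*-cong (≋t*δ b₀≋0) (≋t*δ b₀≋0)) ⟩
      f :* ((t :* δ b) :* (t :* δ b))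
        ≈⟨ solve 3 (λ t b f → f ⊗ ((t ⊗ b) ⊗ (t ⊗ b)) ⊜ t ⊗ (t ⊗ (f ⊗ (b ⊗ b)))) ≋-refl t (δ b) f ⟩
      t :* (t :* (f :* (δ b :* δ b)))   ∎))))
      where
      b₀≋0 : constantPart b ≋ 𝟘
      b₀≋0 = f₀-nonSquare (constantPart a) (constantPart b) (constantPart-cong a²≋fb²)
      a₀≋0 : constantPart a ≋ 𝟘
      a₀≋0 = poly-square≋0 (constantPart a) (≋-trans (constantPart-cong a²≋fb²)
        (≋-trans (*-cong ≋-refl (*-cong b₀≋0 ≋-refl))
          (≋-trans (*-cong ≋-refl (P₀.zeroˡ _)) (P₀.zeroʳ _))))

  -- t divides t g exactly once: if a² = t g b², then t divides a, hence b.
  nonSquare-t* : (g : Poly k (suc n)) → ¬ (constantPart g ≋ 𝟘) →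
    NonSquare (polyRing k (suc n)) (t :* g)
  nonSquare-t* g g₀≉0 a b = go a b (bounded b)
    where
    go : ∀ a b → Bounded b → a :* a ≋ t :* g :* (b :* b) → b ≋ 𝟘
    go a b (stop e) _ = e
    go a b (step bd) a²≋tgb² = ≋0-from-parts b₀≋0 (go (δ a) (δ b) bd (t-cancel (begin
      t :* (δ a :* δ a)                  ≈⟨ ta′²≋gb² ⟩
      g :* (b :* b)                      ≈⟨ *-cong ≋-refl (*-cong (≋t*δ b₀≋0) (≋t*δ b₀≋0)) ⟩
      g :* ((t :* δ b) :* (t :* δ b))
        ≈⟨ solve 3 (λ t b g → g ⊗ ((t ⊗ b) ⊗ (t ⊗ b)) ⊜ t ⊗ (t ⊗ g ⊗ (b ⊗ b))) ≋-refl t (δ b) g ⟩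
      t :* (t :* g :* (δ b :* δ b))      ∎)))
      where
      a₀≋0 : constantPart a ≋ 𝟘
      a₀≋0 = poly-square≋0 (constantPart a) (≋-trans (constantPart-cong a²≋tgb²)
        (≋-trans (*-cong (P₀.zeroˡ _) ≋-refl) (P₀.zeroˡ _)))
      ta′²≋gb² : t :* (δ a :* δ a) ≋ g :* (b :* b)
      ta′²≋gb² = t-cancel (begin
        t :* (t :* (δ a :* δ a))   ≈⟨ solve 2 (λ t a → t ⊗ (t ⊗ (a ⊗ a)) ⊜ (t ⊗ a) ⊗ (t ⊗ a)) ≋-refl t (δ a) ⟩
        (t :* δ a) :* (t :* δ a)   ≈⟨ *-cong (≋t*δ a₀≋0) (≋t*δ a₀≋0) ⟨
        a :* a                     ≈⟨ a²≋tgb² ⟩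
        t :* g :* (b :* b)         ≈⟨ *-assoc _ _ _ ⟩
        t :* (g :* (b :* b))       ∎)
      g₀b₀²≋0 : constantPart g :* (constantPart b :* constantPart b) ≋ 𝟘
      g₀b₀²≋0 = ≋-trans (≋-sym (constantPart-cong ta′²≋gb²)) (constantPart-t* (δ a :* δ a))
      b₀≋0 : constantPart b ≋ 𝟘
      b₀≋0 = [ (λ e → contradiction e g₀≉0) , poly-square≋0 (constantPart b) ]′
        (poly-domain (constantPart g) _ g₀b₀²≋0)

nonSquare-resp : ∀ {k n} {f g : Poly k n} → f ≋ g →
                 NonSquare (polyRing k n) f → NonSquare (polyRing k n) g
nonSquare-resp f≋g f-nonSquare a b e =
  f-nonSquare a b (≋-trans e (*-cong (≋-sym f≋g) ≋-refl))

nonSquare-*² : ∀ {k n} {f h : Poly k n} → ¬ (h ≋ 𝟘) →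
               NonSquare (polyRing k n) f → NonSquare (polyRing k n) (f :* (h :* h))
nonSquare-*² {k} {n} {f} {h} h≉0 f-nonSquare a b e =
  [ (λ h≋0 → contradiction h≋0 h≉0) , (λ b≋0 → b≋0) ]′
    (poly-domain h b (f-nonSquare a (h :* b) (≋-trans e
      (solve 3 (λ f h b → f ⊗ (h ⊗ h) ⊗ (b ⊗ b) ⊜ f ⊗ ((h ⊗ b) ⊗ (h ⊗ b))) ≋-refl f h b))))
  where open IntegerCoefficients (polyRing k n)

-- The homogeneous coordinate ring of X

private
  quadric≈0 : ∀ {k n} (S : CommutativeRing 0ℓ 0ℓ) → let module S = CommutativeRing S in
    {h : Poly k n → S.Carrier} → IsRingHomomorphism (CommutativeRing.rawRing (polyRing k n)) S.rawRing h →
    ∀ a b c d {r} → r S.* r S.≈ h (a :* b :+ c :* d) →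
    (h a S.* h b S.+ h c S.* h d) S.+ S.- (r S.* r) S.≈ S.0#
  quadric≈0 S h-hom a b c d r² = S.trans
    (S.+-cong (S.trans (S.+-cong (S.sym (*-homo a b)) (S.sym (*-homo c d))) (S.sym (+-homo _ _)))
      (S.-‿cong r²))
    (S.-‿inverseʳ _)
    where
    module S = CommutativeRing S
    open IsRingHomomorphism h-hom

module _ {k : Field} where

  -- The two quadrics over an arbitrary field.
  module Quadrics where
    x y u v z Qₐ Qᵦ : Poly k 5
    x = var 0F
    y = var 1F
    u = var 2F
    v = var 3F
    z = var 4F
    Qₐ = x :* x :+ y :* z :- u :* u
    Qᵦ = x :* z :+ y :* y :- v :* v

  quadrics : Pred (Poly k 5) 0ℓ
  quadrics = ｛ Quadrics.Qₐ ｝ ∪ ｛ Quadrics.Qᵦ ｝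

HasHalf : Field → Set
HasHalf k = ∃[ h ] (1# + 1#) * h ≈ 1#
  where open Field k

-- Polynomials modulo the quadrics have a unique normal form a + b u + c v + d u v
-- with a, b, c, d in k[x,y,z].
module CoordinateRing (k : Field) (half : HasHalf k) where
  private
    module k = Field k
    K = polyRing k 3
    module K = CommutativeRing K
    S = Quotient (quadrics {k})
    module S = CommutativeRing S

    x y z A B : Poly k 3
    x = var 0F
    y = var 1F
    z = var 2F
    A = x :* x :+ y :* z
    B = x :* z :+ y :* y

  private
    -- At x = 0, A and A B become y z and y² (y z).
    yz-nonSquare : NonSquare (polyRing k 2) (var 0F :* var 1F)
    yz-nonSquare = nonSquare-t* (var 1F) var0≉𝟘

    A-nonSquare : NonSquare K A
    A-nonSquare = nonSquare-constantPart A (nonSquare-resp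
      (solve 2 (λ y z → y ⊗ z ⊜ κ 0ℤ ⊗ κ 0ℤ ⊕ y ⊗ z) ≋-refl (var 0F) (var 1F)) yz-nonSquare)
      where open IntegerCoefficients (polyRing k 2)

    AB-nonSquare : NonSquare K (A :* B)
    AB-nonSquare = nonSquare-constantPart (A :* B) (nonSquare-resp
      (solve 2 (λ y z → y ⊗ z ⊗ (y ⊗ y) ⊜ (κ 0ℤ ⊗ κ 0ℤ ⊕ y ⊗ z) ⊗ (κ 0ℤ ⊗ z ⊕ y ⊗ y)) ≋-refl
        (var 0F) (var 1F))
      (nonSquare-*² var0≉𝟘 yz-nonSquare))
      where open IntegerCoefficients (polyRing k 2)

    swap : Poly k 3 → Poly k 3
    swap = subst (y ∷ x ∷ z ∷ [])

    swap-swap : ∀ p → swap (swap p) ≋ p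
    swap-swap p = ≋-trans (Subst.ev-subst _ p) (≋-trans
      (Subst.ev-≗ (λ { 0F → ≋-refl ; 1F → ≋-refl ; 2F → ≋-refl }) p) (subst-var p))

    -- The exchange of x and y turns B into A.
    B-nonSquare : NonSquare K B
    B-nonSquare a b e = ≋-trans (≋-sym (swap-swap b)) (Subst.ev-cong (A-nonSquare (swap a) (swap b)
      (≋-trans (Subst.ev-cong e) (*-cong (+-comm _ _) ≋-refl))))

    2-regular : ∀ p → (𝟙 :+ 𝟙) :* p ≋ 𝟘 → p ≋ 𝟘
    2-regular p e = begin
      p                         ≈⟨ *-identityˡ p ⟨
      𝟙 :* p                    ≈⟨ *-cong 2h≋1 ≋-refl ⟨
      (𝟙 :+ 𝟙) :* h :* p        ≈⟨ solve 3 (λ c h p → c ⊗ h ⊗ p ⊜ h ⊗ (c ⊗ p)) ≋-refl (𝟙 :+ 𝟙) h p ⟩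
      h :* ((𝟙 :+ 𝟙) :* p)      ≈⟨ *-cong ≋-refl e ⟩
      h :* 𝟘                    ≈⟨ K.zeroʳ h ⟩
      𝟘                         ∎
      where
      open SetoidReasoning K.setoid
      open IntegerCoefficients K
      h : Poly k 3
      h = con (proj₁ half)
      2h≋1 : (𝟙 :+ 𝟙) :* h ≋ 𝟙
      2h≋1 = ≋-trans (*-cong (≋-sym (con-+ _ _)) ≋-refl)
        (≋-trans (≋-sym (con-* _ _)) (con-cong (proj₂ half)))

    A≉0 : ¬ (A ≋ 𝟘)
    A≉0 e = 𝟙≉𝟘 (A-nonSquare 𝟘 𝟙 (≋-trans (K.zeroˡ 𝟘)
      (≋-sym (≋-trans (*-cong e ≋-refl) (K.zeroˡ _)))))

    L : CommutativeRing 0ℓ 0ℓ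
    L = K [√ A ]

    Bᴸ : CommutativeRing.Carrier L
    Bᴸ = √-embed K A B

    -- The inclusion of k[x,y,z], as a homomorphism to the residue class ring.
    ε : Poly k 3 → Poly k 5
    ε = subst (Quadrics.x ∷ Quadrics.y ∷ Quadrics.z ∷ [])

    ε-hom : IsRingHomomorphism K.rawRing S.rawRing ε
    ε-hom = ringHomomorphism {S = S} (λ e → ≋⇒mod (Subst.ev-cong e))
      (λ _ _ → S.refl) (λ _ _ → S.refl) (λ _ → S.refl) S.refl S.refl

    root-mod : ∀ {p q} → p :- q :* q ∈ quadrics → q :* q ≡ p [mod ⟨ quadrics ⟩ ]
    root-mod {p} {q} e = S.sym (gen e)

    module Liftᴬ = √-Lift K A S ε-hom {r = Quadrics.u} (root-mod (inj₁ refl))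

    v²≡B : Quadrics.v :* Quadrics.v ≡ Liftᴬ.√-lift Bᴸ [mod ⟨ quadrics ⟩ ]
    v²≡B = S.trans (root-mod (inj₂ refl)) (≋⇒mod
        (solve 2 (λ b u → b ⊜ b ⊕ u ⊗ κ 0ℤ) ≋-refl (ε B) Quadrics.u))
      where open IntegerCoefficients (polyRing k 5)

    module Liftᴮ = √-Lift L Bᴸ S Liftᴬ.√-lift-hom {r = Quadrics.v} v²≡B

  -- Only the properties of this ring that are stated here are used.
  opaque
    -- k[x,y,z][√A][√B] for A = x² + y z and B = x z + y².
    R : CommutativeRing 0ℓ 0ℓ
    R = L [√ Bᴸ ]

    R-domain : IsDomain R
    R-domain = √-domain {R = L} L-domain {A = Bᴸ}
      (√-nonSquare {R = K} poly-domain {A = A} A-nonSquare {B = B}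
        2-regular A≉0 B-nonSquare AB-nonSquare)
      where
      L-domain : IsDomain L
      L-domain = √-domain {R = K} poly-domain {A = A} A-nonSquare

  private
    module R = CommutativeRing R

  opaque
    unfolding R

    private
      embed : Poly k 3 → R.Carrier
      embed p = √-embed L Bᴸ (√-embed K A p)

      embed-hom : IsRingHomomorphism K.rawRing R.rawRing embed
      embed-hom = Composition.isRingHomomorphism R.trans (√-embed-hom K A) (√-embed-hom L Bᴸ)

      embed-injective : ∀ {p} → embed p R.≈ R.0# → p ≋ 𝟘
      embed-injective e = proj₁ (proj₁ e)

      √A √B : R.Carrier
      √A = √-embed L Bᴸ (root K A)
      √B = root L Bᴸ

      √A² : √A R.* √A R.≈ embed A
      √A² = R.trans (R.sym (*-homo (root K A) (root K A))) (⟦⟧-cong (root² K A))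
        where open IsRingHomomorphism (√-embed-hom L Bᴸ)

      √B² : √B R.* √B R.≈ embed B
      √B² = root² L Bᴸ

      -- A polynomial with a given normal form; multiplicative modulo the quadrics.
      reify : R.Carrier → Poly k 5
      reify = Liftᴮ.√-lift

      reify-hom : IsRingHomomorphism R.rawRing S.rawRing reify
      reify-hom = Liftᴮ.√-lift-hom

      reify-embed : ∀ p → reify (embed p) ≋ ε p
      reify-embed p = solve 3 (λ p u v → (p ⊕ u ⊗ κ 0ℤ) ⊕ v ⊗ (κ 0ℤ ⊕ u ⊗ κ 0ℤ) ⊜ p) ≋-refl
          (ε p) Quadrics.u Quadrics.v
        where open IntegerCoefficients (polyRing k 5)

      reify-√A : reify √A ≋ Quadrics.u
      reify-√A = solve 2 (λ u v → (κ 0ℤ ⊕ u ⊗ κ 1ℤ) ⊕ v ⊗ (κ 0ℤ ⊕ u ⊗ κ 0ℤ) ⊜ u) ≋-refl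
          Quadrics.u Quadrics.v
        where open IntegerCoefficients (polyRing k 5)

      reify-√B : reify √B ≋ Quadrics.v
      reify-√B = solve 2 (λ u v → (κ 0ℤ ⊕ u ⊗ κ 0ℤ) ⊕ v ⊗ (κ 1ℤ ⊕ u ⊗ κ 0ℤ) ⊜ v) ≋-refl
          Quadrics.u Quadrics.v
        where open IntegerCoefficients (polyRing k 5)

  private
    ι-hom : IsRingHomomorphism k.rawRing R.rawRing (embed ∘ con)
    ι-hom = Composition.isRingHomomorphism R.trans con-hom embed-hom

    module Normal = Evaluation {k} R ι-hom

  -- The homomorphism that maps u and v to √A and √B.
  normalForm : Poly k 5 → R.Carrier
  normalForm = Normal.ev (embed x ∷ embed y ∷ √A ∷ √B ∷ embed z ∷ [])

  private
    normalForm-quadrics : ∀ {p} → p ∈ quadrics → normalForm p R.≈ R.0#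
    normalForm-quadrics (inj₁ refl) = quadric≈0 R embed-hom x x y z √A²
    normalForm-quadrics (inj₂ refl) = quadric≈0 R embed-hom x z y y √B²

    reify-normalForm : ∀ p → p ≡ reify (normalForm p) [mod ⟨ quadrics ⟩ ]
    reify-normalForm p = S.trans
      (InS.ev-unique {f = λ p → p} (λ _ → S.refl) (λ _ → S.refl)
        (λ _ _ → S.refl) (λ _ _ → S.refl) (λ _ → S.refl) p)
      (S.sym (InS.ev-unique {f = λ p → reify (normalForm p)}
        (λ a → ≋⇒mod (reify-embed (con a)))
        (λ { 0F → ≋⇒mod (reify-embed x) ; 1F → ≋⇒mod (reify-embed y) ; 4F → ≋⇒mod (reify-embed z)
           ; 2F → ≋⇒mod reify-√A ; 3F → ≋⇒mod reify-√B })
        (λ _ _ → +-homo _ _) (λ _ _ → *-homo _ _) (λ _ → -‿homo _) p))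
      where
      open IsRingHomomorphism reify-hom
      module InS = Evaluation {k} S con-hom-mod

  normalForm-ideal : ∀ {p} → p ∈ ⟨ quadrics ⟩ → normalForm p R.≈ R.0#
  normalForm-ideal = Normal.ev-ideal normalForm-quadrics

  -- Hence the quadrics generate the kernel of normalForm.
  normalForm≈0 : ∀ {p} → normalForm p R.≈ R.0# → p ∈ ⟨ quadrics ⟩
  normalForm≈0 {p} e = mod⇒∈ (S.trans (reify-normalForm p) (S.trans (⟦⟧-cong e) 0#-homo))
    where open IsRingHomomorphism reify-hom

  quadrics-prime : ∀ p q → (p :* q) ∈ ⟨ quadrics ⟩ → p ∈ ⟨ quadrics ⟩ ⊎ q ∈ ⟨ quadrics ⟩
  quadrics-prime p q e = [ (λ h → inj₁ (normalForm≈0 h)) , (λ h → inj₂ (normalForm≈0 h)) ]′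
    (R-domain (normalForm p) (normalForm q) (normalForm-ideal e))

  z∉quadrics : var 4F ∉ ⟨ quadrics ⟩
  z∉quadrics e = var-suc≉𝟘 (var-suc≉𝟘 var0≉𝟘) (embed-injective (normalForm-ideal e))

open ClosedSubscheme using (Gen; ideal)

-- Homogeneous polynomials

module _ {k : Field} (S : CommutativeRing 0ℓ 0ℓ) {ι : Field.Carrier k → CommutativeRing.Carrier S}
         (ι-hom : IsRingHomomorphism (Field.rawRing k) (CommutativeRing.rawRing S) ι) where
  private
    module S = CommutativeRing S
    module ι = IsRingHomomorphism ι-hom
    open Evaluation {k} S ι-hom
    open Exp S.semiring using (_^_; ^-homo-*)
    open IntegerCoefficients S using (solve; _⊗_; _⊕_; ⊝_; _⊜_; κ)

  homogeneous-scaling : ∀ {n d} {p : Poly k n} {ρ : Vector S.Carrier n} (s : S.Carrier) →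
    Homogeneous d p → ev (λ i → s S.* ρ i) p S.≈ s ^ d S.* ev ρ p
  homogeneous-scaling s (con a) = S.sym (S.*-identityˡ _)
  homogeneous-scaling {ρ = ρ} s (var i) = S.*-congʳ (S.sym (S.*-identityʳ s))
  homogeneous-scaling s zero =
    S.trans ι.0#-homo (S.sym (S.trans (S.*-congˡ ι.0#-homo) (S.zeroʳ _)))
  homogeneous-scaling s (add h g) = S.trans
    (S.+-cong (homogeneous-scaling s h) (homogeneous-scaling s g)) (S.sym (S.distribˡ _ _ _))
  homogeneous-scaling {ρ = ρ} s (mul {d} {e} {p} {q} h g) = S.trans
    (S.*-cong (homogeneous-scaling s h) (homogeneous-scaling s g)) (S.trans
    (solve 4 (λ a b c d → (a ⊗ b) ⊗ (c ⊗ d) ⊜ (a ⊗ c) ⊗ (b ⊗ d)) S.refl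
      (s ^ d) (ev ρ p) (s ^ e) (ev ρ q))
    (S.*-congʳ (S.sym (^-homo-* s d e))))
  homogeneous-scaling {d = d} {ρ = ρ} s (neg {p = p} h) = S.trans (S.-‿cong (homogeneous-scaling s h))
    (solve 2 (λ a b → ⊝ (a ⊗ b) ⊜ a ⊗ ⊝ b) S.refl (s ^ d) (ev ρ p))
  homogeneous-scaling s (resp e h) = S.trans (S.sym (ev-cong e))
    (S.trans (homogeneous-scaling s h) (S.*-congˡ (ev-cong e)))

-- The projective closure

-- The argument takes place in the total ring of fractions of the coordinate ring
-- of the intersection of the quadrics, where z is invertible.
module Homogenisation where
  module Q = CoordinateRing ℚ-field (+ 1 / 2 , refl)

  S : CommutativeRing 0ℓ 0ℓ
  S = Quotient (quadrics {ℚ-field})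

  module S = CommutativeRing S
  open TotalFractions S

  F : CommutativeRing 0ℓ 0ℓ
  F = fractions

  module F = CommutativeRing F

  z-regular : Regular (var 4F)
  z-regular p zp≡0 = [ (λ h → contradiction h Q.z∉quadrics) , ∈⇒mod ]′
    (Q.quadrics-prime (var 4F) p (mod⇒∈ zp≡0))

  ι-hom : IsRingHomomorphism (Field.rawRing ℚ-field) F.rawRing (fraction ∘ con)
  ι-hom = Composition.isRingHomomorphism (λ {a b c} → F.trans {a} {b} {c})
    con-hom-mod fraction-hom

  module AtRatios = Evaluation {ℚ-field} F ι-hom

  ratio : Fin 5 → Frac
  ratio i = var i / var 4F [ z-regular ]

  affineRatio : Fin 4 → Frac
  affineRatio i = ratio (inject₁ i)

  z³ : Poly ℚ-field 5
  z³ = Projective.z :* Projective.z :* Projective.z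

  affineRatio-equations : ∀ {p} → p ∈ Affine.equations → AtRatios.ev affineRatio p F.≈ F.0#
  affineRatio-equations (inj₁ refl) = resp identity (mul z³ (gen (inj₁ refl)))
  affineRatio-equations (inj₂ refl) = resp identity (mul z³ (gen (inj₂ refl)))

  open Exp F.semiring using (_^_)

  -- p is z^d times its dehomogenisation at the ratios x/z, y/z, u/z, v/z.
  fraction-homogeneous : ∀ {d p} → Homogeneous d p →
    fraction p F.≈ fraction (var 4F) ^ d F.* AtRatios.ev affineRatio (dehom p)
  fraction-homogeneous {d} {p} h = begin
    fraction p
      ≈⟨ AtRatios.ev-unique {f = fraction}
           (λ a → F.refl {fraction (con a)}) (λ i → F.refl {fraction (var i)}) +-homo *-homo -‿homo p ⟩
    AtRatios.ev (λ i → fraction (var i)) p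
      ≈⟨ AtRatios.ev-≗ (λ i → ≋⇒mod
           (solve 2 (λ x z → x ⊗ (κ 1ℤ ⊗ z) ⊜ (z ⊗ x) ⊗ κ 1ℤ) ≋-refl (var i) (var 4F))) p ⟩
    AtRatios.ev (λ i → fraction (var 4F) F.* ratio i) p
      ≈⟨ homogeneous-scaling F ι-hom (fraction (var 4F)) h ⟩
    fraction (var 4F) ^ d F.* AtRatios.ev ratio p
      ≈⟨ times-z^d {AtRatios.ev ratio p} {p₁} (AtRatios.ev-≗ ratio-insertAt p) ⟩
    fraction (var 4F) ^ d F.* p₁
      ≈⟨ times-z^d {AtRatios.ev affineRatio (dehom p)} {p₁}
           (AtRatios.ev-subst (insertAt var (fromℕ 4) 𝟙) p) ⟨
    fraction (var 4F) ^ d F.* AtRatios.ev affineRatio (dehom p) ∎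
    where
    open IsRingHomomorphism fraction-hom
    open SetoidReasoning F.setoid
    open IntegerCoefficients (polyRing ℚ-field 5)

    p₁ = AtRatios.ev (AtRatios.ev affineRatio ∘ insertAt var (fromℕ 4) 𝟙) p

    times-z^d : ∀ {a b} → a F.≈ b → fraction (var 4F) ^ d F.* a F.≈ fraction (var 4F) ^ d F.* b
    times-z^d {a} {b} = F.*-congˡ {fraction (var 4F) ^ d} {a} {b}

    ratio-insertAt : ∀ i → ratio i F.≈ AtRatios.ev affineRatio (insertAt var (fromℕ 4) 𝟙 i)
    ratio-insertAt 0F = F.refl {ratio 0F}
    ratio-insertAt 1F = F.refl {ratio 1F}
    ratio-insertAt 2F = F.refl {ratio 2F}
    ratio-insertAt 3F = F.refl {ratio 3F}
    ratio-insertAt 4F = ≋⇒mod identity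

  homogeneous∈quadrics : ∀ {d p} → Homogeneous d p → dehom p ∈ ⟨ Affine.equations ⟩ → p ∈ ⟨ quadrics ⟩
  homogeneous∈quadrics {d} {p} h e = mod⇒∈ (begin
    p            ≈⟨ S.*-identityʳ p ⟨
    p :* 𝟙       ≈⟨ fraction≈0 ⟩
    𝟘 :* 𝟙       ≈⟨ S.zeroˡ 𝟙 ⟩
    𝟘            ∎)
    where
    open SetoidReasoning S.setoid
    z^d = fraction (var 4F) ^ d
    p₁  = AtRatios.ev affineRatio (dehom p)

    fraction≈0 : fraction p F.≈ F.0#
    fraction≈0 = F.trans {fraction p} {z^d F.* p₁} {F.0#} (fraction-homogeneous h)
      (F.trans {z^d F.* p₁} {z^d F.* F.0#} {F.0#}
        (F.*-congˡ {z^d} {p₁} {F.0#} (AtRatios.ev-ideal affineRatio-equations e)) (F.zeroʳ z^d))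

  Q₁-gen : Q₁ ∈ Gen X
  Q₁-gen = (2 , Q₁-quadratic) , resp identity (gen (inj₁ refl))

  Q₂-gen : Q₂ ∈ Gen X
  Q₂-gen = (2 , Q₂-quadratic) , resp identity (gen (inj₂ refl))

open Homogenisation using (homogeneous∈quadrics; Q₁-gen; Q₂-gen)

X-gen⊆quadrics : ∀ {p} → p ∈ Gen X → p ∈ ⟨ quadrics ⟩
X-gen⊆quadrics ((_ , h) , e) = homogeneous∈quadrics h e

quadrics⊆X-gen : ∀ {p} → p ∈ quadrics → p ∈ Gen X
quadrics⊆X-gen (inj₁ refl) = Q₁-gen
quadrics⊆X-gen (inj₂ refl) = Q₂-gen

X-isIntersection :
  ideal X ≐ ideal (intersection Q₁-quadratic Q₂-quadratic)
X-isIntersection = ⟨⟩-mono X-gen⊆quadrics , ⟨⟩-mono (λ e → gen (quadrics⊆X-gen e))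

-- Geometric integrality

module _ (E : Extension ℚ-field) where
  private
    module E = Extension E
    module ι = IsRingHomomorphism E.isRingHomomorphism

  half-extension : HasHalf E.top
  half-extension = E.ι (+ 1 / 2) , E.trans
    (E.*-congʳ (E.sym (E.trans (ι.+-homo _ _) (E.+-cong ι.1#-homo ι.1#-homo))))
    (E.trans (E.sym (ι.*-homo (+ 2 / 1) (+ 1 / 2))) ι.1#-homo)

  private
    module C = CoordinateRing E.top half-extension

    extended : Pred (Poly E.top 5) 0ℓ
    extended q = ∃[ p ] p ∈ Gen X × q ≡ extendScalars E p

    extended⊆quadrics : ∀ {q} → q ∈ ⟨ extended ⟩ → q ∈ ⟨ quadrics ⟩
    extended⊆quadrics = ⟨⟩-mono λ { (p , p∈X , refl) → ev-⟨⟩ (con∘ι-hom E)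
      (λ { (inj₁ refl) → gen (inj₁ refl) ; (inj₂ refl) → gen (inj₂ refl) }) (X-gen⊆quadrics p∈X) }

    quadrics⊆extended : ∀ {q} → q ∈ ⟨ quadrics ⟩ → q ∈ ⟨ extended ⟩
    quadrics⊆extended = ⟨⟩-mono λ
      { (inj₁ refl) → gen (Q₁ , quadrics⊆X-gen (inj₁ refl) , refl)
      ; (inj₂ refl) → gen (Q₂ , quadrics⊆X-gen (inj₂ refl) , refl) }

  X-integral-over :
    (∀ p q → (p :* q) ∈ ⟨ extended ⟩ → p ∈ ⟨ extended ⟩ ⊎ q ∈ ⟨ extended ⟩) ×
    (∃[ i ] var i ∉ ⟨ extended ⟩)
  X-integral-over =
    (λ p q pq∈I → Sum.map quadrics⊆extended quadrics⊆extended
      (C.quadrics-prime p q (extended⊆quadrics pq∈I))) ,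
    4F , λ z∈I → C.z∉quadrics (extended⊆quadrics z∈I)

X-geometricallyIntegral : IsGeometricallyIntegral X
X-geometricallyIntegral = X-integral-over

-- The identity of a projective scheme

module _ {k n} (Y : ClosedSubscheme k n) (i : Fin (suc n)) (i∉Y : var i ∉ ideal Y) where

  identityMap : RationalMap Y Y
  identityMap = record
    { coords      = var
    ; degree      = 1
    ; homogeneous = var
    ; nonzero     = i , i∉Y
    ; lands       = λ {p} p∈Y → resp (≋-sym (subst-var p)) (gen p∈Y)
    }

  private
    sameOn-refl : SameOn Y var var
    sameOn-refl i j = ≋⇒mod (*-comm (var i) (var j))

  identityMap-regular : IsRegular identityMap
  identityMap-regular E P = identityMap , sameOn-refl , Point.nonzero P

  identityMap-inverse : AreInverse identityMap identityMap
  identityMap-inverse = ((i , i∉Y) , sameOn-refl) , ((i , i∉Y) , sameOn-refl)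

  isomorphic-refl : IsIsomorphic Y Y
  isomorphic-refl =
    identityMap , identityMap , identityMap-regular , identityMap-regular , identityMap-inverse

-- Points of X

module _ {E : Extension ℚ-field} where
  private module E = Extension E

  point : (c : Vector E.Carrier 5) → ∃[ i ] ¬ (c i E.≈ E.0#) →
          eval E c Q₁ E.≈ E.0# → eval E c Q₂ E.≈ E.0# → Point X E
  point c nonzero c∈Q₁ c∈Q₂ = record
    { coords  = c
    ; nonzero = nonzero
    ; onX     = λ p∈X → Eval.ev-ideal E (λ { (inj₁ refl) → c∈Q₁ ; (inj₂ refl) → c∈Q₂ })
        (X-gen⊆quadrics p∈X)
    }

  vanishes-at : (P : Point X E) → ∀ {p} → p ∈ ideal X → at P p E.≈ E.0#
  vanishes-at P = Eval.ev-ideal E (Point.onX P)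

-- ℚ as an extension of itself.
ℚ-extension : Extension ℚ-field
ℚ-extension = record
  { top = ℚ-field ; ι = λ a → a
  ; isRingHomomorphism = Identity.isRingHomomorphism (Field.rawRing ℚ-field) refl }

open Projective

-- Charts

-- The gradients of Q₁ and Q₂.
grad₁ grad₂ : Vector (Poly ℚ-field 5) 5
grad₁ = x :+ x ∷ z ∷ :- (u :+ u) ∷ 𝟘 ∷ y ∷ []
grad₂ = z ∷ y :+ y ∷ 𝟘 ∷ :- (v :+ v) ∷ x ∷ []

∂Q₁ : ∀ i → ∂ i Q₁ ≋ grad₁ i
∂Q₁ = λ { 0F → identity ; 1F → identity ; 2F → identity ; 3F → identity ; 4F → identity }

∂Q₂ : ∀ i → ∂ i Q₂ ≋ grad₂ i
∂Q₂ = λ { 0F → identity ; 1F → identity ; 2F → identity ; 3F → identity ; 4F → identity }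

grad₁-linear : ∀ i → Homogeneous 1 (grad₁ i)
grad₁-linear = λ { 0F → add (var _) (var _) ; 1F → var _ ; 2F → neg (add (var _) (var _)) ; 3F → zero ; 4F → var _ }

grad₂-linear : ∀ i → Homogeneous 1 (grad₂ i)
grad₂-linear = λ { 0F → var _ ; 1F → add (var _) (var _) ; 2F → zero ; 3F → neg (add (var _) (var _)) ; 4F → var _ }

-- The minors of the Jacobian matrix.
minor : Fin 5 → Fin 5 → Poly ℚ-field 5
minor m n = grad₁ m :* grad₂ n :- grad₁ n :* grad₂ m

minor-quadratic : ∀ m n → Homogeneous 2 (minor m n)
minor-quadratic m n =
  add (mul (grad₁-linear m) (grad₂-linear n)) (neg (mul (grad₁-linear n) (grad₂-linear m)))

-- The chart l∣ij is for points where the coordinate l and the Jacobian minor of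
-- the two columns m, n other than l, i, j do not vanish; there i/l and j/l are
-- local coordinates.  These charts suffice to cover X.
data Chart : Set where
  z∣xy z∣vy z∣xu z∣uv x∣yz x∣yv y∣ux : Chart

-- The order of m and n fixes the sign of the minor.
module ChartIndex where
  l i j m n : Chart → Fin 5
  l z∣xy = 4F
  l z∣vy = 4F
  l z∣xu = 4F
  l z∣uv = 4F
  l x∣yz = 0F
  l x∣yv = 0F
  l y∣ux = 1F

  i z∣xy = 0F
  i z∣vy = 3F
  i z∣xu = 0F
  i z∣uv = 2F
  i x∣yz = 1F
  i x∣yv = 1F
  i y∣ux = 2F

  j z∣xy = 1F
  j z∣vy = 1F
  j z∣xu = 2F
  j z∣uv = 3F
  j x∣yz = 4F
  j x∣yv = 3F
  j y∣ux = 0F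

  m z∣xy = 2F
  m z∣vy = 0F
  m z∣xu = 3F
  m z∣uv = 0F
  m x∣yz = 2F
  m x∣yv = 4F
  m y∣ux = 3F

  n z∣xy = 3F
  n z∣vy = 2F
  n z∣xu = 1F
  n z∣uv = 1F
  n x∣yz = 3F
  n x∣yv = 2F
  n y∣ux = 4F

  minorOf : Chart → Poly ℚ-field 5
  minorOf c = minor (m c) (n c)

  cover : ∀ c {Q : Fin 5 → Set} → Q (l c) → Q (i c) → Q (j c) → Q (m c) → Q (n c) → ∀ q → Q q
  cover z∣xy l i j m n = λ { 0F → i ; 1F → j ; 2F → m ; 3F → n ; 4F → l }
  cover z∣vy l i j m n = λ { 0F → m ; 1F → j ; 2F → n ; 3F → i ; 4F → l }
  cover z∣xu l i j m n = λ { 0F → i ; 1F → n ; 2F → j ; 3F → m ; 4F → l }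
  cover z∣uv l i j m n = λ { 0F → m ; 1F → n ; 2F → i ; 3F → j ; 4F → l }
  cover x∣yz l i j m n = λ { 0F → l ; 1F → i ; 2F → m ; 3F → n ; 4F → j }
  cover x∣yv l i j m n = λ { 0F → l ; 1F → i ; 2F → n ; 3F → j ; 4F → m }
  cover y∣ux l i j m n = λ { 0F → j ; 1F → l ; 2F → i ; 3F → m ; 4F → n }

module AtPoint {E : Extension ℚ-field} (P : Point X E) where
  private
    module E = Extension E
    module ι = IsRingHomomorphism E.isRingHomomorphism
    module Ev = Eval E
    open SetoidReasoning E.setoid

  -- The polynomials that vanish at (a representative of) P form a prime ideal;
  -- the laws below suffice for computations with the coordinates of P.
  record Vanishes (p : Poly ℚ-field 5) : Set where
    constructor vanishes
    field value≈0 : at P p E.≈ E.0#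

  open Vanishes public

  vanishes? : ∀ p → Dec (Vanishes p)
  vanishes? p = map′ vanishes value≈0 (at P p E.≟ E.0#)

  infixr 5 _⊞_
  _⊞_ : ∀ {p q} → Vanishes p → Vanishes q → Vanishes (p :+ q)
  vanishes h ⊞ vanishes g = vanishes (E.trans (E.+-cong h g) (E.+-identityˡ E.0#))

  infixr 6 _⊡_
  _⊡_ : ∀ p {q} → Vanishes q → Vanishes (p :* q)
  p ⊡ vanishes h = vanishes (E.trans (E.*-congˡ h) (E.zeroʳ _))

  vanishes-resp : ∀ {p q} → p ≋ q → Vanishes p → Vanishes q
  vanishes-resp e (vanishes h) = vanishes (E.trans (E.sym (Ev.ev-cong e)) h)

  vanishes-* : ∀ p q → Vanishes (p :* q) → Vanishes p ⊎ Vanishes q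
  vanishes-* p q (vanishes h) = Sum.map vanishes vanishes (field-domain {E.top} (at P p) (at P q) h)

  vanishes-² : ∀ p → Vanishes (p :* p) → Vanishes p
  vanishes-² p h = [ (λ g → g) , (λ g → g) ]′ (vanishes-* p p h)

  cancel : ∀ {p q} → ¬ Vanishes p → Vanishes (p :* q) → Vanishes q
  cancel p≉0 h = [ (λ g → contradiction g p≉0) , (λ g → g) ]′ (vanishes-* _ _ h)

  -- Here b is the inverse of a.
  constant-nonzero : ∀ a b → con {ℚ-field} {5} (a ℚ.* b) ≋ 𝟙 → ¬ Vanishes (con a)
  constant-nonzero a b ab≋1 (vanishes a≈0) = E.1≉0 (begin
    E.1#                ≈⟨ ι.1#-homo ⟨
    at P 𝟙              ≈⟨ Ev.ev-cong {ρ = Point.coords P} ab≋1 ⟨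
    E.ι (a ℚ.* b)       ≈⟨ ι.*-homo a b ⟩
    E.ι a E.* E.ι b     ≈⟨ E.*-congʳ a≈0 ⟩
    E.0# E.* E.ι b      ≈⟨ E.zeroˡ _ ⟩
    E.0#                ∎)

  onQ₁ : Vanishes Q₁
  onQ₁ = vanishes (Point.onX P (quadrics⊆X-gen (inj₁ refl)))

  onQ₂ : Vanishes Q₂
  onQ₂ = vanishes (Point.onX P (quadrics⊆X-gen (inj₂ refl)))

  private
    𝟚 : Poly ℚ-field 5
    𝟚 = con (+ 2 / 1)

    product-nonzero : ∀ {p q} → ¬ Vanishes p → ¬ Vanishes q → ¬ Vanishes (𝟚 :* p :* q)
    product-nonzero {p} {q} p≉0 q≉0 h = q≉0 (cancel p≉0 (cancel
      (constant-nonzero (+ 2 / 1) (+ 1 / 2) ≋-refl) (vanishes-resp (*-assoc 𝟚 p q) h)))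

  -- One of the charts applies at P.  For z = 0, where the equations become x² = u²
  -- and y² = v², one may take l = x unless u = 0, and then x = 0 but y, v are not.
  chart : Σ[ c ∈ Chart ] ¬ Vanishes (var (ChartIndex.l c)) × ¬ Vanishes (ChartIndex.minorOf c)
  chart with vanishes? z | vanishes? u | vanishes? v
  ... | no z≉0 | no u≉0 | no v≉0 = z∣xy , z≉0 , λ h →
          product-nonzero u≉0 v≉0 (cancel (constant-nonzero (+ 2 / 1) (+ 1 / 2) ≋-refl)
            (vanishes-resp {q = 𝟚 :* (𝟚 :* u :* v)} identity h))
  ... | no z≉0 | no u≉0 | yes v≈0 = z∣vy , z≉0 , λ h →
          product-nonzero u≉0 z≉0 (vanishes-resp identity h)
  ... | no z≉0 | yes u≈0 | no v≉0 = z∣xu , z≉0 , λ h →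
          product-nonzero v≉0 z≉0 (vanishes-resp identity h)
  ... | no z≉0 | yes u≈0 | yes v≈0 = z∣uv , z≉0 , λ h →
          z≉0 (vanishes-² z (vanishes-² (z :* z) (cancel
            (constant-nonzero (+ 3 / 1) (+ 1 / 3) ≋-refl) (3z⁴ h))))
    where
    -- Modulo u = v = Q₁ = Q₂ = 0, the equality 4 x y = z² yields 3 z⁴ = 0.
    3z⁴ : Vanishes (minor 0F 1F) → Vanishes (con (+ 3 / 1) :* ((z :* z) :* (z :* z)))
    3z⁴ h = vanishes-resp identity
      ((𝟚 :* 𝟚 :* x :* y :- con (+ 3 / 1) :* z :* z) ⊡ h
       ⊞ (con (ℚ.- (+ 16 / 1)) :* y :* y) ⊡ onQ₁
       ⊞ (con (+ 16 / 1) :* y :* z) ⊡ onQ₂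
       ⊞ (con (ℚ.- (+ 16 / 1)) :* y :* y :* u) ⊡ u≈0
       ⊞ (con (+ 16 / 1) :* y :* z :* v) ⊡ v≈0)
  ... | yes z≈0 | no u≉0 | v? = at-infinity v?
    where
    x≉0 : ¬ Vanishes x
    x≉0 x≈0 = u≉0 (vanishes-² u (vanishes-resp {p = x :* x :+ (y :* z :+ (:- 𝟙) :* Q₁)} identity
      (x ⊡ x≈0 ⊞ y ⊡ z≈0 ⊞ (:- 𝟙) ⊡ onQ₁)))
    at-infinity : Dec (Vanishes v) → _
    at-infinity (no v≉0)  = x∣yz , x≉0 , λ h →
      product-nonzero u≉0 v≉0 (cancel (constant-nonzero (+ 2 / 1) (+ 1 / 2) ≋-refl)
        (vanishes-resp {q = 𝟚 :* (𝟚 :* u :* v)} identity h))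
    at-infinity (yes v≈0) = x∣yv , x≉0 , λ h → product-nonzero u≉0 x≉0 (vanishes-resp identity h)
  ... | yes z≈0 | yes u≈0 | _ = y∣ux , y≉0 , λ h → product-nonzero v≉0 y≉0 (vanishes-resp identity h)
    where
    x≈0 : Vanishes x
    x≈0 = vanishes-² x (vanishes-resp {p = Q₁ :+ (u :* u :+ (:- y) :* z)} identity
      (onQ₁ ⊞ u ⊡ u≈0 ⊞ (:- y) ⊡ z≈0))
    y≈0⇒v≈0 : Vanishes y → Vanishes v
    y≈0⇒v≈0 y≈0 = vanishes-² v (vanishes-resp {p = y :* y :+ (x :* z :+ (:- 𝟙) :* Q₂)} identity
      (y ⊡ y≈0 ⊞ x ⊡ z≈0 ⊞ (:- 𝟙) ⊡ onQ₂))
    v≈0⇒y≈0 : Vanishes v → Vanishes y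
    v≈0⇒y≈0 v≈0 = vanishes-² y (vanishes-resp {p = Q₂ :+ (v :* v :+ (:- x) :* z)} identity
      (onQ₂ ⊞ v ⊡ v≈0 ⊞ (:- x) ⊡ z≈0))
    y≉0 : ¬ Vanishes y
    y≉0 y≈0 with Point.nonzero P
    ... | 0F , x≉0 = x≉0 (value≈0 x≈0)
    ... | 1F , y≉0 = y≉0 (value≈0 y≈0)
    ... | 2F , u≉0 = u≉0 (value≈0 u≈0)
    ... | 3F , v≉0 = v≉0 (value≈0 (y≈0⇒v≈0 y≈0))
    ... | 4F , z≉0 = z≉0 (value≈0 z≈0)
    v≉0 : ¬ Vanishes v
    v≉0 v≈0 = y≉0 (v≈0⇒y≈0 v≈0)

-- Tangent vectors

module TangentSpace {E : Extension ℚ-field} (P : Point X E) where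
  open AtPoint P
  private
    module E = Extension E
    module Ev = Eval E
    open Point P using (coords)
    open FiniteSum E.commutativeRing
    open IntegerCoefficients E.commutativeRing
    open SetoidReasoning E.setoid

  minor≉0⇒independent : ∀ m n → ¬ Vanishes (minor m n) → ∀ {a b} →
    (∀ q → a E.* at P (grad₁ q) E.+ b E.* at P (grad₂ q) E.≈ E.0#) → a E.≈ E.0# × b E.≈ E.0#
  minor≉0⇒independent m n M≉0 e = cramer {R = E.commutativeRing} (field-domain {E.top})
    (λ h → M≉0 (vanishes (E.trans (E.+-congˡ (E.-‿cong (E.*-comm _ _))) h))) (e m) (e n)

  gradients-at : ∀ {w} → IsTangent P w →
    sum (λ q → at P (grad₁ q) E.* w q) E.≈ E.0# × sum (λ q → at P (grad₂ q) E.* w q) E.≈ E.0#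
  gradients-at {w} t = along ∂Q₁ (quadrics⊆X-gen (inj₁ refl)) , along ∂Q₂ (quadrics⊆X-gen (inj₂ refl))
    where
    along : ∀ {Q} {grad : Vector (Poly ℚ-field 5) 5} → (∀ q → ∂ q Q ≋ grad q) → Q ∈ Gen X →
            sum (λ q → at P (grad q) E.* w q) E.≈ E.0#
    along {Q} {grad} ∂Q Q∈X = E.trans
      (sum-cong {f = λ q → at P (grad q) E.* w q} {g = λ q → at P (∂ q Q) E.* w q}
        (λ q → E.*-congʳ (E.sym (Ev.ev-cong {ρ = coords} (∂Q q))))) (t Q∈X)

  at-sum : ∀ {n} (f : Vector (Poly ℚ-field 5) n) → at P (Σₚ f) E.≈ sum (λ q → at P (f q))
  at-sum {ℕ.zero} f = IsRingHomomorphism.0#-homo E.isRingHomomorphism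
  at-sum {suc n}  f = E.+-congˡ (at-sum (λ q → f (suc q)))

  -- Euler's formula for quadratic forms.
  euler : sum (λ q → at P (grad₁ q) E.* coords q) E.≈ E.0# ×
          sum (λ q → at P (grad₂ q) E.* coords q) E.≈ E.0#
  euler =
    E.trans (E.sym (at-sum {5} (λ q → grad₁ q :* var q))) 
      (value≈0 (vanishes-resp {q = Σₚ {n = 5} (λ q → grad₁ q :* var q)} identity (con (+ 2 / 1) ⊡ onQ₁))) ,
    E.trans (E.sym (at-sum {5} (λ q → grad₂ q :* var q))) 
      (value≈0 (vanishes-resp {q = Σₚ {n = 5} (λ q → grad₂ q :* var q)} identity (con (+ 2 / 1) ⊡ onQ₂)))

  open ChartIndex

  sum-chart : ∀ c (f : Vector E.Carrier 5) →
    sum f E.≈ (f (l c) E.+ (f (i c) E.+ f (j c))) E.+ (f (m c) E.+ f (n c))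
  sum-chart z∣xy f = solve 5 (λ x y u v z → x ⊕ (y ⊕ (u ⊕ (v ⊕ (z ⊕ κ 0ℤ)))) ⊜ (z ⊕ (x ⊕ y)) ⊕ (u ⊕ v))
    E.refl (f 0F) (f 1F) (f 2F) (f 3F) (f 4F)
  sum-chart z∣vy f = solve 5 (λ x y u v z → x ⊕ (y ⊕ (u ⊕ (v ⊕ (z ⊕ κ 0ℤ)))) ⊜ (z ⊕ (v ⊕ y)) ⊕ (x ⊕ u))
    E.refl (f 0F) (f 1F) (f 2F) (f 3F) (f 4F)
  sum-chart z∣xu f = solve 5 (λ x y u v z → x ⊕ (y ⊕ (u ⊕ (v ⊕ (z ⊕ κ 0ℤ)))) ⊜ (z ⊕ (x ⊕ u)) ⊕ (v ⊕ y))
    E.refl (f 0F) (f 1F) (f 2F) (f 3F) (f 4F)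
  sum-chart z∣uv f = solve 5 (λ x y u v z → x ⊕ (y ⊕ (u ⊕ (v ⊕ (z ⊕ κ 0ℤ)))) ⊜ (z ⊕ (u ⊕ v)) ⊕ (x ⊕ y))
    E.refl (f 0F) (f 1F) (f 2F) (f 3F) (f 4F)
  sum-chart x∣yz f = solve 5 (λ x y u v z → x ⊕ (y ⊕ (u ⊕ (v ⊕ (z ⊕ κ 0ℤ)))) ⊜ (x ⊕ (y ⊕ z)) ⊕ (u ⊕ v))
    E.refl (f 0F) (f 1F) (f 2F) (f 3F) (f 4F)
  sum-chart x∣yv f = solve 5 (λ x y u v z → x ⊕ (y ⊕ (u ⊕ (v ⊕ (z ⊕ κ 0ℤ)))) ⊜ (x ⊕ (y ⊕ v)) ⊕ (z ⊕ u))
    E.refl (f 0F) (f 1F) (f 2F) (f 3F) (f 4F)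
  sum-chart y∣ux f = solve 5 (λ x y u v z → x ⊕ (y ⊕ (u ⊕ (v ⊕ (z ⊕ κ 0ℤ)))) ⊜ (y ⊕ (u ⊕ x)) ⊕ (v ⊕ z))
    E.refl (f 0F) (f 1F) (f 2F) (f 3F) (f 4F)

  module _ (c : Chart) (l≉0 : ¬ Vanishes (var (l c))) (M≉0 : ¬ Vanishes (minorOf c)) where

    -- A tangent vector is determined, up to multiples of P, by the values of
    -- the differentials of x_i / x_l and x_j / x_l on it.
    tangent-proportional : ∀ {w} → IsTangent P w →
      coords (l c) E.* w (i c) E.+ E.- (coords (i c) E.* w (l c)) E.≈ E.0# →
      coords (l c) E.* w (j c) E.+ E.- (coords (j c) E.* w (l c)) E.≈ E.0# →
      Proportional E.top coords w
    tangent-proportional {w} t i≈0 j≈0 p q = difference≈0 (E.trans (E.sym (E.*-identityˡ _)) (E.trans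
      (E.*-congʳ (E.sym (proj₂ l⁻¹)))
      (E.trans (solve 6 (λ l l⁻¹ a b c d → (l ⊗ l⁻¹) ⊗ (a ⊗ d ⊖ b ⊗ c) ⊜ l⁻¹ ⊗ (a ⊗ (l ⊗ d) ⊖ b ⊗ (l ⊗ c)))
        E.refl xl (proj₁ l⁻¹) (coords p) (coords q) (w p) (w q))
      (E.trans (E.*-congˡ (E.+-cong (E.*-congˡ (scaled q)) (E.-‿cong (E.*-congˡ (scaled p)))))
      (solve 4 (λ l⁻¹ a b c → l⁻¹ ⊗ (a ⊗ (c ⊗ b) ⊖ b ⊗ (c ⊗ a)) ⊜ κ 0ℤ) E.refl
        (proj₁ l⁻¹) (coords p) (coords q) (w (l c)))))))
      where
      xl = coords (l c)
      l⁻¹ = E.inverse xl (λ h → l≉0 (vanishes h))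

      difference≈0 : ∀ {a b} → a E.+ E.- b E.≈ E.0# → a E.≈ b
      difference≈0 {a} {b} e = E.trans (solve 2 (λ a b → a ⊜ (a ⊖ b) ⊕ b) E.refl a b)
        (E.trans (E.+-congʳ e) (E.+-identityˡ b))

      -- w moved along P to a vector whose l-th coordinate is 0.
      w′ : Vector E.Carrier 5
      w′ q = xl E.* w q E.+ (E.- w (l c)) E.* coords q

      w′≈ : ∀ q → w′ q E.≈ xl E.* w q E.+ E.- (coords q E.* w (l c))
      w′≈ q = solve 4 (λ l w p wl → l ⊗ w ⊕ ⊝ wl ⊗ p ⊜ l ⊗ w ⊖ p ⊗ wl) E.refl xl (w q) (coords q) (w (l c))

      w′-l : w′ (l c) E.≈ E.0#
      w′-l = solve 2 (λ l w → l ⊗ w ⊕ ⊝ w ⊗ l ⊜ κ 0ℤ) E.refl xl (w (l c))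

      w′-i : w′ (i c) E.≈ E.0#
      w′-i = E.trans (w′≈ (i c)) i≈0

      w′-j : w′ (j c) E.≈ E.0#
      w′-j = E.trans (w′≈ (j c)) j≈0

      two-terms : (g : Vector E.Carrier 5) → sum (λ q → g q E.* w q) E.≈ E.0# →
        sum (λ q → g q E.* coords q) E.≈ E.0# →
        w′ (m c) E.* g (m c) E.+ w′ (n c) E.* g (n c) E.≈ E.0#
      two-terms g gw≈0 gP≈0 = begin
        w′ (m c) E.* g (m c) E.+ w′ (n c) E.* g (n c)
          ≈⟨ solve 7 (λ gl gi gj gm gn wm wn → wm ⊗ gm ⊕ wn ⊗ gn ⊜
               (gl ⊗ κ 0ℤ ⊕ (gi ⊗ κ 0ℤ ⊕ gj ⊗ κ 0ℤ)) ⊕ (gm ⊗ wm ⊕ gn ⊗ wn)) E.refl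
               (g (l c)) (g (i c)) (g (j c)) (g (m c)) (g (n c)) (w′ (m c)) (w′ (n c)) ⟩
        (g (l c) E.* E.0# E.+ (g (i c) E.* E.0# E.+ g (j c) E.* E.0#)) E.+
        (g (m c) E.* w′ (m c) E.+ g (n c) E.* w′ (n c))
          ≈⟨ E.+-congʳ (E.+-cong (E.*-congˡ w′-l) (E.+-cong (E.*-congˡ w′-i) (E.*-congˡ w′-j))) ⟨
        (g (l c) E.* w′ (l c) E.+ (g (i c) E.* w′ (i c) E.+ g (j c) E.* w′ (j c))) E.+
        (g (m c) E.* w′ (m c) E.+ g (n c) E.* w′ (n c))
          ≈⟨ sum-chart c (λ q → g q E.* w′ q) ⟨
        sum (λ q → g q E.* w′ q)
          ≈⟨ sum-linear xl (E.- w (l c)) g w coords ⟩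
        xl E.* sum (λ q → g q E.* w q) E.+ (E.- w (l c)) E.* sum (λ q → g q E.* coords q)
          ≈⟨ E.+-cong (E.*-congˡ gw≈0) (E.*-congˡ gP≈0) ⟩
        xl E.* E.0# E.+ (E.- w (l c)) E.* E.0#
          ≈⟨ solve 2 (λ a b → a ⊗ κ 0ℤ ⊕ b ⊗ κ 0ℤ ⊜ κ 0ℤ) E.refl xl (E.- w (l c)) ⟩
        E.0# ∎

      -- Two entries of w′ are left, and two equations for them.
      w′-mn : w′ (m c) E.≈ E.0# × w′ (n c) E.≈ E.0#
      w′-mn = cramer {R = E.commutativeRing} (field-domain {E.top}) (λ h → M≉0 (vanishes h))
        (two-terms (λ q → at P (grad₁ q)) (proj₁ (gradients-at {w} t)) (proj₁ euler))
        (two-terms (λ q → at P (grad₂ q)) (proj₂ (gradients-at {w} t)) (proj₂ euler))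

      scaled : ∀ q → xl E.* w q E.≈ w (l c) E.* coords q
      scaled q = difference≈0 (E.trans (solve 4 (λ l w p wl → l ⊗ w ⊖ wl ⊗ p ⊜ l ⊗ w ⊕ ⊝ wl ⊗ p) E.refl
        xl (w q) (coords q) (w (l c)))
        (cover c {λ q → w′ q E.≈ E.0#} w′-l w′-i w′-j (proj₁ w′-mn) (proj₂ w′-mn) q))

-- Smoothness

X-smooth : IsSmoothOfDimension 2 X
X-smooth E P = 2 , refl , f , f-ideal , independent , λ {g} → generated {g}
  where
  open AtPoint P
  open TangentSpace P
  module E = Extension E

  f : Vector (Poly ℚ-field 5) 2
  f = Q₁ ∷ Q₂ ∷ []

  f-ideal : ∀ i → f i ∈ ideal X × ∃[ d ] Homogeneous d (f i)
  f-ideal 0F = gen (quadrics⊆X-gen (inj₁ refl)) , 2 , Q₁-quadratic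
  f-ideal 1F = gen (quadrics⊆X-gen (inj₂ refl)) , 2 , Q₂-quadratic

  independent : ∀ (a : Vector E.Carrier 2) →
    (∀ j → E.sum (λ i → a i E.* at P (∂ j (f i))) E.≈ E.0#) → ∀ i → a i E.≈ E.0#
  independent a e = λ { 0F → proj₁ zeros ; 1F → proj₂ zeros }
    where
    c = proj₁ chart
    zeros = minor≉0⇒independent (ChartIndex.m c) (ChartIndex.n c) (proj₂ (proj₂ chart)) {a 0F} {a 1F} (λ q → E.trans
      (E.+-cong (E.*-congˡ (E.sym (Eval.ev-cong E {ρ = Point.coords P} (∂Q₁ q))))
        (E.trans (E.*-congˡ (E.sym (Eval.ev-cong E {ρ = Point.coords P} (∂Q₂ q)))) (E.sym (E.+-identityʳ _))))
      (e q))

  generated : ∀ {g} → g ∈ Gen X → ∃[ h ] ¬ (at P h E.≈ E.0#) × (h :* g) ∈ ⟨ (λ p → ∃[ i ] p ≡ f i) ⟩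
  generated g∈X = 𝟙 ,
    (λ 1≈0 → E.1≉0 (E.trans (E.sym (IsRingHomomorphism.1#-homo E.isRingHomomorphism)) 1≈0)) ,
    mul 𝟙 (⟨⟩-mono (λ { (inj₁ refl) → gen (0F , refl) ; (inj₂ refl) → gen (1F , refl) }) (X-gen⊆quadrics g∈X))

-- The degree of X

module Degree where
  private
    module ℚF = Field ℚ-field
    1ℚ -1ℚ 0ℚ : ℚ
    1ℚ  = + 1 / 1
    -1ℚ = ℚF.- 1ℚ
    0ℚ  = + 0 / 1

  -- The hyperplanes z = 0 and x = y.
  ℓ ℓ′ : Vector ℚ 5
  ℓ  = 0ℚ ∷ 0ℚ ∷ 0ℚ ∷ 0ℚ ∷ 1ℚ ∷ []
  ℓ′ = 1ℚ ∷ -1ℚ ∷ 0ℚ ∷ 0ℚ ∷ 0ℚ ∷ []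

  -- The points (1 : 1 : ± 1 : ± 1 : 0).
  sign-u sign-v : Fin 4 → ℚ
  sign-u = 1ℚ ∷ 1ℚ ∷ -1ℚ ∷ -1ℚ ∷ []
  sign-v = 1ℚ ∷ -1ℚ ∷ 1ℚ ∷ -1ℚ ∷ []

  pointCoords : Fin 4 → Vector ℚ 5
  pointCoords i = 1ℚ ∷ 1ℚ ∷ sign-u i ∷ sign-v i ∷ 0ℚ ∷ []

  onQ₁ : ∀ i → eval ℚ-extension (pointCoords i) Q₁ ≡ 0ℚ
  onQ₁ = λ { 0F → refl ; 1F → refl ; 2F → refl ; 3F → refl }

  onQ₂ : ∀ i → eval ℚ-extension (pointCoords i) Q₂ ≡ 0ℚ
  onQ₂ = λ { 0F → refl ; 1F → refl ; 2F → refl ; 3F → refl }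

  points : Fin 4 → Point X ℚ-extension
  points i = point (pointCoords i) (0F , λ ()) (onQ₁ i) (onQ₂ i)

  distinct : ∀ i j → i ≢ j → ¬ Proportional ℚ-field (pointCoords i) (pointCoords j)
  distinct 0F 0F i≢j = λ _ → i≢j refl
  distinct 0F 1F _ h = contradiction (h 0F 3F) λ ()
  distinct 0F 2F _ h = contradiction (h 0F 2F) λ ()
  distinct 0F 3F _ h = contradiction (h 0F 3F) λ ()
  distinct 1F 0F _ h = contradiction (h 0F 3F) λ ()
  distinct 1F 1F i≢j = λ _ → i≢j refl
  distinct 1F 2F _ h = contradiction (h 0F 3F) λ ()
  distinct 1F 3F _ h = contradiction (h 0F 2F) λ ()
  distinct 2F 0F _ h = contradiction (h 0F 2F) λ ()
  distinct 2F 1F _ h = contradiction (h 0F 3F) λ ()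
  distinct 2F 2F i≢j = λ _ → i≢j refl
  distinct 2F 3F _ h = contradiction (h 0F 3F) λ ()
  distinct 3F 0F _ h = contradiction (h 0F 3F) λ ()
  distinct 3F 1F _ h = contradiction (h 0F 2F) λ ()
  distinct 3F 2F _ h = contradiction (h 0F 3F) λ ()
  distinct 3F 3F i≢j = λ _ → i≢j refl

module _ where
  open Degree using (ℓ; ℓ′; sign-u; sign-v; pointCoords; points; distinct)
  private
    module ℚF = Field ℚ-field
    open FiniteSum ℚF.commutativeRing using (sum)
    open IntegerCoefficients ℚF.commutativeRing
    open SetoidReasoning ℚF.setoid

    half-cancel : ∀ (a : ℚ) → (ℚF.1# ℚF.+ ℚF.1#) ℚF.* a ≡ ℚF.0# → a ≡ ℚF.0#
    half-cancel a e = [ (λ ()) , (λ h → h) ]′ (field-domain {ℚ-field} (+ 2 / 1) a e)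

    -- Solves 2 b = 2 s c for a sign s.
    tangent-solution : ∀ s {a b c} → s ℚF.* s ≡ ℚF.1# → a ≡ ℚF.0# →
      (ℚF.1# ℚF.+ ℚF.1#) ℚF.* b ℚF.+ ((ℚF.- (s ℚF.+ s)) ℚF.* c ℚF.+ a) ≡ ℚF.0# → c ≡ b ℚF.* s
    tangent-solution s {a} {b} {c} s²≡1 a≡0 e = begin
      c                            ≡⟨ solve 3 (λ b c s → c ⊜ b ⊗ s ⊖ (b ⊗ s ⊖ c)) refl b c s ⟩
      b ℚF.* s ℚF.+ ℚF.- (b ℚF.* s ℚF.+ ℚF.- c) ≡⟨ ≡.cong (λ d → b ℚF.* s ℚF.+ ℚF.- d) (half-cancel _ (begin
        (ℚF.1# ℚF.+ ℚF.1#) ℚF.* (b ℚF.* s ℚF.+ ℚF.- c)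
          ≡⟨ solve 4 (λ a b c s → (κ 1ℤ ⊕ κ 1ℤ) ⊗ (b ⊗ s ⊖ c)
               ⊜ s ⊗ ((κ 1ℤ ⊕ κ 1ℤ) ⊗ b ⊕ (⊝ (s ⊕ s) ⊗ c ⊕ a)) ⊕ ((κ 1ℤ ⊕ κ 1ℤ) ⊗ c ⊗ (s ⊗ s ⊖ κ 1ℤ) ⊖ s ⊗ a))
               refl a b c s ⟩
        s ℚF.* ((ℚF.1# ℚF.+ ℚF.1#) ℚF.* b ℚF.+ ((ℚF.- (s ℚF.+ s)) ℚF.* c ℚF.+ a)) ℚF.+
        ((ℚF.1# ℚF.+ ℚF.1#) ℚF.* c ℚF.* (s ℚF.* s ℚF.+ ℚF.- ℚF.1#) ℚF.+ ℚF.- (s ℚF.* a))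
          ≡⟨ ≡.cong₂ ℚF._+_ (≡.cong (s ℚF.*_) e) (≡.cong₂
               (λ t a → (ℚF.1# ℚF.+ ℚF.1#) ℚF.* c ℚF.* (t ℚF.+ ℚF.- ℚF.1#) ℚF.+ ℚF.- (s ℚF.* a)) s²≡1 a≡0) ⟩
        s ℚF.* ℚF.0# ℚF.+ ((ℚF.1# ℚF.+ ℚF.1#) ℚF.* c ℚF.* (ℚF.1# ℚF.+ ℚF.- ℚF.1#) ℚF.+ ℚF.- (s ℚF.* ℚF.0#))
          ≡⟨ solve 2 (λ c s → s ⊗ κ 0ℤ ⊕ ((κ 1ℤ ⊕ κ 1ℤ) ⊗ c ⊗ (κ 1ℤ ⊖ κ 1ℤ) ⊖ s ⊗ κ 0ℤ) ⊜ κ 0ℤ) refl c s ⟩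
        ℚF.0# ∎)) ⟩
      b ℚF.* s ℚF.+ ℚF.- ℚF.0# ≡⟨ solve 2 (λ b s → b ⊗ s ⊖ κ 0ℤ ⊜ b ⊗ s) refl b s ⟩
      b ℚF.* s ∎

    sign-u² : ∀ i → sign-u i ℚF.* sign-u i ≡ ℚF.1#
    sign-u² = λ { 0F → refl ; 1F → refl ; 2F → refl ; 3F → refl }

    sign-v² : ∀ i → sign-v i ℚF.* sign-v i ≡ ℚF.1#
    sign-v² = λ { 0F → refl ; 1F → refl ; 2F → refl ; 3F → refl }

  transversal : ∀ i w → IsTangent (points i) w → sum (λ q → ℓ q ℚF.* w q) ≡ ℚF.0# →
    sum (λ q → ℓ′ q ℚF.* w q) ≡ ℚF.0# → Proportional ℚ-field (pointCoords i) w
  transversal i w t ℓw≡0 ℓ′w≡0 = proportional {R = ℚF.commutativeRing} {5} {w 0F} {pointCoords i} {w} λ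
    { 0F → solve 1 (λ a → a ⊜ a ⊗ κ 1ℤ) refl (w 0F)
    ; 1F → y≡x
    ; 2F → tangent-solution (sign-u i) {b = w 0F} {w 2F} (sign-u² i) z≡0 (begin
        (ℚF.1# ℚF.+ ℚF.1#) ℚF.* w 0F ℚF.+ ((ℚF.- (sign-u i ℚF.+ sign-u i)) ℚF.* w 2F ℚF.+ w 4F)
          ≡⟨ solve 6 (λ s a b c d e → (κ 1ℤ ⊕ κ 1ℤ) ⊗ a ⊕ (⊝ (s ⊕ s) ⊗ c ⊕ e) ⊜
               (κ 1ℤ ⊕ κ 1ℤ) ⊗ a ⊕ (κ 0ℤ ⊗ b ⊕ (⊝ (s ⊕ s) ⊗ c ⊕ (κ 0ℤ ⊗ d ⊕ (κ 1ℤ ⊗ e ⊕ κ 0ℤ))))) refl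
               (sign-u i) (w 0F) (w 1F) (w 2F) (w 3F) (w 4F) ⟩
        sum (λ q → at (points i) (grad₁ q) ℚF.* w q)
          ≡⟨ proj₁ (TangentSpace.gradients-at (points i) {w} t) ⟩
        ℚF.0# ∎)
    ; 3F → tangent-solution (sign-v i) {b = w 0F} {w 3F} (sign-v² i) z≡0 (begin
        (ℚF.1# ℚF.+ ℚF.1#) ℚF.* w 0F ℚF.+ ((ℚF.- (sign-v i ℚF.+ sign-v i)) ℚF.* w 3F ℚF.+ w 4F)
          ≡⟨ ≡.cong (λ y → (ℚF.1# ℚF.+ ℚF.1#) ℚF.* y ℚF.+ ((ℚF.- (sign-v i ℚF.+ sign-v i)) ℚF.* w 3F ℚF.+ w 4F))
               (≡.sym (≡.trans y≡x (solve 1 (λ a → a ⊗ κ 1ℤ ⊜ a) refl (w 0F)))) ⟩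
        (ℚF.1# ℚF.+ ℚF.1#) ℚF.* w 1F ℚF.+ ((ℚF.- (sign-v i ℚF.+ sign-v i)) ℚF.* w 3F ℚF.+ w 4F)
          ≡⟨ solve 6 (λ s a b c d e → (κ 1ℤ ⊕ κ 1ℤ) ⊗ b ⊕ (⊝ (s ⊕ s) ⊗ d ⊕ e) ⊜
               κ 0ℤ ⊗ a ⊕ ((κ 1ℤ ⊕ κ 1ℤ) ⊗ b ⊕ (κ 0ℤ ⊗ c ⊕ (⊝ (s ⊕ s) ⊗ d ⊕ (κ 1ℤ ⊗ e ⊕ κ 0ℤ))))) refl
               (sign-v i) (w 0F) (w 1F) (w 2F) (w 3F) (w 4F) ⟩
        sum (λ q → at (points i) (grad₂ q) ℚF.* w q)
          ≡⟨ proj₂ (TangentSpace.gradients-at (points i) {w} t) ⟩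
        ℚF.0# ∎)
    ; 4F → ≡.trans z≡0 (solve 1 (λ a → κ 0ℤ ⊜ a ⊗ κ 0ℤ) refl (w 0F))
    }
    where
    z≡0 : w 4F ≡ ℚF.0#
    z≡0 = ≡.trans (solve 5 (λ a b c d e → e ⊜
      κ 0ℤ ⊗ a ⊕ (κ 0ℤ ⊗ b ⊕ (κ 0ℤ ⊗ c ⊕ (κ 0ℤ ⊗ d ⊕ (κ 1ℤ ⊗ e ⊕ κ 0ℤ))))) refl
      (w 0F) (w 1F) (w 2F) (w 3F) (w 4F)) ℓw≡0

    y≡x : w 1F ≡ w 0F ℚF.* ℚF.1#
    y≡x = begin
      w 1F ≡⟨ solve 5 (λ a b c d e → b ⊜ a ⊗ κ 1ℤ ⊖
        (κ 1ℤ ⊗ a ⊕ (⊝ κ 1ℤ ⊗ b ⊕ (κ 0ℤ ⊗ c ⊕ (κ 0ℤ ⊗ d ⊕ (κ 0ℤ ⊗ e ⊕ κ 0ℤ)))))) refl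
        (w 0F) (w 1F) (w 2F) (w 3F) (w 4F) ⟩
      w 0F ℚF.* ℚF.1# ℚF.+ ℚF.- sum (λ q → ℓ′ q ℚF.* w q) ≡⟨ ≡.cong (λ a → w 0F ℚF.* ℚF.1# ℚF.+ ℚF.- a) ℓ′w≡0 ⟩
      w 0F ℚF.* ℚF.1# ℚF.+ ℚF.- ℚF.0#                     ≡⟨ solve 1 (λ a → a ⊗ κ 1ℤ ⊖ κ 0ℤ ⊜ a ⊗ κ 1ℤ) refl (w 0F) ⟩
      w 0F ℚF.* ℚF.1#                                     ∎

module _ where
  open Degree using (ℓ; ℓ′; sign-u; sign-v; pointCoords; points; distinct)

  -- For z = 0 and x = y the equations become u² = x² and v² = x².
  complete : (L : Extension ℚ-field) (P : Point X (ℚ-extension ⟫ L)) →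
    let module L = Extension L
        Q = Point.coords P
    in L.sum (λ i → L.ι (ℓ i) L.* Q i) L.≈ L.0# → L.sum (λ i → L.ι (ℓ′ i) L.* Q i) L.≈ L.0# →
       ∃[ i ] Proportional L.top (λ q → L.ι (pointCoords i q)) Q
  complete L P ℓQ≈0 ℓ′Q≈0 = which (vanishes-* (u :- x) (u :+ x) u²≡x²) (vanishes-* (v :- x) (v :+ x) v²≡x²)
    where
    module L = Extension L
    open AtPoint P
    open TangentSpace P using (at-sum)
    Q = Point.coords P

    linearForm : Vector ℚ 5 → Poly ℚ-field 5
    linearForm a = Σₚ {n = 5} (λ q → con (a q) :* var q)

    z≡0 : Vanishes z
    z≡0 = vanishes-resp {p = linearForm ℓ} identity (vanishes (L.trans (at-sum {5} (λ q → con (ℓ q) :* var q)) ℓQ≈0))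

    x≡y : Vanishes (x :- y)
    x≡y = vanishes-resp {p = linearForm ℓ′} identity (vanishes (L.trans (at-sum {5} (λ q → con (ℓ′ q) :* var q)) ℓ′Q≈0))

    u²≡x² : Vanishes ((u :- x) :* (u :+ x))
    u²≡x² = vanishes-resp {p = y :* z :+ (:- 𝟙) :* Q₁} identity (y ⊡ z≡0 ⊞ (:- 𝟙) ⊡ onQ₁)

    v²≡x² : Vanishes ((v :- x) :* (v :+ x))
    v²≡x² = vanishes-resp {p = x :* z :+ ((:- (x :+ y)) :* (x :- y) :+ (:- 𝟙) :* Q₂)} identity
      (x ⊡ z≡0 ⊞ (:- (x :+ y)) ⊡ x≡y ⊞ (:- 𝟙) ⊡ onQ₂)

    is-point : ∀ i → Vanishes (u :- con (sign-u i) :* x) → Vanishes (v :- con (sign-v i) :* x) →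
               ∃[ i ] Proportional L.top (λ q → L.ι (pointCoords i q)) Q
    is-point i eu ev = i , proportional {R = L.commutativeRing} {5} {Q 0F}
      {λ q → L.ι (pointCoords i q)} {Q} λ
        { 0F → from {𝟙} {x} (vanishes-resp identity (𝟘 ⊡ z≡0))
        ; 1F → from {𝟙} {y} (vanishes-resp identity ((:- 𝟙) ⊡ x≡y))
        ; 2F → from {con (sign-u i)} eu
        ; 3F → from {con (sign-v i)} ev
        ; 4F → from {𝟘} {z} (vanishes-resp identity (𝟙 ⊡ z≡0))
        }
      where
      open IntegerCoefficients L.commutativeRing
      from : ∀ {c p} → Vanishes (p :- c :* x) → at P p L.≈ Q 0F L.* at P c
      from {c} {p} (vanishes e) = L.trans (solve 3 (λ p c x → p ⊜ (p ⊖ c ⊗ x) ⊕ x ⊗ c) L.refl (at P p) (at P c) (Q 0F))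
        (L.trans (L.+-congʳ e) (L.+-identityˡ _))

    which : Vanishes (u :- x) ⊎ Vanishes (u :+ x) → Vanishes (v :- x) ⊎ Vanishes (v :+ x) →
            ∃[ i ] Proportional L.top (λ q → L.ι (pointCoords i q)) Q
    which (inj₁ a) (inj₁ b) = is-point 0F (vanishes-resp identity a) (vanishes-resp identity b)
    which (inj₁ a) (inj₂ b) = is-point 1F (vanishes-resp identity a) (vanishes-resp identity b)
    which (inj₂ a) (inj₁ b) = is-point 2F (vanishes-resp identity a) (vanishes-resp identity b)
    which (inj₂ a) (inj₂ b) = is-point 3F (vanishes-resp identity a) (vanishes-resp identity b)

  X-degree : HasDegree 4 X
  X-degree = record
    { E = ℚ-extension
    ; ℓ = ℓ ; ℓ′ = ℓ′
    ; points = points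
    ; on-ℓ  = λ { 0F → refl ; 1F → refl ; 2F → refl ; 3F → refl }
    ; on-ℓ′ = λ { 0F → refl ; 1F → refl ; 2F → refl ; 3F → refl }
    ; distinct    = distinct
    ; transversal = transversal
    ; complete    = complete
    }

-- Rational functions and forms on X

-- The homogeneous coordinate ring of X.
Xᵣ : CommutativeRing 0ℓ 0ℓ
Xᵣ = Quotient (Gen X)

private
  module Xᵣ = CommutativeRing Xᵣ
  module Coordinates = CoordinateRing ℚ-field (+ 1 / 2 , refl)

X-prime : ∀ p q → (p :* q) ∈ ideal X → p ∈ ideal X ⊎ q ∈ ideal X
X-prime p q pq∈X = [ (λ h → inj₁ (proj₂ X-isIntersection h)) , (λ h → inj₂ (proj₂ X-isIntersection h)) ]′
  (Coordinates.quadrics-prime p q (proj₁ X-isIntersection pq∈X))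

∉X-* : ∀ {p q} → p ∉ ideal X → q ∉ ideal X → (p :* q) ∉ ideal X
∉X-* p∉X q∉X pq∈X = [ p∉X , q∉X ]′ (X-prime _ _ pq∈X)

nonzero-at⇒∉X : ∀ {E} (P : Point X E) → let open Extension E in ∀ {p} → ¬ (at P p ≈ 0#) → p ∉ ideal X
nonzero-at⇒∉X P p≉0 p∈X = p≉0 (vanishes-at P p∈X)

z∉X : z ∉ ideal X
z∉X z∈X = Coordinates.z∉quadrics (proj₁ X-isIntersection z∈X)

-- The rational function x_i / x_l.
coordinateRatio : (i l : Fin 5) → var l ∉ ideal X → RationalFunction X
coordinateRatio i l l∉X = record
  { degree = 1
  ; fraction = record { num = var i ; den = var l ; num-hom = var i ; den-hom = var l ; den≢0 = l∉X } }

private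
  module PolySum = FiniteSum (polyRing ℚ-field 5)

Σ-∂-var : ∀ (w : Vector (Poly ℚ-field 5) 5) i → Σₚ (λ q → w q :* ∂ q (var i)) ≋ w i
Σ-∂-var w i = ≋-trans
  (PolySum.sum-cong {f = λ q → w q :* ∂ q (var i)} {g = λ q → ∂ q (var i) :* w q} (λ q → *-comm (w q) (∂ q (var i))))
  (PolySum.sum-δ i w)

d-coordinateRatio : ∀ i l l∉X w → d[ coordinateRatio i l l∉X ] w ≋ var l :* w i :- var i :* w l
d-coordinateRatio i l l∉X w =
  +-cong (*-cong ≋-refl (Σ-∂-var w i)) (neg-cong (*-cong ≋-refl (Σ-∂-var w l)))

module _ {E : Extension ℚ-field} (P : Point X E) where
  private
    module E = Extension E
    open FiniteSum E.commutativeRing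

  differential-var : ∀ i w → differential P (var i) w E.≈ w i
  differential-var i w = E.trans
    (sum-cong {f = λ q → at P (∂ q (var i)) E.* w q} (λ q → E.*-congʳ (at-δ (does (q Fin.≟ i)))))
    (sum-δ i w)
    where
    open IsRingHomomorphism E.isRingHomomorphism
    at-δ : ∀ b → at P (if b then 𝟙 else 𝟘) E.≈ (if b then E.1# else E.0#)
    at-δ true  = 1#-homo
    at-δ false = 0#-homo

  d-coordinateRatio-at : ∀ i l l∉X w → d[ coordinateRatio i l l∉X ]at P w E.≈
    Point.coords P l E.* w i E.+ E.- (Point.coords P i E.* w l)
  d-coordinateRatio-at i l l∉X w =
    E.+-cong (E.*-congˡ (differential-var i w)) (E.-‿cong (E.*-congˡ (differential-var l w)))

-- The canonical divisor

module _ (w w′ : Vector (Poly ℚ-field 5) 5) where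
  open Determinant Xᵣ
  open ChartIndex

  private
    -- The rows of the matrix with columns (x, y, u, v, z), w and w′.
    row : Fin 5 → Vector (Poly ℚ-field 5) 3
    row i = var i ∷ w i ∷ w′ i ∷ []

    -- The determinant of the chart z∣xy.
    D : Poly ℚ-field 5
    D = det (row 4F) (row 0F) (row 1F)

  -- The determinant of the rows l, i, j.
  chartDet : Chart → Poly ℚ-field 5
  chartDet c = det (row (l c)) (row (i c)) (row (j c))

  form-numerator : ∀ i j l (l∉X : var l ∉ ideal X) →
    let a = coordinateRatio i l l∉X ; b = coordinateRatio j l l∉X in
    d[ a ] w :* d[ b ] w′ :- d[ a ] w′ :* d[ b ] w ≋ var l :* det (row l) (row i) (row j)
  form-numerator i j l l∉X = ≋-trans
    (+-cong (*-cong (d-coordinateRatio i l l∉X w) (d-coordinateRatio j l l∉X w′))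
      (neg-cong (*-cong (d-coordinateRatio i l l∉X w′) (d-coordinateRatio j l l∉X w))))
    (solve 9 (λ a b c a′ b′ c′ a″ b″ c″ →
        (a ⊗ b′ ⊖ b ⊗ a′) ⊗ (a ⊗ c″ ⊖ c ⊗ a″) ⊖ (a ⊗ b″ ⊖ b ⊗ a″) ⊗ (a ⊗ c′ ⊖ c ⊗ a′)
      ⊜ a ⊗ ((a ⊗ (b′ ⊗ c″ ⊖ b″ ⊗ c′) ⊖ b ⊗ (a′ ⊗ c″ ⊖ a″ ⊗ c′)) ⊕ c ⊗ (a′ ⊗ b″ ⊖ a″ ⊗ b′))) ≋-refl
      (var l) (var i) (var j) (w l) (w i) (w j) (w′ l) (w′ i) (w′ j))
    where open IntegerCoefficients (polyRing ℚ-field 5)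

  module _ (w-field : VectorField X w) (w′-field : VectorField X w′) where
    private
  
      -- The two equations for a vector field; the Euler field is one by homogeneity.
      u-relation : (w : Vector (Poly ℚ-field 5) 5) → Σₚ (λ q → w q :* ∂ q Q₁) ∈ ideal X →
        (u :+ u) :* w 2F ≡ (x :+ x) :* w 0F :+ z :* w 1F :+ y :* w 4F [mod ideal X ]
      u-relation w h = resp (≋-trans
          (*-cong ≋-refl (PolySum.sum-cong {f = λ q → w q :* ∂ q Q₁} {g = λ q → w q :* grad₁ q}
            (λ q → *-cong (≋-refl {p = w q}) (∂Q₁ q))))
          (solve 9 (λ x y u z a b c d e →
              ⊝ (κ 1ℤ) ⊗ (a ⊗ (x ⊕ x) ⊕ (b ⊗ z ⊕ (c ⊗ ⊝ (u ⊕ u) ⊕ (d ⊗ κ 0ℤ ⊕ (e ⊗ y ⊕ κ 0ℤ)))))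
            ⊜ (u ⊕ u) ⊗ c ⊖ ((x ⊕ x) ⊗ a ⊕ z ⊗ b ⊕ y ⊗ e)) ≋-refl x y u z (w 0F) (w 1F) (w 2F) (w 3F) (w 4F)))
        (mul (:- 𝟙) h)
        where open IntegerCoefficients (polyRing ℚ-field 5)

      v-relation : (w : Vector (Poly ℚ-field 5) 5) → Σₚ (λ q → w q :* ∂ q Q₂) ∈ ideal X →
        (v :+ v) :* w 3F ≡ z :* w 0F :+ (y :+ y) :* w 1F :+ x :* w 4F [mod ideal X ]
      v-relation w h = resp (≋-trans
          (*-cong ≋-refl (PolySum.sum-cong {f = λ q → w q :* ∂ q Q₂} {g = λ q → w q :* grad₂ q}
            (λ q → *-cong (≋-refl {p = w q}) (∂Q₂ q))))
          (solve 9 (λ x y v z a b c d e →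
              ⊝ (κ 1ℤ) ⊗ (a ⊗ z ⊕ (b ⊗ (y ⊕ y) ⊕ (c ⊗ κ 0ℤ ⊕ (d ⊗ ⊝ (v ⊕ v) ⊕ (e ⊗ x ⊕ κ 0ℤ)))))
            ⊜ (v ⊕ v) ⊗ d ⊖ (z ⊗ a ⊕ (y ⊕ y) ⊗ b ⊕ x ⊗ e)) ≋-refl x y v z (w 0F) (w 1F) (w 2F) (w 3F) (w 4F)))
        (mul (:- 𝟙) h)
        where open IntegerCoefficients (polyRing ℚ-field 5)

      Q₁∈X : Q₁ ∈ Gen X
      Q₁∈X = quadrics⊆X-gen (inj₁ refl)
      Q₂∈X : Q₂ ∈ Gen X
      Q₂∈X = quadrics⊆X-gen (inj₂ refl)

      euler₁ : Σₚ {n = 5} (λ q → var q :* ∂ q Q₁) ∈ ideal X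
      euler₁ = resp identity (mul (con (+ 2 / 1)) (gen Q₁∈X))
      euler₂ : Σₚ {n = 5} (λ q → var q :* ∂ q Q₂) ∈ ideal X
      euler₂ = resp identity (mul (con (+ 2 / 1)) (gen Q₂∈X))

      u-relations : ∀ i → (u :+ u) :* row 2F i ≡ (x :+ x) :* row 0F i :+ z :* row 1F i :+ y :* row 4F i [mod ideal X ]
      u-relations = λ
        { 0F → u-relation var euler₁ ; 1F → u-relation w (w-field Q₁∈X) ; 2F → u-relation w′ (w′-field Q₁∈X) }

      v-relations : ∀ i → (v :+ v) :* row 3F i ≡ z :* row 0F i :+ (y :+ y) :* row 1F i :+ x :* row 4F i [mod ideal X ]
      v-relations = λ
        { 0F → v-relation var euler₂ ; 1F → v-relation w (w-field Q₂∈X) ; 2F → v-relation w′ (w′-field Q₂∈X) }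

      module C = Complementary {x} {y} {u} {v} {z} {row 0F} {row 1F} {row 2F} {row 3F} {row 4F}
        u-relations v-relations

    private
      from-u : ∀ {p M d} → M ≋ (v :+ v) :* p → (u :+ u) :* d ≡ p :* D [mod ideal X ] →
        (u :+ u) :* ((v :+ v) :* d) ≡ M :* D [mod ideal X ]
      from-u {p} {M} {d} M≋ e = Xᵣ.trans
        (≋⇒mod (solve 3 (λ a b c → a ⊗ (b ⊗ c) ⊜ b ⊗ (a ⊗ c)) ≋-refl (u :+ u) (v :+ v) d))
        (Xᵣ.trans (Xᵣ.*-congˡ e) (≋⇒mod (≋-trans (≋-sym (*-assoc _ _ _)) (*-cong (≋-sym M≋) ≋-refl))))
        where open IntegerCoefficients (polyRing ℚ-field 5)

      from-v : ∀ {p M d} → M ≋ (u :+ u) :* p → (v :+ v) :* d ≡ p :* D [mod ideal X ] →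
        (u :+ u) :* ((v :+ v) :* d) ≡ M :* D [mod ideal X ]
      from-v M≋ e = Xᵣ.trans (Xᵣ.*-congˡ e) (≋⇒mod (≋-trans (≋-sym (*-assoc _ _ _)) (*-cong (≋-sym M≋) ≋-refl)))

      from-uv : ∀ {M d} → M ≋ (u :+ u) :* (v :+ v) → d ≡ D [mod ideal X ] →
        (u :+ u) :* ((v :+ v) :* d) ≡ M :* D [mod ideal X ]
      from-uv M≋ e = Xᵣ.trans (Xᵣ.*-congˡ (Xᵣ.*-congˡ e))
        (≋⇒mod (≋-trans (≋-sym (*-assoc _ _ _)) (*-cong (≋-sym M≋) ≋-refl)))

    -- 4 u v is the Jacobian minor of the chart z∣xy, and so this is the equality of
    -- the ratios of determinant and complementary minor for c and for that chart.
    chartDet-minor : ∀ c → (u :+ u) :* ((v :+ v) :* chartDet c) ≡ minorOf c :* D [mod ideal X ]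
    chartDet-minor z∣xy = from-uv identity Xᵣ.refl
    chartDet-minor z∣vy = from-v identity C.det-zvy
    chartDet-minor z∣xu = from-u identity C.det-zxu
    chartDet-minor z∣uv = Xᵣ.trans C.det-zuv (≋⇒mod (*-cong identity ≋-refl))
    chartDet-minor x∣yz = from-uv identity C.det-xyz
    chartDet-minor x∣yv = from-v identity C.det-xyv
    chartDet-minor y∣ux = from-u identity C.det-yux

private
  uv∉X : (u :* v) ∉ ideal X
  uv∉X = nonzero-at⇒∉X (Degree.points 0F) {u :* v} (λ ())

-- z² / (u v) d(x/z) ∧ d(y/z), which is dx ∧ dy / (u v) on the affine surface and
-- has no zeros or poles there; its divisor is minus the hyperplane section z = 0.
ω : RationalTwoForm X
ω = record
  { degree = 2
  ; fraction = record
    { num = z :* z ; den = u :* v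
    ; num-hom = mul (var _) (var _) ; den-hom = mul (var _) (var _) ; den≢0 = uv∉X }
  } ·d coordinateRatio 0F 4F z∉X ∧d coordinateRatio 1F 4F z∉X

-- 1 / z, a section of the sheaf 𝒪(-1).
z⁻¹ : Fraction X 0 1
z⁻¹ = record { num = 𝟙 ; den = z ; num-hom = con _ ; den-hom = var _ ; den≢0 = z∉X }

module _ (c : Chart) (l∉X : var (ChartIndex.l c) ∉ ideal X) (M∉X : ChartIndex.minorOf c ∉ ideal X) where
  open ChartIndex

  private
    L M : Poly ℚ-field 5
    L = var (l c)
    M = minorOf c

    4L³ : Poly ℚ-field 5
    4L³ = con (+ 4 / 1) :* L :* L :* L

    4L³-cubic : Homogeneous 3 4L³
    4L³-cubic = mul (mul (mul (con _) (var _)) (var _)) (var _)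

  -- The coefficient of ω with respect to the coordinates of the chart.
  coefficient : RationalFunction X
  coefficient = record
    { degree = 3
    ; fraction = record
      { num = 4L³ ; den = z :* M ; num-hom = 4L³-cubic
      ; den-hom = mul (var _) (minor-quadratic (m c) (n c)) ; den≢0 = ∉X-* z∉X M∉X } }

  -- A generator of 𝒪(1) where L and M do not vanish: coefficient is unit / z.
  unit : Fraction X 3 2
  unit = record
    { num = 4L³ ; den = M ; num-hom = 4L³-cubic ; den-hom = minor-quadratic (m c) (n c) ; den≢0 = M∉X }

  chartForm : RationalTwoForm X
  chartForm = coefficient ·d coordinateRatio (i c) (l c) l∉X ∧d coordinateRatio (j c) (l c) l∉X

  ω≈chartForm : ω ≈Ω chartForm
  ω≈chartForm {w} {w′} w-field w′-field = begin
    numerator ω w w′ :* denominator chartForm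
      ≈⟨ ≋⇒mod (*-cong (*-cong ≋-refl (form-numerator w w′ 0F 1F 4F z∉X)) ≋-refl) ⟩
    (z :* z) :* (z :* D) :* ((z :* M) :* (L :^ 2 :* L :^ 2))
      ≈⟨ ≋⇒mod (solve 4 (λ z d m l → (z ⊗ z) ⊗ (z ⊗ d) ⊗ ((z ⊗ m) ⊗ ((l ⊗ (l ⊗ κ 1ℤ)) ⊗ (l ⊗ (l ⊗ κ 1ℤ))))
           ⊜ (z ⊗ z ⊗ z ⊗ z ⊗ l ⊗ l ⊗ l ⊗ l) ⊗ (m ⊗ d)) ≋-refl z D M L) ⟩
    (z :* z :* z :* z :* L :* L :* L :* L) :* (M :* D)
      ≈⟨ Xᵣ.*-congˡ (chartDet-minor w w′ w-field w′-field c) ⟨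
    (z :* z :* z :* z :* L :* L :* L :* L) :* ((u :+ u) :* ((v :+ v) :* Dᶜ))
      ≈⟨ ≋⇒mod (solve 5 (λ z l u v d →
           (z ⊗ z ⊗ z ⊗ z ⊗ l ⊗ l ⊗ l ⊗ l) ⊗ ((u ⊕ u) ⊗ ((v ⊕ v) ⊗ d))
           ⊜ (((κ (+ 4) ⊗ l ⊗ l ⊗ l) ⊗ (l ⊗ d)) ⊗ ((u ⊗ v) ⊗ ((z ⊗ (z ⊗ κ 1ℤ)) ⊗ (z ⊗ (z ⊗ κ 1ℤ))))))
           ≋-refl z L u v Dᶜ) ⟩
    ((((𝟙 :+ 𝟙) :+ 𝟙) :+ 𝟙) :* L :* L :* L) :* (L :* Dᶜ) :* ((u :* v) :* (z :^ 2 :* z :^ 2))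
      ≈⟨ ≋⇒mod (*-cong (*-cong (*-cong (*-cong (*-cong 4≋ ≋-refl) ≋-refl) ≋-refl)
           (≋-sym (form-numerator w w′ (i c) (j c) (l c) l∉X))) ≋-refl) ⟩
    numerator chartForm w w′ :* denominator ω ∎
    where
    open SetoidReasoning Xᵣ.setoid
    open IntegerCoefficients (polyRing ℚ-field 5)
    D Dᶜ : Poly ℚ-field 5
    D  = chartDet w w′ z∣xy
    Dᶜ = chartDet w w′ c
    4≋ : ((𝟙 :+ 𝟙) :+ 𝟙) :+ 𝟙 ≋ con {ℚ-field} {5} (+ 4 / 1)
    4≋ = identity

module _ (E : Extension ℚ-field) (P : Point X E) where
  open AtPoint P
  open ChartIndex
  private
    module E = Extension E
    c = proj₁ chart

    l∉X : var (l c) ∉ ideal X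
    l∉X l∈X = proj₁ (proj₂ chart) (vanishes (vanishes-at P l∈X))

    M∉X : minorOf c ∉ ideal X
    M∉X M∈X = proj₂ (proj₂ chart) (vanishes (vanishes-at P M∈X))

    l≉0 : ¬ (at P (var (l c)) E.≈ E.0#)
    l≉0 h = proj₁ (proj₂ chart) (vanishes h)

    four-nonzero : ¬ (Vanishes (con (+ 4 / 1)))
    four-nonzero = constant-nonzero (+ 4 / 1) (+ 1 / 4) ≋-refl

  localCoordinates : AreLocalCoordinates P (coordinateRatio (i c) (l c) l∉X) (coordinateRatio (j c) (l c) l∉X)
  localCoordinates = record
    { a-regular   = l≉0
    ; b-regular   = l≉0
    ; independent = λ w w-tangent a≈0 b≈0 →
        TangentSpace.tangent-proportional P c (proj₁ (proj₂ chart)) (proj₂ (proj₂ chart)) {w} w-tangent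
          (E.trans (E.sym (d-coordinateRatio-at P (i c) (l c) l∉X w)) a≈0)
          (E.trans (E.sym (d-coordinateRatio-at P (j c) (l c) l∉X w)) b≈0)
    }

  X-divisorsAgree : DivisorsAgreeAt 1 ω z⁻¹ P
  X-divisorsAgree = record
    { a = coordinateRatio (i c) (l c) l∉X
    ; b = coordinateRatio (j c) (l c) l∉X
    ; h = coefficient c l∉X M∉X
    ; coordinates = localCoordinates
    ; ω≈ = λ {w} {w′} → ω≈chartForm c l∉X M∉X {w} {w′}
    ; d = 2
    ; t = unit c l∉X M∉X
    ; t-num≢0 = λ h → l≢0 (cancel l≢0 (vanishes-resp (*-comm _ _) (cancel l≢0 (vanishes-resp
        (≋-trans (*-comm _ _) (*-cong ≋-refl (*-comm _ _))) (cancel four-nonzero (vanishes-resp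
        (≋-trans (*-cong (*-assoc _ _ _) ≋-refl) (*-assoc _ _ _)) (vanishes h)))))))
    ; t-den≢0 = λ h → proj₂ (proj₂ chart) (vanishes h)
    ; hᵐ≈st = ≋⇒mod (solve 3 (λ n z m → (n ⊗ κ 1ℤ) ⊗ (z ⊗ m) ⊜ κ 1ℤ ⊗ n ⊗ ((z ⊗ m) ⊗ κ 1ℤ)) ≋-refl
        (Fraction.num (unit c l∉X M∉X)) z (minorOf c))
    }
    where
    open IntegerCoefficients (polyRing ℚ-field 5)
    l≢0 : ¬ Vanishes (var (l c))
    l≢0 = proj₁ (proj₂ chart)

X-anticanonical : IsPluricanonicallyMinusHyperplane 1 X
X-anticanonical = record
  { ω = ω ; e = 0 ; s = z⁻¹
  ; s≢0 = nonzero-at⇒∉X (Degree.points 0F) {𝟙} (λ ())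
  ; local = X-divisorsAgree
  }

X-isSurface : IsSmoothProjectiveSurface X
X-isSurface = record { geometricallyIntegral = X-geometricallyIntegral ; smooth = X-smooth }

X-isDelPezzo : IsDelPezzo 4 X
X-isDelPezzo = record
  { isSurface   = X-isSurface
  ; Y           = X
  ; Y-isSurface = X-isSurface
  ; X≅Y         = isomorphic-refl X 4F z∉X
  ; m           = 1
  ; m≥1         = s≤s z≤n
  ; -mK∼H       = X-anticanonical
  ; m²K²        = X-degree
  }

-- The parametrisation

module Parametrisation where
  ƛ μ ν 𝟚 𝟜 N D : Poly ℚ-field 3
  ƛ = var 0F
  μ = var 1F
  ν = var 2F
  𝟚 = con (+ 2 / 1)
  𝟜 = con (+ 4 / 1)
  -- The homogenisations of μ² - ƛ⁴ and 4 ƛ³ - 4 ƛ μ + 1.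
  N = μ :* μ :* ν :* ν :- ƛ :* ƛ :* ƛ :* ƛ
  D = 𝟜 :* ƛ :* ƛ :* ƛ :- 𝟜 :* ƛ :* μ :* ν :+ ν :* ν :* ν

  N-quartic : Homogeneous 4 N
  N-quartic = add (mul (mul (mul (var _) (var _)) (var _)) (var _))
    (neg (mul (mul (mul (var _) (var _)) (var _)) (var _)))

  D-cubic : Homogeneous 3 D
  D-cubic = add (add (mul (mul (mul (con _) (var _)) (var _)) (var _))
    (neg (mul (mul (mul (con _) (var _)) (var _)) (var _)))) (mul (mul (var _) (var _)) (var _))

  -- The formulas for x, y, u, v, multiplied by the common denominator ν² D.
  φ-coords : Vector (Poly ℚ-field 3) 5
  φ-coords = ν :* N
           ∷ 𝟚 :* ƛ :* N :+ ƛ :* ƛ :* D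
           ∷ ν :* N :+ ƛ :* ν :* D
           ∷ 𝟚 :* ƛ :* N :+ μ :* ν :* D
           ∷ ν :* ν :* D ∷ []

  ∉ℙ² : ∀ p (c : Vector ℚ 3) → eval ℚ-extension c p ≢ + 0 / 1 → p ∉ ideal ℙ²
  ∉ℙ² p c p≢0 p∈ = p≢0 (Eval.ev-ideal ℚ-extension {ρ = c} (λ ()) p∈)

  φ : RationalMap ℙ² X
  φ = record
    { coords      = φ-coords
    ; degree      = 5
    ; homogeneous = λ
      { 0F → mul (var _) N-quartic
      ; 1F → add (mul (mul (con _) (var _)) N-quartic) (mul (mul (var _) (var _)) D-cubic)
      ; 2F → add (mul (var _) N-quartic) (mul (mul (var _) (var _)) D-cubic)
      ; 3F → add (mul (mul (con _) (var _)) N-quartic) (mul (mul (var _) (var _)) D-cubic)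
      ; 4F → mul (mul (var _) (var _)) D-cubic
      }
    ; nonzero     = 4F , ∉ℙ² (φ-coords 4F) (+ 0 / 1 ∷ + 0 / 1 ∷ + 1 / 1 ∷ []) (λ ())
    ; lands       = λ p∈X → ev-⟨⟩ con-hom
        (λ { (inj₁ refl) → resp identity zero ; (inj₂ refl) → resp identity zero }) (X-gen⊆quadrics p∈X)
    }

  φ-isGiven : IsGivenByφ φ
  φ-isGiven = record
    { defined   = λ Z≋0 → contradiction (Eval.ev-cong ℚ-extension {ρ = + 0 / 1 ∷ + 0 / 1 ∷ []} Z≋0) (λ ())
    ; x-formula = identity
    ; y-formula = identity
    ; u-formula = identity
    ; v-formula = identity
    }

  𝟚′ e : Poly ℚ-field 5
  𝟚′ = con (+ 2 / 1)
  e = u :- x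

  -- ƛ = (u - x) / z and μ = (v z - 2 (u - x) x) / z².
  ψ-coords : Vector (Poly ℚ-field 5) 3
  ψ-coords = e :* z ∷ v :* z :- 𝟚′ :* e :* x ∷ z :* z ∷ []

  e-linear : Homogeneous 1 e
  e-linear = add (var _) (neg (var _))

  -- The point (0 : 0 : 0 : 0 : 1).
  origin : Point X ℚ-extension
  origin = point (+ 0 / 1 ∷ + 0 / 1 ∷ + 0 / 1 ∷ + 0 / 1 ∷ + 1 / 1 ∷ []) (4F , λ ()) refl refl

  ψ : RationalMap X ℙ²
  ψ = record
    { coords      = ψ-coords
    ; degree      = 2
    ; homogeneous = λ
      { 0F → mul e-linear (var _)
      ; 1F → add (mul (var _) (var _)) (neg (mul (mul (con _) e-linear) (var _)))
      ; 2F → mul (var _) (var _)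
      }
    ; nonzero     = 2F , nonzero-at⇒∉X origin {z :* z} (λ ())
    ; lands       = λ ()
    }

  equations-vanish : ∀ {p} → p ∈ Affine.equations → eval ℚ-extension (λ _ → + 0 / 1) p ≡ + 0 / 1
  equations-vanish (inj₁ refl) = refl
  equations-vanish (inj₂ refl) = refl

  ψ-isGiven : IsGivenByψ ψ
  ψ-isGiven = record
    { defined   = λ N∈ → contradiction (Eval.ev-ideal ℚ-extension equations-vanish N∈) (λ ())
    ; ƛ-formula = ≋⇒mod identity
    ; μ-formula = ≋⇒mod identity
    }

  -- The composite is g times the identity of the plane.
  ψ∘φ : IsLeftInverse ψ φ
  ψ∘φ = (2F , ∉ℙ² (subst φ-coords (z :* z)) (+ 0 / 1 ∷ + 0 / 1 ∷ + 1 / 1 ∷ []) (λ ())) ,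
    λ i j → resp (≋-trans (≋-sym (CommutativeRing.-‿inverseʳ (polyRing ℚ-field 3) (g :* (var i :* var j))))
      (+-cong (mult i j) (neg-cong (≋-trans (*-cong ≋-refl (*-comm _ _)) (mult j i))))) zero
    where
    g : Poly ℚ-field 3
    g = ν :* ν :* ν :* D :* D
    component : ∀ i → g :* var i ≋ subst φ-coords (ψ-coords i)
    component = λ { 0F → identity ; 1F → identity ; 2F → identity }
    mult : ∀ i j → g :* (var i :* var j) ≋ subst φ-coords (ψ-coords i) :* var j
    mult i j = ≋-trans (≋-sym (*-assoc _ _ _)) (*-cong (component i) ≋-refl)

  -- The composite is g times the identity of X modulo the ideal of X.
  φ∘ψ : IsLeftInverse φ ψ
  φ∘ψ = (4F , nonzero-at⇒∉X origin {subst ψ-coords (φ-coords 4F)} (λ ())) , λ i j → begin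
    composite i :* var j          ≈⟨ Xᵣ.*-congʳ (component i) ⟨
    g :* var i :* var j           ≈⟨ ≋⇒mod (solve 3 (λ g a b → g ⊗ a ⊗ b ⊜ g ⊗ b ⊗ a) ≋-refl g (var i) (var j)) ⟩
    g :* var j :* var i           ≈⟨ Xᵣ.*-congʳ (component j) ⟩
    composite j :* var i          ∎
    where
    open SetoidReasoning Xᵣ.setoid
    open IntegerCoefficients (polyRing ℚ-field 5)
    composite : Vector (Poly ℚ-field 5) 5
    composite i = subst ψ-coords (φ-coords i)
    -- At ψ, the polynomials μ, D and N become M, z³ D′ and z⁴ N′.
    M D′ N′ g : Poly ℚ-field 5
    M  = v :* z :- 𝟚′ :* e :* x
    D′ = con (+ 4 / 1) :* e :* e :* e :- con (+ 4 / 1) :* e :* M :+ z :* z :* z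
    N′ = M :* M :- e :* e :* e :* e
    g  = z :* z :* z :* z :* z :* z :* D′

    z⁵ z⁶ w : Poly ℚ-field 5
    z⁵ = z :* z :* z :* z :* z
    z⁶ = z⁵ :* z
    w  = e :* e :+ 𝟚′ :* e :* x :+ y :* z

    combination : ∀ a b → (a :* Q₁ :+ b :* Q₂) ∈ ideal X
    combination a b = add (mul a (gen (quadrics⊆X-gen (inj₁ refl)))) (mul b (gen (quadrics⊆X-gen (inj₂ refl))))

    -- Because of y z = e² + 2 e x + Q₁ and x D′ = N′ + z² Q₂ - w Q₁.
    component : ∀ i → g :* var i ≡ composite i [mod ideal X ]
    component 0F = resp identity (combination (:- (z⁶ :* w)) (z⁶ :* z :* z))
    component 1F = resp identity (combination (z⁵ :* (D′ :- 𝟚′ :* e :* w)) (𝟚′ :* e :* z⁶ :* z))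
    component 2F = resp identity (combination (:- (z⁶ :* w)) (z⁶ :* z :* z))
    component 3F = resp identity (combination (:- (𝟚′ :* e :* z⁵ :* w)) (𝟚′ :* e :* z⁶ :* z))
    component 4F = ≋⇒mod identity

  φ-isBirational : IsBirational φ
  φ-isBirational = ψ , ψ∘φ , φ∘ψ

mainTheorem1 : (ClosedSubscheme.ideal X ≐ ClosedSubscheme.ideal (intersection Q₁-quadratic Q₂-quadratic)) ×
    IsSmoothOfDimension 2 X ×
    IsDelPezzo 4 X ×
    (Σ[ φ ∈ RationalMap ℙ² X ] (IsGivenByφ φ × IsBirational φ ×
    (Σ[ ψ ∈ RationalMap X ℙ² ] (IsGivenByψ ψ × AreInverse φ ψ))))
mainTheorem1 =
  X-isIntersection , X-smooth , X-isDelPezzo ,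
  φ , φ-isGiven , φ-isBirational , ψ , ψ-isGiven , ψ∘φ , φ∘ψ
  where open Parametrisation
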